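{- Let $\nu$ be a positive integer, and let $N_k = n_k+n_{k+1}+\dots +n_{\nu}$, for $k=1,2,\dots, \nu$. Then, for non-negative integers $L,M$, \begin{align*} \sum_{\substack{i,m,n_1,n_2,\dots,n_\nu\geq 0,\\ i+m\equiv N_1+N_2+\dots +N_\nu\text{ (mod 2)}}} &q^{\frac{m^2+3(i^2+N_1^2+N_2^2+\dots+N_\nu^2)}{2}}{L+M-i\brack L}_{q^3}{L-N_1 \brack i}_{q^3} {3n_\nu \brack m}_{q}\\ &\times{2n_\nu + \frac{i-m-N_1-N_2-\dots-N_\nu}{2}\brack 2n_\nu}_{q^3} \prod_{j=1}^{\nu-1}{i-\sum_{l=1}^{j} N_l+n_j \brack n_j}_{q^3}\\ & = \sum_{j=-\infty}^\infty q^{3{\nu+2 \choose 2}j^2+j}\, \mathcal{S}\left(L,M;\,(\nu+2)j,\,(\nu+1)j;\,q^3\right). \end{align*}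
   Context: Here $|q|<1$, $(a;q)_n=(1-a)(1-aq)\cdots(1-aq^{n-1})$, and ${m+n \brack m}_q = \frac{(q;q)_{m+n}}{(q;q)_m(q;q)_n}$ for $m,n\geq 0$ and $0$ otherwise. The refined $q$-trinomial coefficient (Warnaar) is \[\mathcal{S}(L,M;\,a,b;\,q) := \sum_{n\geq0} q^{n(n+a)} {M+L-a-2n\brack M}_q {M-a+b \brack n}_q {M+a-b \brack n+a}_q.\] -}

module Defs where

open import Level using (Level)
open import Algebra.Bundles using (CommutativeRing; Semiring)
open import Data.Nat as ℕ using (ℕ; zero; suc)
open import Data.Nat.Combinatorics using (_C_)
open import Data.Integer as ℤ using (ℤ; +_; -[1+_]; ∣_∣)
open import Data.Integer.DivMod using (_/ℕ_)
open import Data.Fin using (Fin; fromℕ; toℕ; inject₁) renaming (zero to fzero; suc to fsuc)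
open import Data.Vec.Functional using (_∷_; []; head; tail)
open import Relation.Nullary using (yes; no)
open import Relation.Binary.PropositionalEquality using (_≡_)

module Q {c ℓ : Level} (R : CommutativeRing c ℓ) where
  open CommutativeRing R
  open import Algebra.Definitions.RawSemiring (Semiring.rawSemiring semiring) using (_^_)

  -- Gaussian binomial [n brack k]_p for n k : ℕ (polynomial in p),
  -- via the q-Pascal rule; equals 0 when k > n.
  qbin : Carrier → ℕ → ℕ → Carrier
  qbin p zero    zero    = 1#
  qbin p zero    (suc k) = 0#
  qbin p (suc n) zero    = 1#
  qbin p (suc n) (suc k) = qbin p n k + (p ^ suc k) * qbin p n (suc k)

  -- [A brack B]_p for integers A B : equal to 0 unless 0 ≤ B ≤ A
  -- (paper's convention: {m+n brack m} for m,n ≥ 0, 0 otherwise).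
  qbinℤ : Carrier → ℤ → ℤ → Carrier
  qbinℤ p (+ a)    (+ b)    = qbin p a b
  qbinℤ p (+ a)    -[1+ _ ] = 0#
  qbinℤ p -[1+ _ ] _        = 0#

  sumTo : ℕ → (ℕ → Carrier) → Carrier
  sumTo zero    f = f 0
  sumTo (suc B) f = sumTo B f + f (suc B)

  sumℤ : ℕ → (ℤ → Carrier) → Carrier
  sumℤ B f = sumTo B (λ j → f (+ j)) + sumTo B (λ j → f -[1+ j ]) + (- f -[1+ B ])
  -- (the last correction removes j = -(B+1); hence exactly j ∈ [-B, B])

  sumBox : (k : ℕ) → ℕ → ((Fin k → ℕ) → Carrier) → Carrier
  sumBox zero    B f = f []
  sumBox (suc k) B f = sumTo B (λ x → sumBox k B (λ v → f (x ∷ v)))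

  -- Warnaar's refined q-trinomial coefficient S(L,M;a,b;p), with the
  -- sum over n truncated at n ≤ B (the summand vanishes for n > M-a+b).
  -- The exponent n(n+a) is taken as ∣ n(n+a) ∣; whenever n + a < 0 the
  -- factor [M+a-b brack n+a] is 0, so this does not change the value.
  Sref : ℕ → Carrier → ℕ → ℕ → ℤ → ℤ → Carrier
  Sref B p L M a b = sumTo B λ n →
      (p ^ ∣ (+ n) ℤ.* ((+ n) ℤ.+ a) ∣)
    * qbinℤ p ((+ (M ℕ.+ L)) ℤ.- a ℤ.- (+ (2 ℕ.* n))) (+ M)
    * qbinℤ p ((+ M) ℤ.- a ℤ.+ b) (+ n)
    * qbinℤ p ((+ M) ℤ.+ a ℤ.- b) ((+ n) ℤ.+ a)

  sumFin : (k : ℕ) → (Fin k → ℕ) → ℕ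
  sumFin zero    f = 0
  sumFin (suc k) f = f fzero ℕ.+ sumFin k (λ x → f (fsuc x))

  -- N_k = n_k + … + n_ν, with index l : Fin ν standing for k = toℕ l + 1
  Nk : (ν : ℕ) → (Fin ν → ℕ) → Fin ν → ℕ
  Nk (suc ν) n fzero    = sumFin (suc ν) n
  Nk (suc ν) n (fsuc l) = Nk ν (λ x → n (fsuc x)) l

  sumN : (ν : ℕ) → (Fin ν → ℕ) → ℕ
  sumN ν n = sumFin ν (Nk ν n)

  sumN² : (ν : ℕ) → (Fin ν → ℕ) → ℕ
  sumN² ν n = sumFin ν (λ l → Nk ν n l ℕ.* Nk ν n l)

  pre : (k : ℕ) → (Fin k → ℕ) → Fin k → ℕ
  pre (suc k) f fzero    = f fzero
  pre (suc k) f (fsuc l) = f fzero ℕ.+ pre k (λ x → f (fsuc x)) l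

  -- Σ_{l=1}^{j} N_l  for j = toℕ l + 1
  prefN : (ν : ℕ) → (Fin ν → ℕ) → Fin ν → ℕ
  prefN ν n = pre ν (Nk ν n)

  prodFin : (k : ℕ) → (Fin k → Carrier) → Carrier
  prodFin zero    f = 1#
  prodFin (suc k) f = f fzero * prodFin k (λ x → f (fsuc x))

  ifEven : ℕ → Carrier → Carrier
  ifEven t x with t ℕ.% 2 ℕ.≟ 0
  ... | yes _ = x
  ... | no  _ = 0#

  -- summand of the left-hand side, for ν = suc k; n_j = n (j-1)
  lhsTerm : Carrier → (k : ℕ) → ℕ → ℕ → ℕ → ℕ → (Fin (suc k) → ℕ) → Carrier
  lhsTerm q k L M i m n =
    ifEven (i ℕ.+ m ℕ.+ sumN ν n)
      ( (q ^ ((m ℕ.* m ℕ.+ 3 ℕ.* (i ℕ.* i ℕ.+ sumN² ν n)) ℕ./ 2))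
      * qbinℤ q³ (+ (L ℕ.+ M) ℤ.- + i) (+ L)
      * qbinℤ q³ (+ L ℤ.- + N₁) (+ i)
      * qbinℤ q (+ (3 ℕ.* nν)) (+ m)
      * qbinℤ q³ ((+ (2 ℕ.* nν)) ℤ.+ (((+ i) ℤ.- (+ m) ℤ.- (+ sumN ν n)) /ℕ 2)) (+ (2 ℕ.* nν))
      * prodFin k (λ j → qbinℤ q³ ((+ i) ℤ.- (+ prefN ν n (inject₁ j)) ℤ.+ (+ n (inject₁ j))) (+ n (inject₁ j))))
    where
      ν = suc k
      q³ = q ^ 3
      nν = n (fromℕ k)
      N₁ = Nk ν n fzero

  LHS : Carrier → (k : ℕ) → ℕ → ℕ → ℕ → Carrier
  LHS q k B L M = sumTo B λ i → sumTo B λ m → sumBox (suc k) B λ n → lhsTerm q k L M i m n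

  -- right-hand side, for ν = suc k, sum over j truncated to [-B,B]
  -- (exponent 3·C(ν+2,2)·j² + j is always ≥ 0, so ∣_∣ is harmless)
  RHS : Carrier → (k : ℕ) → ℕ → ℕ → ℕ → Carrier
  RHS q k B L M = sumℤ B λ j →
      (q ^ ∣ (+ (3 ℕ.* ((ν ℕ.+ 2) C 2))) ℤ.* j ℤ.* j ℤ.+ j ∣)
    * Sref B (q ^ 3) L M ((+ (ν ℕ.+ 2)) ℤ.* j) ((+ (ν ℕ.+ 1)) ℤ.* j)
    where ν = suc k

{-# OPTIONS --safe #-}
-- With p = q³, T(L,M;a,b) is the coefficient of z^L w^a in
-- (-z p^½;p)_M / ((z/w;p)_{M+b+1} (zw;p)_{M-b+1}) and hence satisfies first-order recurrences.
-- Warnaar's transformations T → T and T → S follow from these by telescoping sums, first for b = 0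
-- by induction on M and then from b to b + 1; no step divides, so they hold in every commutative ring.
-- The sum Σ_j q^(3j²/2+j) T(L,M;j,j;q³) satisfies the same recurrence in M as
-- Σ_m q^(m²/2) [3M brack m]_q [2M + (L-m)/2 brack 2M]_{q³}.
-- Applying T → T ν times and T → S once to this evaluation yields the theorem.
module Submission where

open import Defs
open import Level using (Level)
open import Algebra.Bundles using (CommutativeRing; AbelianGroup)
open import Data.Nat using (ℕ; suc; _≤_)
open import Data.Product using (∃-syntax)
open import Data.Nat as ℕ using (zero; _∸_; z≤n; s≤s)
import Data.Nat.Properties as ℕₚ
open import Data.Nat.Combinatorics using (_C_; nCk+nC[k+1]≡[n+1]C[k+1]; nC1≡n)
open import Data.Nat.DivMod using (m*n%n≡0; [m+kn]%n≡m%n; m*n/n≡m)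
open import Data.Nat.Solver using () renaming (module +-*-Solver to ℕS)
open import Data.Integer as ℤ using (ℤ; +_; -[1+_]; ∣_∣)
import Data.Integer.Properties as ℤₚ
open import Data.Integer.DivMod using (_/ℕ_)
open import Data.Integer.Solver using () renaming (module +-*-Solver to ℤS)
open import Data.Fin using (Fin; fromℕ; inject₁) renaming (zero to fzero; suc to fsuc)
open import Data.Vec.Functional using (_∷_; [])
open import Data.Product using (∃; _,_; _×_; proj₁)
open import Data.Sum as Sum using ()
open import Data.Empty using (⊥-elim)
open import Relation.Nullary using (yes; no)
open import Relation.Binary.Definitions using (tri<; tri≈; tri>)
open import Relation.Binary.PropositionalEquality as ≡ using (_≡_)
import Algebra.Properties.Semiring.Exp

-- Half-integral powers of `q` enter every single step, although only integral ones survive in the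
-- result. The argument therefore runs in a ring where `q = r * r`, with `s` the cube of `r` and
-- `p = s * s`. Adjoining the root gives a free module on 1 and √q, so an equality between elements
-- of the base ring can be read off in the first component.
--
-- A series in z and w is stored as one sequence for each a ≥ 0, indexed by L - a. With x = z/w and
-- y = zw, multiplication by x raises a and shifts the index by two, while multiplication by y only
-- lowers a. The value a = -1, which is not stored, is reached through the reflection of w into 1/w
-- where the series is symmetric.
--
-- Each recurrence is arranged so that the unknown recurs only at smaller arguments. Two solutions
-- are then compared by induction and additive cancellation, and no factor such as 1 - p^n x has to
-- be inverted. Negative terms are moved across the equality throughout, so that a solver over
-- natural coefficients can verify the polynomial identities.
--
-- The parity condition on the left needs no separate treatment in the series, because the
-- denominators involved are series in z².

module Sequences {c ℓ : Level} (R : CommutativeRing c ℓ) where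
  open CommutativeRing R
  open import Algebra.Properties.Semiring.Exp semiring
  open import Algebra.Properties.AbelianGroup +-abelianGroup using () renaming (∙-cancelʳ to +-cancelʳ)
  open import Algebra.Solver.Ring.NaturalCoefficients.Default commutativeSemiring
    using (solve; _:=_; _:+_; _:*_; con)
  open import Relation.Binary.Reasoning.Setoid setoid
  open Q R

  *-zeroʳ : ∀ {x y} → y ≈ 0# → x * y ≈ 0#
  *-zeroʳ y≈0 = trans (*-congˡ y≈0) (zeroʳ _)

  *-zeroˡ : ∀ {x y} → x ≈ 0# → x * y ≈ 0#
  *-zeroˡ x≈0 = trans (*-congʳ x≈0) (zeroˡ _)

  -- Formal power series in z: shifts, dilations, convolution, telescoping sums.

  Seq : Set c
  Seq = ℕ → Carrier

  S : Seq → Seq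
  S f zero    = 0#
  S f (suc k) = f k

  -- sh n f k is f (k - n), and 0 when k < n.
  sh : ℕ → Seq → Seq
  sh zero    f = f
  sh (suc n) f = S (sh n f)

  S-cong : ∀ {f g} → (∀ k → f k ≈ g k) → ∀ k → S f k ≈ S g k
  S-cong f≈g zero    = refl
  S-cong f≈g (suc k) = f≈g k

  S-lin : ∀ {f g h} x → (∀ k → f k ≈ g k + x * h k) → ∀ k → S f k ≈ S g k + x * S h k
  S-lin x eq zero    = sym (trans (+-identityˡ _) (zeroʳ x))
  S-lin x eq (suc k) = eq k

  conv : Seq → Seq → Seq
  conv u f zero    = u 0 * f 0
  conv u f (suc k) = u 0 * f (suc k) + conv (λ n → u (suc n)) f k

  conv-cong : ∀ {u w f g} → (∀ k → u k ≈ w k) → (∀ k → f k ≈ g k) → ∀ k → conv u f k ≈ conv w g k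
  conv-cong u≈w f≈g zero    = *-cong (u≈w 0) (f≈g 0)
  conv-cong u≈w f≈g (suc k) =
    +-cong (*-cong (u≈w 0) (f≈g (suc k))) (conv-cong (λ n → u≈w (suc n)) f≈g k)

  conv-linʳ : ∀ u {f g h} x → (∀ k → f k ≈ g k + x * h k) →
              ∀ k → conv u f k ≈ conv u g k + x * conv u h k
  conv-linʳ u {f} {g} {h} x eq zero = trans (*-congˡ (eq 0))
    (solve 4 (λ a b d e → a :* (b :+ d :* e) := a :* b :+ d :* (a :* e)) refl (u 0) (g 0) x (h 0))
  conv-linʳ u {f} {g} {h} x eq (suc k) = trans
    (+-cong (*-congˡ (eq (suc k))) (conv-linʳ (λ n → u (suc n)) x eq k))
    (solve 6 (λ a b d e y z → a :* (b :+ d :* e) :+ (y :+ d :* z) := a :* b :+ y :+ d :* (a :* e :+ z))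
      refl (u 0) (g (suc k)) x (h (suc k)) _ _)

  conv-linˡ : ∀ {u v w} f x → (∀ k → u k ≈ v k + x * w k) →
              ∀ k → conv u f k ≈ conv v f k + x * conv w f k
  conv-linˡ {u} {v} {w} f x eq zero = trans (*-congʳ (eq 0))
    (solve 4 (λ a b d e → (b :+ d :* e) :* a := b :* a :+ d :* (e :* a)) refl (f 0) (v 0) x (w 0))
  conv-linˡ {u} {v} {w} f x eq (suc k) = trans
    (+-cong (*-congʳ (eq 0)) (conv-linˡ f x (λ n → eq (suc n)) k))
    (solve 6 (λ a b d e y z → (b :+ d :* e) :* a :+ (y :+ d :* z) := b :* a :+ y :+ d :* (e :* a :+ z))
      refl (f (suc k)) (v 0) x (w 0) _ _)

  conv-Sˡ : ∀ u f k → conv (S u) f k ≈ S (conv u f) k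
  conv-Sˡ u f zero    = zeroˡ _
  conv-Sˡ u f (suc k) = trans (+-congʳ (zeroˡ _)) (+-identityˡ _)

  conv-Sʳ : ∀ u f k → conv u (S f) k ≈ S (conv u f) k
  conv-Sʳ u f zero          = zeroʳ _
  conv-Sʳ u f (suc zero)    = trans (+-congˡ (conv-Sʳ (λ n → u (suc n)) f 0)) (+-identityʳ _)
  conv-Sʳ u f (suc (suc k)) = +-congˡ (conv-Sʳ (λ n → u (suc n)) f (suc k))

  conv-S²ʳ : ∀ u f k → conv u (S (S f)) k ≈ S (S (conv u f)) k
  conv-S²ʳ u f k = trans (conv-Sʳ u (S f) k) (S-cong (conv-Sʳ u f) k)

  conv-zero : ∀ u {f} → (∀ k → f k ≈ 0#) → ∀ k → conv u f k ≈ 0#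
  conv-zero u f≈0 zero    = *-zeroʳ (f≈0 0)
  conv-zero u f≈0 (suc k) =
    trans (+-cong (*-zeroʳ (f≈0 (suc k))) (conv-zero _ f≈0 k)) (+-identityˡ _)

  ^-+ : ∀ x m n → x ^ (m ℕ.+ n) ≈ x ^ m * x ^ n
  ^-+ = ^-homo-*

  ^-distrib : ∀ x y n → (x * y) ^ n ≈ x ^ n * y ^ n
  ^-distrib x y zero    = sym (*-identityˡ 1#)
  ^-distrib x y (suc n) = trans (*-congˡ (^-distrib x y n))
    (solve 4 (λ a b d e → (a :* b) :* (d :* e) := (a :* d) :* (b :* e)) refl x y _ _)

  scale : Carrier → Seq → Seq
  scale x f n = x ^ n * f n

  S-scale : ∀ x f n → x * S (scale x f) n ≈ scale x (S f) n
  S-scale x f zero    = trans (zeroʳ _) (sym (zeroʳ _))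
  S-scale x f (suc n) = sym (*-assoc _ _ _)

  -- Steps of two, because `E` stores the coefficient of a j-th power at index 2j. At the monomial
  -- x^j y^(j+a) the y-exponent is then read at k + 2a with k = 2j.
  sft : ℕ → Seq → Seq
  sft zero    f k = f k
  sft (suc a) f k = sft a f (suc (suc k))

  sft-cong : ∀ a {f g} → (∀ k → f k ≈ g k) → ∀ k → sft a f k ≈ sft a g k
  sft-cong zero    eq k = eq k
  sft-cong (suc a) eq k = sft-cong a eq (suc (suc k))

  sft-zero : ∀ a {f} → (∀ k → f k ≈ 0#) → ∀ k → sft a f k ≈ 0#
  sft-zero zero    eq k = eq k
  sft-zero (suc a) eq k = sft-zero a eq (suc (suc k))

  conv-homˡ : ∀ {u w} f x → (∀ n → u n ≈ x * w n) → ∀ k → conv u f k ≈ x * conv w f k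
  conv-homˡ f x eq zero    = trans (*-congʳ (eq 0)) (*-assoc _ _ _)
  conv-homˡ f x eq (suc k) = trans
    (+-cong (trans (*-congʳ (eq 0)) (*-assoc _ _ _)) (conv-homˡ f x (λ n → eq (suc n)) k))
    (sym (distribˡ _ _ _))

  -- Substituting xz for z is multiplicative: in each product the two powers of x combine to x^k.
  conv-scale : ∀ x u f k → conv (scale x u) (scale x f) k ≈ x ^ k * conv u f k
  conv-scale x u f zero    = solve 2 (λ a b → (con 1 :* a) :* (con 1 :* b) := con 1 :* (a :* b)) refl _ _
  conv-scale x u f (suc k) = trans
    (+-congˡ (trans (conv-homˡ (scale x f) x (λ n → *-assoc x (x ^ n) (u (suc n))) k)
                    (*-congˡ (conv-scale x (λ n → u (suc n)) f k))))
    (solve 5 (λ x y a b z → (con 1 :* a) :* (x :* y :* b) :+ x :* (y :* z) := x :* y :* (a :* b :+ z)) refl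
      x (x ^ k) (u 0) (f (suc k)) _)

  ≡⇒≈ : ∀ {x y} → x ≡ y → x ≈ y
  ≡⇒≈ ≡.refl = refl

  sum-cong : ∀ B {f g} → (∀ i → f i ≈ g i) → sumTo B f ≈ sumTo B g
  sum-cong zero    eq = eq 0
  sum-cong (suc B) eq = +-cong (sum-cong B eq) (eq (suc B))

  sum-+ : ∀ B {f g} → sumTo B (λ i → f i + g i) ≈ sumTo B f + sumTo B g
  sum-+ zero    = refl
  sum-+ (suc B) {f} {g} = trans (+-congʳ (sum-+ B))
    (solve 4 (λ a b d e → (a :+ b) :+ (d :+ e) := (a :+ d) :+ (b :+ e)) refl _ _ (f (suc B)) (g (suc B)))

  sum-*ˡ : ∀ B x {f} → sumTo B (λ i → x * f i) ≈ x * sumTo B f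
  sum-*ˡ zero    x = refl
  sum-*ˡ (suc B) x = trans (+-congʳ (sum-*ˡ B x)) (sym (distribˡ _ _ _))

  sum-lin : ∀ B x {f g h} → (∀ i → f i ≈ g i + x * h i) → sumTo B f ≈ sumTo B g + x * sumTo B h
  sum-lin B x eq = trans (sum-cong B eq) (trans (sum-+ B) (+-congˡ (sum-*ˡ B x)))

  sum-zero : ∀ B {f} → (∀ i → f i ≈ 0#) → sumTo B f ≈ 0#
  sum-zero zero    eq = eq 0
  sum-zero (suc B) eq = trans (+-cong (sum-zero B eq) (eq (suc B))) (+-identityˡ 0#)

  sum-head : ∀ B f → sumTo (suc B) f ≈ f 0 + sumTo B (λ i → f (suc i))
  sum-head zero    f = refl
  sum-head (suc B) f = trans (+-congʳ (sum-head B f)) (+-assoc _ _ _)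

  sum-first : ∀ B {f} → (∀ i → f (suc i) ≈ 0#) → sumTo B f ≈ f 0
  sum-first zero    eq = refl
  sum-first (suc B) eq = trans (+-cong (sum-first B eq) (eq B)) (+-identityʳ _)

  -- The summand of f - g is the increment of v - u. The subtraction-free form keeps each instance
  -- within reach of the solver over natural coefficients.
  telescope : ∀ {f g u v : Seq} N → u 0 ≈ v 0 →
              (∀ i → f i + u (suc i) + v i ≈ g i + v (suc i) + u i) →
              sumTo N f + u (suc N) ≈ sumTo N g + v (suc N)
  telescope {f} {g} {u} {v} zero    u₀≈v₀ eq =
    +-cancelʳ (v 0) _ _ (trans (eq 0) (+-congˡ u₀≈v₀))
  telescope {f} {g} {u} {v} (suc N) u₀≈v₀ eq = +-cancelʳ (v (suc N) + u (suc N)) _ _ (begin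
    (sumTo N f + f (suc N)) + u (suc (suc N)) + (v (suc N) + u (suc N))
      ≈⟨ solve 5 (λ a b d e h → (a :+ b) :+ d :+ (e :+ h) := (a :+ h) :+ (b :+ d :+ e)) refl _ _ _ _ _ ⟩
    (sumTo N f + u (suc N)) + (f (suc N) + u (suc (suc N)) + v (suc N))
      ≈⟨ +-cong (telescope {f} {g} {u} {v} N u₀≈v₀ eq) (eq (suc N)) ⟩
    (sumTo N g + v (suc N)) + (g (suc N) + v (suc (suc N)) + u (suc N))
      ≈⟨ solve 5 (λ a b d e h → (a :+ e) :+ (b :+ d :+ h) := (a :+ b) :+ d :+ (e :+ h)) refl _ _ _ _ _ ⟩
    (sumTo N g + g (suc N)) + v (suc (suc N)) + (v (suc N) + u (suc N)) ∎)

  sh-cong : ∀ n {f g} → (∀ k → f k ≈ g k) → ∀ k → sh n f k ≈ sh n g k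
  sh-cong zero    eq = eq
  sh-cong (suc n) eq = S-cong (sh-cong n eq)

  sh-S : ∀ n f k → sh n (S f) k ≡ S (sh n f) k
  sh-S zero    f k       = ≡.refl
  sh-S (suc n) f zero    = ≡.refl
  sh-S (suc n) f (suc k) = sh-S n f k

  sh-sh : ∀ m n f k → sh m (sh n f) k ≡ sh (m ℕ.+ n) f k
  sh-sh zero    n f k       = ≡.refl
  sh-sh (suc m) n f zero    = ≡.refl
  sh-sh (suc m) n f (suc k) = sh-sh m n f k

  sh-over : ∀ n f k → k ℕ.< n → sh n f k ≡ 0#
  sh-over (suc n) f zero    _         = ≡.refl
  sh-over (suc n) f (suc k) (s≤s k<n) = sh-over n f k k<n

  sh-at : ∀ n f k → sh n f (n ℕ.+ k) ≡ f k
  sh-at zero    f k = ≡.refl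
  sh-at (suc n) f k = sh-at n f k

  sh-lin : ∀ n {f g h} x → (∀ k → f k ≈ g k + x * h k) → ∀ k → sh n f k ≈ sh n g k + x * sh n h k
  sh-lin zero    x eq = eq
  sh-lin (suc n) x eq = S-lin x (sh-lin n x eq)

  sh-zero : ∀ n {f} → (∀ k → f k ≈ 0#) → ∀ k → sh n f k ≈ 0#
  sh-zero zero    eq k       = eq k
  sh-zero (suc n) eq zero    = refl
  sh-zero (suc n) eq (suc k) = sh-zero n eq k

  sh-hom : ∀ n {f g} x → (∀ k → f k ≈ x * g k) → ∀ k → sh n f k ≈ x * sh n g k
  sh-hom zero    x eq k       = eq k
  sh-hom (suc n) x eq zero    = sym (zeroʳ x)
  sh-hom (suc n) x eq (suc k) = sh-hom n x eq k

  sh-scale : ∀ n x f k → x ^ n * sh n (scale x f) k ≈ x ^ k * sh n f k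
  sh-scale zero    x f k       = *-identityˡ _
  sh-scale (suc n) x f zero    = trans (zeroʳ _) (sym (zeroʳ _))
  sh-scale (suc n) x f (suc k) = trans (*-assoc _ _ _) (trans (*-congˡ (sh-scale n x f k)) (sym (*-assoc _ _ _)))

  sh-rel₆ : ∀ n {f₁ f₂ f₃ f₄ f₅ f₆} x y z w →
    (∀ k → f₁ k + x * f₂ k + y * f₃ k ≈ z * f₄ k + w * f₅ k + f₆ k) →
    ∀ k → sh n f₁ k + x * sh n f₂ k + y * sh n f₃ k ≈ z * sh n f₄ k + w * sh n f₅ k + sh n f₆ k
  sh-rel₆ zero    x y z w eq k       = eq k
  sh-rel₆ (suc n) x y z w eq zero    =
    solve 4 (λ x y z w → con 0 :+ x :* con 0 :+ y :* con 0 := z :* con 0 :+ w :* con 0 :+ con 0) refl x y z w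
  sh-rel₆ (suc n) x y z w eq (suc k) = sh-rel₆ n x y z w eq k

  S-zero : ∀ {f} → (∀ k → f k ≈ 0#) → ∀ k → S f k ≈ 0#
  S-zero eq zero    = refl
  S-zero eq (suc k) = eq k

module RefinedTrinomial {c ℓ : Level} (R : CommutativeRing c ℓ) (s : CommutativeRing.Carrier R) where
  open CommutativeRing R
  open import Algebra.Properties.Semiring.Exp semiring
  open import Algebra.Properties.AbelianGroup +-abelianGroup using () renaming (∙-cancelʳ to +-cancelʳ)
  open import Algebra.Solver.Ring.NaturalCoefficients.Default commutativeSemiring
    using (solve; _:=_; _:+_; _:*_; con)
  open import Relation.Binary.Reasoning.Setoid setoid
  open Q R
  open Sequences R

  -- The series 1/(z²;p)_d, 1/(z;p)_L and (-sz;p)_M.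

  p : Carrier
  p = s * s

  sⁿsⁿ : ∀ n → s ^ n * s ^ n ≈ p ^ n
  sⁿsⁿ n = sym (^-distrib s s n)

  -- E (suc m) k is [m + k/2 brack m] for even k and 0 for odd k; E 0 is the paper's
  -- convention for the negative lower entry -1.
  E : ℕ → Seq
  E zero    k             = 0#
  E (suc d) zero          = 1#
  E (suc d) (suc zero)    = 0#
  E (suc d) (suc (suc k)) = E d (suc (suc k)) + p ^ d * E (suc d) k

  -- The defining rule cancels the last factor of 1/(z²;p)_(d+1). Here the first factor 1 - z² is
  -- cancelled, and the power of s comes from the dilation by p of the factors that remain.
  E-dual : ∀ d k → E (suc d) (suc (suc k)) ≈ E (suc d) k + s ^ suc (suc k) * E d (suc (suc k))
  E-dual zero k = solve 2 (λ e t → con 0 :+ con 1 :* e := e :+ t :* con 0) refl _ _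
  E-dual (suc d) zero = trans (+-congʳ (E-dual d 0))
    (solve 3 (λ s x e → con 1 :+ s :* (s :* con 1) :* e :+ (s :* s :* x) :* con 1
      := con 1 :+ s :* (s :* con 1) :* (e :+ x :* con 1)) refl s (p ^ d) (E d 2))
  E-dual (suc d) (suc zero) = trans (+-congʳ (E-dual d 1))
    (solve 4 (λ s x e t → con 0 :+ t :* e :+ (s :* s :* x) :* con 0
      := con 0 :+ t :* (e :+ x :* con 0)) refl s (p ^ d) (E d 3) (s ^ 3))
  E-dual (suc d) (suc (suc k)) = trans (+-cong (E-dual d (suc (suc k))) (*-congˡ (E-dual (suc d) k)))
    (solve 6 (λ s t x e₂ e₀ e₄ →
        e₂ :+ s :* (s :* t) :* e₄ :+ s :* s :* x :* (e₀ :+ t :* e₂)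
        := e₂ :+ s :* s :* x :* e₀ :+ s :* (s :* t) :* (e₄ :+ x :* e₂))
      refl s (s ^ suc (suc k)) (p ^ d) (E (suc d) (suc (suc k))) (E (suc (suc d)) k)
      (E d (suc (suc (suc (suc k))))))

  -- gx (suc L) k is [L + k brack L]; gx 0 is chosen so that both Pascal rules hold at L = 0.
  gx : ℕ → Seq
  gx zero    zero    = 1#
  gx zero    (suc k) = 0#
  gx (suc L) zero    = 1#
  gx (suc L) (suc k) = gx L (suc k) + p ^ L * gx (suc L) k

  gx-pascal : ∀ L k → gx (suc L) k ≈ gx L k + p ^ L * S (gx (suc L)) k
  gx-pascal zero    zero    = sym (trans (+-congˡ (zeroʳ _)) (+-identityʳ _))
  gx-pascal (suc L) zero    = sym (trans (+-congˡ (zeroʳ _)) (+-identityʳ _))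
  gx-pascal L       (suc k) = refl

  -- Cancels the first factor 1 - z of 1/(z;p)_(L+1), where `gx-pascal` cancels the last. The power
  -- p^k is the dilation of what remains.
  gx-dual : ∀ L k → gx (suc L) k ≈ S (gx (suc L)) k + p ^ k * gx L k
  gx-dual zero    zero    = sym (trans (+-identityˡ _) (*-identityˡ _))
  gx-dual (suc L) zero    = sym (trans (+-identityˡ _) (*-identityˡ _))
  gx-dual zero    (suc k) = solve 2 (λ g x → con 0 :+ con 1 :* g := g :+ x :* con 0) refl _ _
  gx-dual (suc L) (suc k) = trans (+-cong (gx-dual L (suc k)) (*-congˡ (gx-dual (suc L) k)))
    (trans (solve 7 (λ s x a b d e y → a :+ (s :* s) :* y :* b :+ ((s :* s) :* x) :* (d :+ y :* a)
        := (a :+ ((s :* s) :* x) :* d) :+ ((s :* s) :* y) :* (b :+ x :* a)) refl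
        s (p ^ L) (gx (suc L) k) (gx L (suc k)) (S (gx (suc (suc L))) k) 0# (p ^ k))
      (+-congʳ (sym (gx-pascal (suc L) k))))

  -- cf M n = s^(n²) [M brack n]_p
  cf : ℕ → Seq
  cf zero    zero    = 1#
  cf zero    (suc n) = 0#
  cf (suc M) n       = cf M n + (p ^ M * s) * S (cf M) n

  -- Splits the first factor 1 + sz off (-sz;p)_(M+1), whereas the recursion of `cf` splits off the
  -- last.
  cf-dual : ∀ M n → cf (suc M) n ≈ scale p (cf M) n + s * S (scale p (cf M)) n
  cf-dual zero    zero    = solve 2 (λ y s → con 1 :+ y :* con 0 := con 1 :* con 1 :+ s :* con 0) refl _ _
  cf-dual zero    (suc zero) = solve 1 (λ s → con 0 :+ con 1 :* s :* con 1 := s :* s :* con 1 :* con 0 :+ s :* (con 1 :* con 1)) refl s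
  cf-dual zero    (suc (suc n)) = solve 4 (λ s x y z → con 0 :+ y :* con 0 := x :* con 0 :+ s :* (z :* con 0)) refl _ _ _ _
  cf-dual (suc M) n = begin
    cf (suc M) n + (p * p ^ M * s) * S (cf (suc M)) n
      ≈⟨ +-cong (cf-dual M n) (*-congˡ (S-lin s (cf-dual M) n)) ⟩
    (A n + s * S A n) + (p * p ^ M * s) * (S A n + s * S (S A) n)
      ≈⟨ solve 5 (λ s x a b d → (a :+ s :* b) :+ (s :* s :* x :* s) :* (b :+ s :* d)
           := (a :+ (x :* s) :* (s :* s :* b)) :+ s :* (b :+ (x :* s) :* (s :* s :* d))) refl
           s (p ^ M) (A n) (S A n) (S (S A) n) ⟩
    (A n + (p ^ M * s) * (p * S A n)) + s * (S A n + (p ^ M * s) * (p * S (S A) n))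
      ≈⟨ +-cong (main n) (*-congˡ (lem n)) ⟨
    scale p (cf (suc M)) n + s * S (scale p (cf (suc M))) n ∎
    where
    A : Seq
    A = scale p (cf M)
    main : ∀ n → scale p (cf (suc M)) n ≈ A n + (p ^ M * s) * (p * S A n)
    main n = trans (solve 4 (λ y a z b → y :* (a :+ z :* b) := y :* a :+ z :* (y :* b)) refl
                      (p ^ n) (cf M n) (p ^ M * s) (S (cf M) n))
                   (+-congˡ (*-congˡ (sym (S-scale p (cf M) n))))
    lem : ∀ n → S (scale p (cf (suc M))) n ≈ S A n + (p ^ M * s) * (p * S (S A) n)
    lem zero    = sym (trans (+-identityˡ _) (*-zeroʳ (zeroʳ _)))
    lem (suc n) = main n

  -- Quotients by (x;p)_m (y;p)_d and the cancellation of one factor.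

  sft-E : ∀ a d k → sft (suc a) (E (suc d)) k ≈ sft (suc a) (E d) k + p ^ d * sft a (E (suc d)) k
  sft-E zero    d k = refl
  sft-E (suc a) d k = sft-E a d (suc (suc k))

  sft-E-dual : ∀ a d k → sft (suc a) (E (suc d)) k
               ≈ sft a (E (suc d)) k + p ^ suc a * (s ^ k * sft (suc a) (E d) k)
  sft-E-dual zero    d k = trans (E-dual d k) (+-congˡ
    (solve 3 (λ s x e → s :* (s :* x) :* e := s :* s :* con 1 :* (x :* e)) refl s (s ^ k) _))
  sft-E-dual (suc a) d k = trans (sft-E-dual a d (suc (suc k))) (+-congˡ
    (solve 4 (λ s x y e → y :* (s :* (s :* x) :* e) := s :* s :* y :* (x :* e)) refl s (s ^ k) (p ^ suc a) _))

  -- Raising a while lowering the index by 2 multiplies the generating function by x = z/w;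
  -- lowering a multiplies it by y = zw. U-x and U-y cancel one factor of a denominator (x;p) or (y;p).
  U : Seq → ℕ → ℕ → ℕ → Seq
  U u m d a = conv u (λ k → E m k * sft a (E d) k)

  -- At x^j y^(j+a) the weight s^k is p^j, so the denominators are those with x replaced by px.
  -- Multiplied by p^a, the same numbers are the coefficients with y replaced by py. This double
  -- reading links cancellations in x with cancellations in y.
  J : Seq → ℕ → ℕ → ℕ → Seq
  J u m d a = conv u (λ k → s ^ k * (E m k * sft a (E d) k))

  -- The weight p^(2j), completed by p^a, dilates x and y simultaneously.
  K : Seq → ℕ → ℕ → ℕ → Seq
  K u m d a = conv u (λ k → p ^ k * (E m k * sft a (E d) k))

  -- The reflection of w into 1/w exchanges x and y and fixes a = 0.
  U-sym : ∀ u m d k → U u m d 0 k ≈ U u d m 0 k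
  U-sym u m d = conv-cong (λ _ → refl) (λ k → *-comm _ _)

  J-sym : ∀ u m d k → J u m d 0 k ≈ J u d m 0 k
  J-sym u m d = conv-cong (λ _ → refl) (λ k → *-congˡ (*-comm _ _))

  U-zero : ∀ u m a k → U u m 0 a k ≈ 0#
  U-zero u m a = conv-zero u (λ k → *-zeroʳ (sft-zero a (λ _ → refl) k))

  J-zero : ∀ u m a k → J u m 0 a k ≈ 0#
  J-zero u m a = conv-zero u (λ k → *-zeroʳ (*-zeroʳ (sft-zero a (λ _ → refl) k)))

  U-x : ∀ u m d a k → U u (suc (suc m)) d a k
        ≈ U u (suc m) d a k + p ^ suc m * S (S (U u (suc (suc m)) d (suc a))) k
  U-x u m d a k = trans
    (conv-linʳ u {h = S (S (λ k → E (suc (suc m)) k * sft (suc a) (E d) k))} (p ^ suc m) rel k)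
    (+-congˡ (*-congˡ (conv-S²ʳ u _ k)))
    where
    rel : ∀ k → E (suc (suc m)) k * sft a (E d) k ≈ E (suc m) k * sft a (E d) k
          + p ^ suc m * S (S (λ k → E (suc (suc m)) k * sft (suc a) (E d) k)) k
    rel zero          = sym (trans (+-congˡ (zeroʳ _)) (+-identityʳ _))
    rel (suc zero)    = sym (trans (+-congˡ (zeroʳ _)) (+-identityʳ _))
    rel (suc (suc k)) = solve 4 (λ a y b v → (a :+ y :* b) :* v := a :* v :+ y :* (b :* v)) refl _ _ _ _

  U-y : ∀ u m d a k → U u m (suc d) (suc a) k ≈ U u m d (suc a) k + p ^ d * U u m (suc d) a k
  U-y u m d a = conv-linʳ u (p ^ d) (λ k → trans (*-congˡ (sft-E a d k))
    (solve 4 (λ e a y b → e :* (a :+ y :* b) := e :* a :+ y :* (e :* b)) refl (E m k) _ _ _))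

  -- Cancels the factor 1 - x instead of the last one, so the remaining factors start at px.
  U-x-dual : ∀ u m d a k → U u (suc (suc m)) d a k
             ≈ J u (suc m) d a k + 1# * S (S (U u (suc (suc m)) d (suc a))) k
  U-x-dual u m d a k = trans
    (conv-linʳ u {h = S (S (λ k → E (suc (suc m)) k * sft (suc a) (E d) k))} 1# rel k)
    (+-congˡ (*-congˡ (conv-S²ʳ u _ k)))
    where
    rel : ∀ k → E (suc (suc m)) k * sft a (E d) k ≈ s ^ k * (E (suc m) k * sft a (E d) k)
          + 1# * S (S (λ k → E (suc (suc m)) k * sft (suc a) (E d) k)) k
    rel zero          = solve 1 (λ v → con 1 :* v := con 1 :* (con 1 :* v) :+ con 1 :* con 0) refl _
    rel (suc zero)    = solve 2 (λ v s → con 0 :* v := s :* (con 0 :* v) :+ con 1 :* con 0) refl _ _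
    rel (suc (suc k)) = trans (*-congʳ (E-dual (suc m) k))
      (solve 4 (λ a y b v → (a :+ y :* b) :* v := y :* (b :* v) :+ con 1 :* (a :* v)) refl _ _ _ _)

  U-y-dual : ∀ u m d a k → U u m (suc d) (suc a) k ≈ U u m (suc d) a k + p ^ suc a * J u m d (suc a) k
  U-y-dual u m d a = conv-linʳ u (p ^ suc a) (λ k → trans (*-congˡ (sft-E-dual a d k))
    (solve 5 (λ e a y x b → e :* (a :+ y :* (x :* b)) := e :* a :+ y :* (x :* (e :* b))) refl (E m k) _ _ _ _))

  J-x : ∀ u m d a k → J u (suc (suc m)) d a k
        ≈ K u (suc m) d a k + p * S (S (J u (suc (suc m)) d (suc a))) k
  J-x u m d a k = trans
    (conv-linʳ u {h = S (S (λ k → s ^ k * (E (suc (suc m)) k * sft (suc a) (E d) k)))} p rel k)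
    (+-congˡ (*-congˡ (conv-S²ʳ u _ k)))
    where
    rel : ∀ k → s ^ k * (E (suc (suc m)) k * sft a (E d) k) ≈ p ^ k * (E (suc m) k * sft a (E d) k)
          + p * S (S (λ k → s ^ k * (E (suc (suc m)) k * sft (suc a) (E d) k))) k
    rel zero          = solve 2 (λ v s → con 1 :* (con 1 :* v) := con 1 :* (con 1 :* v) :+ s :* con 0) refl _ _
    rel (suc zero)    = solve 4 (λ v s x y → x :* (con 0 :* v) := y :* (con 0 :* v) :+ s :* con 0) refl _ _ _ _
    rel (suc (suc k)) = trans (*-congˡ (*-congʳ (E-dual (suc m) k)))
      (trans (solve 5 (λ s x a b v → s :* (s :* x) :* ((a :+ s :* (s :* x) :* b) :* v)
          := s :* s :* (s :* s :* (x :* x)) :* (b :* v) :+ s :* s :* (x :* (a :* v))) refl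
          s (s ^ k) (E (suc (suc m)) k) (E (suc m) (suc (suc k))) _)
        (+-congʳ (*-congʳ (*-congˡ (*-congˡ (sⁿsⁿ k))))))

  J-y : ∀ u m d a k → J u m (suc d) (suc a) k ≈ J u m (suc d) a k + p ^ suc a * K u m d (suc a) k
  J-y u m d a = conv-linʳ u (p ^ suc a) (λ k → trans (*-congˡ (*-congˡ (sft-E-dual a d k)))
    (trans (solve 5 (λ e a y x b → x :* (e :* (a :+ y :* (x :* b))) := x :* (e :* a) :+ y :* ((x :* x) :* (e :* b))) refl (E m k) _ _ _ _)
      (+-congˡ (*-congˡ (*-congʳ (sⁿsⁿ k))))))

  sft-E₀ : ∀ d k → sft k (E (suc d)) 0 ≈ gx (suc d) k
  sft-E₀ d zero = refl
  sft-E₀ zero (suc k) = trans (sft-E k 0 0) (trans (+-cong (sft-zero (suc k) (λ _ → refl) 0) (*-congˡ (sft-E₀ 0 k))) refl)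
  sft-E₀ (suc d) (suc k) = trans (sft-E k (suc d) 0) (+-cong (sft-E₀ d (suc k)) (*-congˡ (sft-E₀ (suc d) k)))

  gx-one : ∀ k → gx 1 k ≈ 1#
  gx-one zero    = refl
  gx-one (suc k) = trans (+-identityˡ _) (trans (*-identityˡ _) (gx-one k))

  -- Symmetry of the Gaussian binomial exchanges its two Pascal rules.
  gx-sym : ∀ L k → gx (suc L) k ≈ gx (suc k) L
  gx-sym zero    k       = gx-one k
  gx-sym (suc L) zero    = sym (gx-one (suc L))
  gx-sym (suc L) (suc k) = begin
    gx (suc L) (suc k) + p ^ suc L * gx (suc (suc L)) k
      ≈⟨ +-cong (gx-sym L (suc k)) (*-congˡ (gx-sym (suc L) k)) ⟩
    gx (suc (suc k)) L + p ^ suc L * gx (suc k) (suc L)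
      ≈⟨ gx-dual (suc k) (suc L) ⟨
    gx (suc (suc k)) (suc L) ∎

  -- First transformation: the passage from b to b + 1.

  -- T M b a α is T(L,M;a,b;p) with L = α + a. The truncated suc M ∸ b is 0 for M < b, where E vanishes.
  T : ℕ → ℕ → ℕ → Seq
  T M b a = U (cf M) (suc (M ℕ.+ b)) (suc M ∸ b) a

  T-zero : ∀ M b a k → M ℕ.< b → T M b a k ≈ 0#
  T-zero M b a k M<b rewrite ℕₚ.m≤n⇒m∸n≡0 M<b = U-zero (cf M) (suc (M ℕ.+ b)) a k

  U-cf : ∀ M m d a k → U (cf (suc M)) m d a k ≈ U (cf M) m d a k + (p ^ M * s) * S (U (cf M) m d a) k
  U-cf M m d a k = trans (conv-linˡ _ _ (λ _ → refl) k) (+-congˡ (*-congˡ (conv-Sˡ (cf M) _ k)))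

  square-suc : ∀ i → s ^ (suc i ℕ.* suc i) ≈ s ^ (i ℕ.* i) * (p ^ i * s)
  square-suc i = trans (^-congʳ s (≡.cong suc (≡.trans (≡.cong (i ℕ.+_) (ℕₚ.*-suc i i)) (≡.sym (ℕₚ.+-assoc i i _)))))
    (trans (*-congˡ (trans (^-+ s (i ℕ.+ i) _) (*-congʳ (trans (^-+ s i i) (sⁿsⁿ i)))))
      (solve 3 (λ s x y → s :* (x :* y) := y :* (x :* s)) refl s _ _))

  module Raise (i b D : ℕ) (i≡ : i ≡ b ℕ.+ D) (a : ℕ) where
    n : ℕ
    n = i ℕ.+ b

    T₁ T₁' T₂ T₂' T₃ T₄ : Seq
    T₁  = U (cf (suc i)) (suc (suc (suc n))) (suc D) a
    T₁' = U (cf (suc i)) (suc (suc (suc n))) (suc D) (suc a)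
    T₂  = U (cf (suc i)) (suc (suc n)) (suc (suc D)) a
    T₂' = U (cf (suc i)) (suc (suc n)) (suc (suc D)) (suc a)
    T₃  = U (cf i) (suc n) (suc D) a
    T₄  = U (cf i) (suc (suc n)) D (suc a)
    H H' : Seq
    H  = U (cf i) (suc (suc n)) (suc D) a
    H' = U (cf i) (suc (suc n)) (suc D) (suc a)

    -- Read `S` at fixed a as multiplication by z, and `S` with a raised as division by w. Pairing
    -- `T₁` with `T₁'` and `T₂` with `T₂'` cancels the last factor in x, respectively y. Every term
    -- is then a multiple of `H`, and both sides amount to (1 + p^b s/w) `H`.
    rel : ∀ k → T₁ k + (p ^ suc i * s) * S T₂ k + (p ^ b * s) * S T₄ k
          ≈ p ^ suc (suc n) * S (S T₁') k + (p ^ b * s) * S T₂' k + T₃ k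
    rel k = begin
      T₁ k + (p ^ suc i * s) * S T₂ k + (p ^ b * s) * S T₄ k
        ≈⟨ +-congʳ (+-cong (trans (U-x (cf (suc i)) (suc n) (suc D) a k) (+-congʳ
              (trans (U-cf i (suc (suc n)) (suc D) a k) (+-congʳ (U-x (cf i) n (suc D) a k)))))
            (*-congʳ (*-congʳ (*-congˡ pⁱ)))) ⟩
      ((T₃ k + p ^ suc n * S (S H') k) + (p ^ i * s) * S H k) + p ^ suc (suc n) * S (S T₁') k
        + (p * (p ^ b * p ^ D) * s) * S T₂ k + (p ^ b * s) * S T₄ k
        ≈⟨ +-congʳ (+-congʳ (+-congʳ (+-cong (+-congˡ (*-congʳ pⁿ)) (*-congʳ (*-congʳ pⁱ))))) ⟩
      ((T₃ k + (p * ((p ^ b * p ^ D) * p ^ b)) * S (S H') k) + (p ^ b * p ^ D * s) * S H k)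
        + p ^ suc (suc n) * S (S T₁') k
        + (p * (p ^ b * p ^ D) * s) * S T₂ k + (p ^ b * s) * S T₄ k
        ≈⟨ solve 10 (λ t s b d hh h y w q g →
             ((t :+ ((s :* s) :* ((b :* d) :* b)) :* hh) :+ (b :* d :* s) :* h) :+ y :* w
             :+ ((s :* s) :* (b :* d) :* s) :* q :+ (b :* s) :* g
             := y :* w :+ (b :* s) :* (((g :+ d :* h) :+ (b :* d :* s) :* hh) :+ (s :* s) :* d :* q) :+ t)
             refl (T₃ k) s (p ^ b) (p ^ D) (S (S H') k) (S H k) (p ^ suc (suc n)) (S (S T₁') k) (S T₂ k) (S T₄ k) ⟩
      p ^ suc (suc n) * S (S T₁') k
        + (p ^ b * s) * (((S T₄ k + p ^ D * S H k) + (p ^ b * p ^ D * s) * S (S H') k) + p ^ suc D * S T₂ k) + T₃ k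
        ≈⟨ +-congʳ (+-congˡ (*-congˡ (trans (S-lin (p ^ suc D) (U-y (cf (suc i)) (suc (suc n)) (suc D) a) k) (+-congʳ
             (trans (S-lin (p ^ i * s) (U-cf i (suc (suc n)) (suc D) (suc a)) k)
               (+-cong (S-lin (p ^ D) (U-y (cf i) (suc (suc n)) D a) k) (*-congʳ (*-congʳ pⁱ)))))))) ⟨
      p ^ suc (suc n) * S (S T₁') k + (p ^ b * s) * S T₂' k + T₃ k ∎
      where
      pⁱ : p ^ i ≈ p ^ b * p ^ D
      pⁱ = trans (^-congʳ p i≡) (^-+ p b D)
      pⁿ : p ^ suc n ≈ p * ((p ^ b * p ^ D) * p ^ b)
      pⁿ = *-congˡ (trans (^-+ p i b) (*-congʳ pⁱ))

  U-≡ : ∀ u a {m m' d d'} → m ≡ m' → d ≡ d' → ∀ k → U u m d a k ≈ U u m' d' a k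
  U-≡ u a ≡.refl ≡.refl k = refl

  T-raise : ∀ i b a k → T (suc i) (suc b) a k + (p ^ suc i * s) * S (T (suc i) b a) k
            + (p ^ b * s) * S (T i (suc b) (suc a)) k
            ≈ p ^ suc (suc i ℕ.+ b) * S (S (T (suc i) (suc b) (suc a))) k
              + (p ^ b * s) * S (T (suc i) b (suc a)) k + T i b a k
  T-raise i b a k with ℕₚ.<-cmp (suc i) b
  ... | tri< i<b _ _ = begin
    T (suc i) (suc b) a k + x * S (T (suc i) b a) k + y * S (T i (suc b) (suc a)) k
      ≈⟨ +-cong (+-cong (T-zero (suc i) (suc b) a k (ℕₚ.m<n⇒m<1+n i<b))
                        (*-congˡ (S-zero (λ k → T-zero (suc i) b a k i<b) k)))
                (*-congˡ (S-zero (λ k → T-zero i (suc b) (suc a) k (ℕₚ.<-trans (ℕₚ.n<1+n i) (ℕₚ.m<n⇒m<1+n i<b))) k)) ⟩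
    0# + x * 0# + y * 0#
      ≈⟨ solve 3 (λ x y z → con 0 :+ x :* con 0 :+ y :* con 0 := z :* con 0 :+ y :* con 0 :+ con 0) refl x y z ⟩
    z * 0# + y * 0# + 0#
      ≈⟨ +-cong (+-cong (*-congˡ (S-zero (S-zero (λ k → T-zero (suc i) (suc b) (suc a) k (ℕₚ.m<n⇒m<1+n i<b))) k))
                        (*-congˡ (S-zero (λ k → T-zero (suc i) b (suc a) k i<b) k)))
                (T-zero i b a k (ℕₚ.<-trans (ℕₚ.n<1+n i) i<b)) ⟨
    z * S (S (T (suc i) (suc b) (suc a))) k + y * S (T (suc i) b (suc a)) k + T i b a k ∎
    where
    x = p ^ suc i * s
    y = p ^ b * s
    z = p ^ suc (suc i ℕ.+ b)
  -- Only the two terms with `T (suc i) b` survive. Their denominator in y is 1 - y alone, so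
  -- raising a does not change the coefficients.
  ... | tri≈ _ ≡.refl _ = begin
    T (suc i) (suc b) a k + y * S (T (suc i) b a) k + y * S (T i (suc b) (suc a)) k
      ≈⟨ +-cong (+-congʳ (T-zero (suc i) (suc b) a k (ℕₚ.n<1+n b)))
                (*-congˡ (S-zero (λ k → T-zero i (suc b) (suc a) k (ℕₚ.m<n⇒m<1+n (ℕₚ.n<1+n i))) k)) ⟩
    0# + y * S (T (suc i) b a) k + y * 0#
      ≈⟨ solve 3 (λ y z q → con 0 :+ y :* q :+ y :* con 0 := z :* con 0 :+ y :* (con 0 :+ con 1 :* q) :+ con 0)
           refl y z (S (T (suc i) b a) k) ⟩
    z * 0# + y * (0# + 1# * S (T (suc i) b a) k) + 0#
      ≈⟨ +-cong (+-cong (*-congˡ (S-zero (S-zero (λ k → T-zero (suc i) (suc b) (suc a) k (ℕₚ.n<1+n b))) k))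
                        (*-congˡ (trans (S-lin 1# step k) (+-congʳ (S-zero (U-zero (cf (suc i)) (suc (suc i ℕ.+ b)) (suc a)) k)))))
                (T-zero i b a k (ℕₚ.n<1+n i)) ⟨
    z * S (S (T (suc i) (suc b) (suc a))) k + y * S (T (suc i) b (suc a)) k + T i b a k ∎
    where
    y = p ^ b * s
    z = p ^ suc (suc i ℕ.+ b)
    d≡1 : suc (suc i) ∸ b ≡ 1
    d≡1 = ℕₚ.m+n∸n≡m 1 b
    step : ∀ k → T (suc i) b (suc a) k ≈ U (cf (suc i)) (suc (suc i ℕ.+ b)) 0 (suc a) k + 1# * T (suc i) b a k
    step k = trans (U-≡ _ (suc a) (≡.refl {x = suc (suc i ℕ.+ b)}) d≡1 k) (trans (U-y (cf (suc i)) (suc (suc i ℕ.+ b)) 0 a k)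
      (+-congˡ (*-congˡ (U-≡ _ a (≡.refl {x = suc (suc i ℕ.+ b)}) (≡.sym d≡1) k))))
  ... | tri> _ _ (s≤s b≤i) with ℕₚ.m≤n⇒∃[o]m+o≡n b≤i
  ... | D , ≡.refl = begin
    T (suc i) (suc b) a k + x * S (T (suc i) b a) k + y * S (T i (suc b) (suc a)) k
      ≈⟨ +-cong (+-cong (U-≡ _ a e₁ e₂ k) (*-congˡ (S-cong (U-≡ _ a (≡.refl {x = suc (suc i ℕ.+ b)}) e₃) k)))
                (*-congˡ (S-cong (U-≡ _ (suc a) e₄ (ℕₚ.m+n∸m≡n b D)) k)) ⟩
    R.T₁ k + x * S R.T₂ k + y * S R.T₄ k
      ≈⟨ R.rel k ⟩
    z * S (S R.T₁') k + y * S R.T₂' k + R.T₃ k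
      ≈⟨ +-cong (+-cong (*-congˡ (S-cong (S-cong (U-≡ _ (suc a) e₁ e₂)) k)) (*-congˡ (S-cong (U-≡ _ (suc a) (≡.refl {x = suc (suc i ℕ.+ b)}) e₃) k)))
                (U-≡ _ a (≡.refl {x = suc (i ℕ.+ b)}) e₂ k) ⟨
    z * S (S (T (suc i) (suc b) (suc a))) k + y * S (T (suc i) b (suc a)) k + T i b a k ∎
    where
    module R = Raise (b ℕ.+ D) b D ≡.refl a
    x = p ^ suc i * s
    y = p ^ b * s
    z = p ^ suc (suc i ℕ.+ b)
    e₁ : suc (suc i ℕ.+ suc b) ≡ suc (suc (suc (i ℕ.+ b)))
    e₁ = ≡.cong (λ n → suc (suc n)) (ℕₚ.+-suc i b)
    e₂ : suc i ∸ b ≡ suc D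
    e₂ = ≡.trans (≡.cong (_∸ b) (≡.sym (ℕₚ.+-suc b D))) (ℕₚ.m+n∸m≡n b (suc D))
    e₃ : suc (suc i) ∸ b ≡ suc (suc D)
    e₃ = ≡.trans (≡.cong (λ n → suc n ∸ b) (≡.sym (ℕₚ.+-suc b D)))
           (≡.trans (≡.cong (_∸ b) (≡.sym (ℕₚ.+-suc b (suc D)))) (ℕₚ.m+n∸m≡n b (suc (suc D))))
    e₄ : suc (i ℕ.+ suc b) ≡ suc (suc (i ℕ.+ b))
    e₄ = ≡.cong suc (ℕₚ.+-suc i b)

  -- The left-hand side of the first transformation.
  G : ℕ → ℕ → ℕ → ℕ → Seq
  G B b M a α = sumTo B λ i → s ^ (i ℕ.* i) * (sh i (gx (suc (α ℕ.+ a))) M * sh i (T i b a) α)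

  -- `T-raise` read at L - i and one step lower in M. At i = 0 there is no predecessor, and `S` in
  -- the variable i supplies zero in its place.
  T-raise-sh : ∀ i b a k →
    sh i (T i (suc b) a) k + (p ^ i * s) * sh (suc i) (T i b a) k
      + (p ^ b * s) * S (λ i → sh (suc (suc i)) (T i (suc b) (suc a)) k) i
    ≈ p ^ suc (i ℕ.+ b) * sh (suc (suc i)) (T i (suc b) (suc a)) k
      + (p ^ b * s) * sh (suc i) (T i b (suc a)) k + S (λ i → sh (suc i) (T i b a) k) i
  T-raise-sh zero (suc b) a k = begin
    T 0 (suc (suc b)) a k + x * S (T 0 (suc b) a) k + y * 0#
      ≈⟨ +-congʳ (+-cong (T-zero 0 (suc (suc b)) a k (s≤s z≤n)) (*-congˡ (S-zero (λ k → T-zero 0 (suc b) a k (s≤s z≤n)) k))) ⟩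
    0# + x * 0# + y * 0#
      ≈⟨ solve 3 (λ x y z → con 0 :+ x :* con 0 :+ y :* con 0 := z :* con 0 :+ y :* con 0 :+ con 0) refl x y z ⟩
    z * 0# + y * 0# + 0#
      ≈⟨ +-congʳ (+-cong (*-congˡ (S-zero (S-zero (λ k → T-zero 0 (suc (suc b)) (suc a) k (s≤s z≤n))) k))
                         (*-congˡ (S-zero (λ k → T-zero 0 (suc b) (suc a) k (s≤s z≤n)) k))) ⟨
    z * S (S (T 0 (suc (suc b)) (suc a))) k + y * S (T 0 (suc b) (suc a)) k + 0# ∎
    where
    x = p ^ 0 * s
    y = p ^ suc b * s
    z = p ^ suc (suc b)
  T-raise-sh zero zero a k = begin
    T 0 1 a k + x * S (T 0 0 a) k + x * 0#
      ≈⟨ +-congʳ (+-congʳ (T-zero 0 1 a k (s≤s z≤n))) ⟩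
    0# + x * S (T 0 0 a) k + x * 0#
      ≈⟨ solve 3 (λ x q z → con 0 :+ x :* q :+ x :* con 0 := z :* con 0 :+ x :* (con 0 :+ con 1 :* q) :+ con 0) refl x (S (T 0 0 a) k) z ⟩
    z * 0# + x * (0# + 1# * S (T 0 0 a) k) + 0#
      ≈⟨ +-congʳ (+-cong (*-congˡ (S-zero (S-zero (λ k → T-zero 0 1 (suc a) k (s≤s z≤n))) k))
          (*-congˡ (trans (S-lin 1# (U-y (cf 0) 1 0 a) k) (+-congʳ (S-zero (U-zero (cf 0) 1 (suc a)) k))))) ⟨
    z * S (S (T 0 1 (suc a))) k + x * S (T 0 0 (suc a)) k + 0# ∎
    where
    x = p ^ 0 * s
    z = p ^ 1
  T-raise-sh (suc i) b a k = begin
    sh (suc i) (T (suc i) (suc b) a) k + x * S (sh (suc i) (T (suc i) b a)) k + y * S (S (sh i (T i (suc b) (suc a)))) k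
      ≈⟨ +-cong (+-congˡ (*-congˡ (≡⇒≈ (sh-S (suc i) _ k)))) (*-congˡ (≡⇒≈ (sh-S (suc i) _ k))) ⟨
    sh (suc i) (T (suc i) (suc b) a) k + x * sh (suc i) (S (T (suc i) b a)) k + y * sh (suc i) (S (T i (suc b) (suc a))) k
      ≈⟨ sh-rel₆ (suc i) x y z y (T-raise i b a) k ⟩
    z * sh (suc i) (S (S (T (suc i) (suc b) (suc a)))) k + y * sh (suc i) (S (T (suc i) b (suc a))) k + sh (suc i) (T i b a) k
      ≈⟨ +-congʳ (+-cong (*-congˡ (trans (≡⇒≈ (sh-S (suc i) _ k)) (S-cong (λ k → ≡⇒≈ (sh-S (suc i) _ k)) k))) (*-congˡ (≡⇒≈ (sh-S (suc i) _ k)))) ⟩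
    z * S (S (sh (suc i) (T (suc i) (suc b) (suc a)))) k + y * S (sh (suc i) (T (suc i) b (suc a))) k + sh (suc i) (T i b a) k ∎
    where
    x = p ^ suc i * s
    y = p ^ b * s
    z = p ^ suc (suc i ℕ.+ b)

  sh-gx-dual : ∀ i L M → sh i (gx (suc L)) M ≈ sh (suc i) (gx (suc L)) M + sh i (scale p (gx L)) M
  sh-gx-dual i L M = trans (sh-lin i 1# (λ k → trans (gx-dual L k) (+-congˡ (sym (*-identityˡ _)))) M)
    (+-cong (≡⇒≈ (sh-S i _ M)) (*-identityˡ _))

  -- u and v are the boundary terms by which consecutive summands f and g differ.
  module RaiseSum (B b M a α L : ℕ) (M≤B : M ≤ B) where
    A Bs C D γ η : Seq
    A i  = sh i (T i (suc b) a) α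
    Bs i = sh (suc (suc i)) (T i (suc b) (suc a)) α
    C i  = sh (suc i) (T i b (suc a)) α
    D i  = sh (suc i) (T i b a) α
    γ i  = sh i (gx (suc L)) M
    η i  = sh i (gx L) M

    σ : Seq
    σ i = s ^ (i ℕ.* i)

    -- Dual Pascal rule. Multiplication by p^i turns the dilation inside the shift into the constant
    -- p^M.
    weights : ∀ i → p ^ M * η i + p ^ i * γ (suc i) ≈ p ^ i * γ i
    weights i = trans (+-congʳ (sym (sh-scale i p (gx L) M)))
      (trans (sym (distribˡ _ _ _)) (*-congˡ (trans (+-comm _ _) (sym (sh-gx-dual i L M)))))

    f g u v : Seq
    f i = σ i * (γ i * A i) + (p ^ M * s) * (σ i * (η i * D i))
    g i = (p ^ b * s) * (σ i * (γ i * C i)) + p ^ suc (M ℕ.+ b) * (σ i * (η i * Bs i))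
    u i = σ i * (γ i * S D i)
    v i = σ i * (γ i * ((p ^ b * s) * S Bs i))

    step : ∀ i → f i + u (suc i) + v i ≈ g i + v (suc i) + u i
    step i = begin
      f i + σ (suc i) * (γ (suc i) * D i) + v i
        ≈⟨ +-congʳ (+-congˡ (*-congʳ (square-suc i))) ⟩
      f i + (σ i * (p ^ i * s)) * (γ (suc i) * D i) + v i
        ≈⟨ solve 11 (λ σ γ A P s η D pi γ' pb B →
             (σ :* (γ :* A) :+ (P :* s) :* (σ :* (η :* D))) :+ (σ :* (pi :* s)) :* (γ' :* D) :+ σ :* (γ :* ((pb :* s) :* B))
             := σ :* γ :* (A :+ (pb :* s) :* B) :+ σ :* s :* D :* (P :* η :+ pi :* γ'))
           refl (σ i) (γ i) (A i) (p ^ M) s (η i) (D i) (p ^ i) (γ (suc i)) (p ^ b) (S Bs i) ⟩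
      σ i * γ i * (A i + (p ^ b * s) * S Bs i) + σ i * s * D i * (p ^ M * η i + p ^ i * γ (suc i))
        ≈⟨ +-congˡ (*-congˡ (weights i)) ⟩
      σ i * γ i * (A i + (p ^ b * s) * S Bs i) + σ i * s * D i * (p ^ i * γ i)
        ≈⟨ solve 8 (λ σ γ A s D pi pb B → σ :* γ :* (A :+ (pb :* s) :* B) :+ σ :* s :* D :* (pi :* γ)
             := σ :* γ :* (A :+ (pi :* s) :* D :+ (pb :* s) :* B)) refl (σ i) (γ i) (A i) s (D i) (p ^ i) (p ^ b) (S Bs i) ⟩
      σ i * γ i * (A i + (p ^ i * s) * D i + (p ^ b * s) * S Bs i)
        ≈⟨ *-congˡ (T-raise-sh i b a α) ⟩
      σ i * γ i * (p ^ suc (i ℕ.+ b) * Bs i + (p ^ b * s) * C i + S D i)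
        ≈⟨ *-congˡ (+-congʳ (+-congʳ (*-congʳ (*-congˡ (^-+ p i b))))) ⟩
      σ i * γ i * ((p * (p ^ i * p ^ b)) * Bs i + (p ^ b * s) * C i + S D i)
        ≈⟨ solve 8 (λ σ γ s pi pb B C D → σ :* γ :* (((s :* s) :* (pi :* pb)) :* B :+ (pb :* s) :* C :+ D)
            := σ :* γ :* ((pb :* s) :* C :+ D) :+ σ :* pb :* s :* s :* B :* (pi :* γ)) refl
            (σ i) (γ i) s (p ^ i) (p ^ b) (Bs i) (C i) (S D i) ⟩
      σ i * γ i * ((p ^ b * s) * C i + S D i) + σ i * p ^ b * s * s * Bs i * (p ^ i * γ i)
        ≈⟨ +-congˡ (*-congˡ (weights i)) ⟨
      σ i * γ i * ((p ^ b * s) * C i + S D i) + σ i * p ^ b * s * s * Bs i * (p ^ M * η i + p ^ i * γ (suc i))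
        ≈⟨ solve 11 (λ σ γ C P s η D pi γ' pb B →
             σ :* γ :* ((pb :* s) :* C :+ D) :+ σ :* pb :* s :* s :* B :* (P :* η :+ pi :* γ')
             := (pb :* s) :* (σ :* (γ :* C)) :+ (s :* s) :* (P :* pb) :* (σ :* (η :* B))
                :+ (σ :* (pi :* s)) :* (γ' :* ((pb :* s) :* B)) :+ σ :* (γ :* D))
           refl (σ i) (γ i) (C i) (p ^ M) s (η i) (S D i) (p ^ i) (γ (suc i)) (p ^ b) (Bs i) ⟩
      (p ^ b * s) * (σ i * (γ i * C i)) + (p * (p ^ M * p ^ b)) * (σ i * (η i * Bs i))
        + (σ i * (p ^ i * s)) * (γ (suc i) * ((p ^ b * s) * Bs i)) + u i
        ≈⟨ +-congʳ (+-cong (+-congˡ (*-congʳ (*-congˡ (^-+ p M b)))) (*-congʳ (square-suc i))) ⟨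
      g i + v (suc i) + u i ∎

    end : γ (suc B) ≈ 0#
    end = ≡⇒≈ (sh-over (suc B) (gx (suc L)) M (s≤s M≤B))

    sums : sumTo B f ≈ sumTo B g
    sums = begin
      sumTo B f                ≈⟨ +-identityʳ _ ⟨
      sumTo B f + 0#           ≈⟨ +-congˡ (*-zeroʳ (*-zeroˡ end)) ⟨
      sumTo B f + u (suc B)    ≈⟨ telescope {f} {g} {u} {v} B
                                    (*-congˡ (*-congˡ (sym (zeroʳ _)))) step ⟩
      sumTo B g + v (suc B)    ≈⟨ +-congˡ (*-zeroʳ (*-zeroˡ end)) ⟩
      sumTo B g + 0#           ≈⟨ +-identityʳ _ ⟩
      sumTo B g                ∎

  -- The sum with b + 1 recurs only with α lowered by two, so this relation determines it from the
  -- sum with b.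
  G-raise : ∀ {B M} b a α → M ≤ B →
    G B (suc b) M a α + (p ^ M * s) * S (G B b M a) α
    ≈ (p ^ b * s) * S (G B b M (suc a)) α + p ^ suc (M ℕ.+ b) * S (S (G B (suc b) M (suc a))) α
  G-raise {B} {M} b a α M≤B = begin
    G B (suc b) M a α + (p ^ M * s) * S (G B b M a) α
      ≈⟨ +-congˡ (*-congˡ (eqD α)) ⟩
    G B (suc b) M a α + (p ^ M * s) * sumTo B (λ i → σ i * (η i * D i))
      ≈⟨ sum-lin B (p ^ M * s) {f} (λ i → refl) ⟨
    sumTo B f
      ≈⟨ sums ⟩
    sumTo B g
      ≈⟨ trans (sum-+ B) (+-cong (sum-*ˡ B _) (sum-*ˡ B _)) ⟩
    (p ^ b * s) * sumTo B (λ i → σ i * (γ i * C i)) + p ^ suc (M ℕ.+ b) * sumTo B (λ i → σ i * (η i * Bs i))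
      ≈⟨ +-cong (*-congˡ (eqC α)) (*-congˡ (eqB α)) ⟨
    (p ^ b * s) * S (G B b M (suc a)) α + p ^ suc (M ℕ.+ b) * S (S (G B (suc b) M (suc a))) α ∎
    where
    open RaiseSum B b M a α (α ℕ.+ a) M≤B
    vanish : ∀ {w z : Seq} → sumTo B (λ i → w i * (z i * 0#)) ≈ 0#
    vanish = sum-zero B (λ i → *-zeroʳ (zeroʳ _))
    eqD : ∀ α → S (G B b M a) α ≈ sumTo B (λ i → σ i * (sh i (gx (α ℕ.+ a)) M * sh (suc i) (T i b a) α))
    eqD zero    = sym vanish
    eqD (suc α) = refl
    eqC : ∀ α → S (G B b M (suc a)) α ≈ sumTo B (λ i → σ i * (sh i (gx (suc (α ℕ.+ a))) M * sh (suc i) (T i b (suc a)) α))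
    eqC zero    = sym vanish
    eqC (suc α) = ≡⇒≈ (≡.cong (λ L → sumTo B (λ i → σ i * (sh i (gx (suc L)) M * sh i (T i b (suc a)) α))) (ℕₚ.+-suc α a))
    eqB : ∀ α → S (S (G B (suc b) M (suc a))) α
          ≈ sumTo B (λ i → σ i * (sh i (gx (α ℕ.+ a)) M * sh (suc (suc i)) (T i (suc b) (suc a)) α))
    eqB zero          = sym vanish
    eqB (suc zero)    = sym vanish
    eqB (suc (suc α)) = ≡⇒≈ (≡.cong (λ L → sumTo B (λ i → σ i * (sh i (gx (suc L)) M * sh i (T i (suc b) (suc a)) α))) (ℕₚ.+-suc α a))

  S-hom : ∀ {f g} x → (∀ k → f k ≈ x * g k) → ∀ k → S f k ≈ x * S g k
  S-hom x eq k = sh-hom 1 x eq k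

  -- The closed form s^(b²) T(L,M;a+b,b) with L = α + a. Relative to a + b the index is α - b,
  -- whence `sh b`.
  F : ℕ → ℕ → ℕ → Seq
  F b M a α = s ^ (b ℕ.* b) * sh b (T M b (b ℕ.+ a)) α

  -- The series `h` over (x;p)_(M+b+1) (y;p)_(M-b) arises from `T M (suc b)` by cancelling a factor
  -- in x and from `T M b` by cancelling one in y.
  F-raise : ∀ M b a α →
    F (suc b) M a α + (p ^ M * s) * S (F b M a) α
    ≈ (p ^ b * s) * S (F b M (suc a)) α + p ^ suc (M ℕ.+ b) * S (S (F (suc b) M (suc a))) α
  F-raise M b a α = begin
    F (suc b) M a α + x * S (F b M a) α
      ≈⟨ +-cong (*-congʳ (square-suc b)) (*-congˡ (S-hom σ (λ k → refl) α)) ⟩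
    (σ * y) * P₁ + x * (σ * Q)
      ≈⟨ main (ℕₚ.<-≤-connex M b) ⟩
    y * (σ * Q₁) + z * ((σ * y) * P₂)
      ≈⟨ +-cong (*-congˡ (S-hom σ (λ k → *-congˡ (sh-cong b (λ k → ≡⇒≈ (≡.cong (λ a → T M b a k) (ℕₚ.+-suc b a))) k)) α))
                (*-congˡ (S-hom _ (S-hom _ λ k → trans (*-congʳ (square-suc b))
                  (*-congˡ (sh-cong (suc b) (λ k → ≡⇒≈ (≡.cong (λ a → T M (suc b) (suc a) k) (ℕₚ.+-suc b a))) k))) α)) ⟨
    y * S (F b M (suc a)) α + z * S (S (F (suc b) M (suc a))) α ∎
    where
    x = p ^ M * s
    y = p ^ b * s
    z = p ^ suc (M ℕ.+ b)
    σ = s ^ (b ℕ.* b)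
    P₁ = sh (suc b) (T M (suc b) (suc (b ℕ.+ a))) α
    P₂ = S (S (sh (suc b) (T M (suc b) (suc (suc (b ℕ.+ a)))))) α
    Q  = sh (suc b) (T M b (b ℕ.+ a)) α
    Q₁ = sh (suc b) (T M b (suc (b ℕ.+ a))) α
    main : M ℕ.< b Sum.⊎ b ≤ M → (σ * y) * P₁ + x * (σ * Q) ≈ y * (σ * Q₁) + z * ((σ * y) * P₂)
    main (Sum.inj₁ M<b) = begin
      (σ * y) * P₁ + x * (σ * Q)
        ≈⟨ +-cong (*-congˡ (sh-zero (suc b) (λ k → T-zero M (suc b) (suc (b ℕ.+ a)) k (ℕₚ.m<n⇒m<1+n M<b)) α))
                  (*-congˡ (*-congˡ (sh-zero (suc b) (λ k → T-zero M b (b ℕ.+ a) k M<b) α))) ⟩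
      (σ * y) * 0# + x * (σ * 0#)
        ≈⟨ solve 4 (λ σ y x z → (σ :* y) :* con 0 :+ x :* (σ :* con 0) := y :* (σ :* con 0) :+ z :* ((σ :* y) :* con 0)) refl σ y x z ⟩
      y * (σ * 0#) + z * ((σ * y) * 0#)
        ≈⟨ +-cong (*-congˡ (*-congˡ (sh-zero (suc b) (λ k → T-zero M b (suc (b ℕ.+ a)) k M<b) α)))
                  (*-congˡ (*-congˡ (S-zero (S-zero (sh-zero (suc b) (λ k → T-zero M (suc b) (suc (suc (b ℕ.+ a))) k (ℕₚ.m<n⇒m<1+n M<b)))) α))) ⟨
      y * (σ * Q₁) + z * ((σ * y) * P₂) ∎
    main (Sum.inj₂ b≤M) = begin
      (σ * y) * P₁ + x * (σ * Q)
        ≈⟨ +-cong (*-congˡ (trans (sh-lin (suc b) z stepₓ α) (+-congˡ (*-congˡ shSS)))) (*-congʳ (*-congʳ pᴹ)) ⟩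
      (σ * y) * (H + z * P₂) + ((p ^ b * p ^ D) * s) * (σ * Q)
        ≈⟨ solve 8 (λ σ s H z P pb pd Q → (σ :* (pb :* s)) :* (H :+ z :* P) :+ ((pb :* pd) :* s) :* (σ :* Q)
             := (pb :* s) :* (σ :* (H :+ pd :* Q)) :+ z :* ((σ :* (pb :* s)) :* P)) refl σ s H z P₂ (p ^ b) (p ^ D) Q ⟩
      y * (σ * (H + p ^ D * Q)) + z * ((σ * y) * P₂)
        ≈⟨ +-congʳ (*-congˡ (*-congˡ (sh-lin (suc b) (p ^ D) stepᵧ α))) ⟨
      y * (σ * Q₁) + z * ((σ * y) * P₂) ∎
      where
      D = M ∸ b
      h : Seq
      h = U (cf M) (suc (M ℕ.+ b)) D (suc (b ℕ.+ a))
      H = sh (suc b) h α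
      pᴹ : p ^ M ≈ p ^ b * p ^ D
      pᴹ = trans (^-congʳ p (≡.sym (ℕₚ.m+[n∸m]≡n b≤M))) (^-+ p b D)
      shSS : sh (suc b) (S (S (T M (suc b) (suc (suc (b ℕ.+ a)))))) α ≈ P₂
      shSS = trans (≡⇒≈ (sh-S (suc b) (S (T M (suc b) (suc (suc (b ℕ.+ a))))) α))
                   (S-cong (λ k → ≡⇒≈ (sh-S (suc b) (T M (suc b) (suc (suc (b ℕ.+ a)))) k)) α)
      e₁ : suc (M ℕ.+ suc b) ≡ suc (suc (M ℕ.+ b))
      e₁ = ≡.cong suc (ℕₚ.+-suc M b)
      e₂ : suc M ∸ b ≡ suc D
      e₂ = ℕₚ.+-∸-assoc 1 b≤M
      stepₓ : ∀ k → T M (suc b) (suc (b ℕ.+ a)) k ≈ h k + z * S (S (T M (suc b) (suc (suc (b ℕ.+ a))))) k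
      stepₓ k = trans (U-≡ (cf M) (suc (b ℕ.+ a)) e₁ (≡.refl {x = D}) k)
        (trans (U-x (cf M) (M ℕ.+ b) D (suc (b ℕ.+ a)) k)
          (+-congˡ (*-congˡ (sym (S-cong (S-cong (U-≡ (cf M) (suc (suc (b ℕ.+ a))) e₁ (≡.refl {x = D}))) k)))))
      stepᵧ : ∀ k → T M b (suc (b ℕ.+ a)) k ≈ h k + p ^ D * T M b (b ℕ.+ a) k
      stepᵧ k = trans (U-≡ (cf M) (suc (b ℕ.+ a)) (≡.refl {x = suc (M ℕ.+ b)}) e₂ k)
        (trans (U-y (cf M) (suc (M ℕ.+ b)) D (b ℕ.+ a) k)
          (+-congˡ (*-congˡ (sym (U-≡ (cf M) (b ℕ.+ a) (≡.refl {x = suc (M ℕ.+ b)}) e₂ k)))))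

  G-closed-step : ∀ {B M} b → M ≤ B → (∀ a α → G B b M a α ≈ F b M a α) →
                  ∀ α a → G B (suc b) M a α ≈ F (suc b) M a α
  G-closed-step {B} {M} b M≤B ih = go
    where
    mutual
      go : ∀ α a → G B (suc b) M a α ≈ F (suc b) M a α
      go α a = +-cancelʳ ((p ^ M * s) * S (F b M a) α) _ _ (begin
        G B (suc b) M a α + (p ^ M * s) * S (F b M a) α
          ≈⟨ +-congˡ (*-congˡ (S-cong (ih a) α)) ⟨
        G B (suc b) M a α + (p ^ M * s) * S (G B b M a) α
          ≈⟨ G-raise b a α M≤B ⟩
        (p ^ b * s) * S (G B b M (suc a)) α + p ^ suc (M ℕ.+ b) * S (S (G B (suc b) M (suc a))) α
          ≈⟨ +-cong (*-congˡ (S-cong (ih (suc a)) α)) (*-congˡ (go₂ α (suc a))) ⟩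
        (p ^ b * s) * S (F b M (suc a)) α + p ^ suc (M ℕ.+ b) * S (S (F (suc b) M (suc a))) α
          ≈⟨ F-raise M b a α ⟨
        F (suc b) M a α + (p ^ M * s) * S (F b M a) α ∎)
      go₂ : ∀ α a → S (S (G B (suc b) M a)) α ≈ S (S (F (suc b) M a)) α
      go₂ zero          a = refl
      go₂ (suc zero)    a = refl
      go₂ (suc (suc α)) a = go α a

  -- First transformation: the case b = 0.

  V : ℕ → ℕ → Seq
  V M a = U (cf M) (suc M) (suc M) a

  -- Multiplication by y lowers a; for b = 0 the reflection a ↦ -a supplies a = -1.
  lower : (ℕ → Seq) → ℕ → Seq
  lower t zero    = S (S (t 1))
  lower t (suc a) = t a

  -- Coefficients of (1 - p^(i+1) x)(1 - p^(i+1) y) V (i+1) = (1 + p^i s z) V i, where xy = z²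
  -- appears as a shift by two.
  V-rec : ∀ i a k → V (suc i) a k + p ^ suc i * p ^ suc i * S (S (V (suc i) a)) k
          ≈ p ^ suc i * (S (S (V (suc i) (suc a))) k + lower (V (suc i)) a k)
            + V i a k + (p ^ i * s) * S (V i a) k
  -- `U-y` would need a = -1 here. `U-sym` turns the factor in y into one in x, which `U-x` cancels.
  V-rec i zero k = begin
    t 0 k + x * x * S (S (t 0)) k
      ≈⟨ +-congʳ (trans (U-x u i (suc (suc i)) 0 k) (+-congʳ (trans (U-sym u (suc i) (suc (suc i)) k)
           (trans (U-x u i (suc i) 0 k) (+-congʳ (U-cf i (suc i) (suc i) 0 k)))))) ⟩
    ((V i 0 k + (p ^ i * s) * S (V i 0) k) + x * h) + x * S (S (t 1)) k + x * x * S (S (t 0)) k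
      ≈⟨ solve 6 (λ v w x h t₁ t₀ → ((v :+ w) :+ x :* h) :+ x :* t₁ :+ x :* x :* t₀
                    := x :* (t₁ :+ (h :+ x :* t₀)) :+ v :+ w) refl (V i 0 k) _ x h (S (S (t 1)) k) (S (S (t 0)) k) ⟩
    x * (S (S (t 1)) k + (h + x * S (S (t 0)) k)) + V i 0 k + (p ^ i * s) * S (V i 0) k
      ≈⟨ +-congʳ (+-congʳ (*-congˡ (+-congˡ (S-lin x (S-lin x (U-y u (suc (suc i)) (suc i) 0)) k)))) ⟨
    x * (S (S (t 1)) k + S (S (t 1)) k) + V i 0 k + (p ^ i * s) * S (V i 0) k ∎
    where
    u = cf (suc i)
    x = p ^ suc i
    t = V (suc i)
    h = S (S (U u (suc (suc i)) (suc i) 1)) k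
  V-rec i (suc a) k = begin
    t (suc a) k + x * x * S (S (t (suc a))) k
      ≈⟨ +-congʳ (trans (U-y u (suc (suc i)) (suc i) a k) (+-congʳ
           (trans (U-x u i (suc i) (suc a) k) (+-congʳ (U-cf i (suc i) (suc i) (suc a) k))))) ⟩
    ((V i (suc a) k + (p ^ i * s) * S (V i (suc a)) k) + x * h) + x * t a k + x * x * S (S (t (suc a))) k
      ≈⟨ solve 6 (λ v w x h t₁ t₀ → ((v :+ w) :+ x :* h) :+ x :* t₁ :+ x :* x :* t₀
                    := x :* ((h :+ x :* t₀) :+ t₁) :+ v :+ w) refl (V i (suc a) k) _ x h (t a k) (S (S (t (suc a))) k) ⟩
    x * ((h + x * S (S (t (suc a))) k) + t a k) + V i (suc a) k + (p ^ i * s) * S (V i (suc a)) k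
      ≈⟨ +-congʳ (+-congʳ (*-congˡ (+-congʳ (S-lin x (S-lin x (U-y u (suc (suc i)) (suc i) (suc a))) k)))) ⟨
    x * (S (S (t (suc (suc a)))) k + t a k) + V i (suc a) k + (p ^ i * s) * S (V i (suc a)) k ∎
    where
    u = cf (suc i)
    x = p ^ suc i
    t = V (suc i)
    h = S (S (U u (suc (suc i)) (suc i) (suc (suc a)))) k

  conv-cf₀ : ∀ f k → conv (cf 0) f k ≈ f k
  conv-cf₀ f zero    = *-identityˡ _
  conv-cf₀ f (suc k) = trans (+-cong (*-identityˡ _) (trans (conv-homˡ f 0# (λ n → sym (zeroˡ 0#)) k) (zeroˡ _))) (+-identityʳ _)

  V₀-suc : ∀ a k → V 0 (suc a) k ≈ V 0 a k
  V₀-suc a k = trans (U-y (cf 0) 1 0 a k) (trans (+-cong (U-zero (cf 0) 1 (suc a) k) (*-identityˡ _)) (+-identityˡ _))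

  V₀-period : ∀ k → V 0 0 (suc (suc k)) ≈ V 0 0 k
  V₀-period k = trans (conv-cf₀ _ (suc (suc k))) (trans (*-cong e e) (sym (conv-cf₀ _ k)))
    where
    e : 0# + 1# * E 1 k ≈ E 1 k
    e = trans (+-identityˡ _) (*-identityˡ _)

  -- (1 - x)(1 - y) V 0 is the constant 1, which sits at index 0. The argument `suc k` stays clear
  -- of it.
  V₀-rec : ∀ a k → V 0 a (suc k) + S (S (V 0 a)) (suc k) ≈ S (S (V 0 (suc a))) (suc k) + lower (V 0) a (suc k)
  V₀-rec (suc a) k = trans (+-comm _ _) (+-cong (S-cong (S-cong (λ k → sym (V₀-suc (suc a) k))) (suc k)) (V₀-suc a (suc k)))
  V₀-rec zero zero = +-congʳ (trans (conv-cf₀ (λ k → E 1 k * E 1 k) 1) (zeroˡ _))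
  V₀-rec zero (suc k) = +-cong (trans (V₀-period k) (sym (V₀-suc 0 k))) (sym (V₀-suc 0 k))

  lower-sh : ∀ n (t : ℕ → Seq) a k → sh n (lower t a) k ≡ lower (λ a → sh n (t a)) a k
  lower-sh n t zero    k = ≡.trans (sh-S n (S (t 1)) k) (go k)
    where
    go : ∀ k → S (sh n (S (t 1))) k ≡ S (S (sh n (t 1))) k
    go zero    = ≡.refl
    go (suc k) = sh-S n (t 1) k
  lower-sh n t (suc a) k = ≡.refl

  V-rec-sh : ∀ i a k →
    sh i (V i a) (suc k) + p ^ i * p ^ i * sh (suc (suc i)) (V i a) (suc k)
    ≈ p ^ i * (sh (suc (suc i)) (V i (suc a)) (suc k) + lower (λ a → sh i (V i a)) a (suc k))
      + S (λ i → sh (suc i) (V i a) (suc k)) i + S (λ i → (p ^ i * s) * sh (suc (suc i)) (V i a) (suc k)) i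
  V-rec-sh zero a k = trans (+-congˡ (trans (*-congʳ (*-identityˡ _)) (*-identityˡ _))) (trans (V₀-rec a k)
    (solve 2 (λ x y → x :+ y := con 1 :* (x :+ y) :+ con 0 :+ con 0) refl _ _))
  V-rec-sh (suc i) a k = begin
    sh (suc i) (t a) (suc k) + x * x * sh (suc (suc (suc i))) (t a) (suc k)
      ≈⟨ +-congˡ (*-congˡ (SS (t a) (suc k))) ⟨
    sh (suc i) (t a) (suc k) + x * x * sh (suc i) (S (S (t a))) (suc k)
      ≈⟨ go (suc i) (suc k) ⟩
    x * (sh (suc i) (S (S (t (suc a)))) (suc k) + sh (suc i) (lower t a) (suc k))
      + sh (suc i) (V i a) (suc k) + (p ^ i * s) * sh (suc i) (S (V i a)) (suc k)
      ≈⟨ +-cong (+-congʳ (*-congˡ (+-cong (SS (t (suc a)) (suc k)) (≡⇒≈ (lower-sh (suc i) t a (suc k))))))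
                (*-congˡ (≡⇒≈ (sh-S (suc i) _ (suc k)))) ⟩
    x * (sh (suc (suc (suc i))) (t (suc a)) (suc k) + lower (λ a → sh (suc i) (t a)) a (suc k))
      + sh (suc i) (V i a) (suc k) + (p ^ i * s) * sh (suc (suc i)) (V i a) (suc k) ∎
    where
    x = p ^ suc i
    t = V (suc i)
    SS : ∀ f k → sh (suc i) (S (S f)) k ≈ S (S (sh (suc i) f)) k
    SS f k = trans (≡⇒≈ (sh-S (suc i) _ k)) (S-cong (λ k → ≡⇒≈ (sh-S (suc i) _ k)) k)
    go : ∀ n k → sh n (t a) k + x * x * sh n (S (S (t a))) k
         ≈ x * (sh n (S (S (t (suc a)))) k + sh n (lower t a) k) + sh n (V i a) k + (p ^ i * s) * sh n (S (V i a)) k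
    go zero    k       = V-rec i a k
    go (suc n) zero    = solve 2 (λ x y → con 0 :+ x :* x :* con 0 := x :* (con 0 :+ con 0) :+ con 0 :+ y :* con 0) refl x _
    go (suc n) (suc k) = go n k

  G₀ : ℕ → ℕ → ℕ → Seq
  G₀ B M a α = sumTo B λ i → s ^ (i ℕ.* i) * (sh i (gx (suc (α ℕ.+ a))) M * sh i (V i a) α)

  module BaseSum (B M a α L₁ : ℕ) (M≤B : suc M ≤ B) where
    L : ℕ
    L = suc L₁

    A X Y Z D σ γ θ η ζ : Seq
    A i = sh i (V i a) (suc α)
    X i = sh (suc (suc i)) (V i (suc a)) (suc α)
    Y i = lower (λ a → sh i (V i a)) a (suc α)
    Z i = sh (suc (suc i)) (V i a) (suc α)
    D i = sh (suc i) (V i a) (suc α)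
    σ i = s ^ (i ℕ.* i)
    γ i = sh i (gx (suc L)) (suc M)
    θ i = sh i (scale p (gx L)) (suc M)
    η i = sh i (gx L) (suc M)
    ζ i = sh i (gx L₁) (suc M)

    -- `w` collects what `V-rec` brings in from V at i - 1. The difference of f and g is an
    -- increment of this single boundary sequence.
    f g w : Seq
    f i = σ i * (θ i * A i) + p ^ suc M * p ^ suc M * (σ i * (ζ i * Z i))
    g i = (p ^ M * s) * (σ i * (η (suc i) * D i)) + p ^ suc M * (σ i * (η i * (X i + Y i)))
    w i = σ i * (θ i * (S D i + S (λ i → (p ^ i * s) * Z i) i))

    η-split : ∀ i → p ^ i * η (suc i) + p ^ suc M * ζ i ≈ p ^ i * η i
    η-split i = trans (+-congˡ (sym (sh-scale i p (gx L₁) (suc M))))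
      (trans (sym (distribˡ _ _ _)) (*-congˡ (sym (sh-gx-dual i L₁ (suc M)))))

    step : ∀ i → f i + w (suc i) + 0# ≈ g i + 0# + w i
    step i = begin
      f i + σ (suc i) * (θ (suc i) * (D i + (p ^ i * s) * Z i)) + 0#
        ≈⟨ +-congʳ (+-congˡ (*-congʳ (square-suc i))) ⟩
      f i + (σ i * (p ^ i * s)) * (θ (suc i) * (D i + (p ^ i * s) * Z i)) + 0#
        ≈⟨ solve 10 (λ σ θ A s P ζ Z pi θ' D →
             (σ :* (θ :* A) :+ (s :* s :* P) :* (s :* s :* P) :* (σ :* (ζ :* Z))) :+ (σ :* (pi :* s)) :* (θ' :* (D :+ (pi :* s) :* Z)) :+ con 0
             := σ :* (θ :* A) :+ (s :* s :* P) :* (s :* s :* P) :* (σ :* (ζ :* Z)) :+ (σ :* s) :* (D :+ (pi :* s) :* Z) :* (pi :* θ'))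
           refl (σ i) (θ i) (A i) s (p ^ M) (ζ i) (Z i) (p ^ i) (θ (suc i)) (D i) ⟩
      f i + (σ i * s) * (D i + (p ^ i * s) * Z i) * (p ^ i * θ (suc i))
        ≈⟨ +-congˡ (*-congˡ (sh-scale i p (gx L) M)) ⟩
      f i + (σ i * s) * (D i + (p ^ i * s) * Z i) * (p ^ M * η (suc i))
        ≈⟨ solve 10 (λ σ θ A s P ζ Z pi η' D →
             (σ :* (θ :* A) :+ (s :* s :* P) :* (s :* s :* P) :* (σ :* (ζ :* Z))) :+ (σ :* s) :* (D :+ (pi :* s) :* Z) :* (P :* η')
             := (P :* s) :* (σ :* (η' :* D)) :+ σ :* θ :* A :+ σ :* Z :* (s :* s :* P) :* (pi :* η' :+ (s :* s :* P) :* ζ))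
           refl (σ i) (θ i) (A i) s (p ^ M) (ζ i) (Z i) (p ^ i) (η (suc i)) (D i) ⟩
      (p ^ M * s) * (σ i * (η (suc i) * D i)) + σ i * θ i * A i + σ i * Z i * p ^ suc M * (p ^ i * η (suc i) + p ^ suc M * ζ i)
        ≈⟨ +-congˡ (trans (*-congˡ (η-split i)) (trans (solve 5 (λ σ Z P pi η → σ :* Z :* P :* (pi :* η) := σ :* Z :* pi :* (P :* η))
             refl (σ i) (Z i) (p ^ suc M) (p ^ i) (η i)) (*-congˡ (sym (sh-scale i p (gx L) (suc M)))))) ⟩
      (p ^ M * s) * (σ i * (η (suc i) * D i)) + σ i * θ i * A i + σ i * Z i * p ^ i * (p ^ i * θ i)
        ≈⟨ solve 6 (λ e σ θ A Z pi → e :+ σ :* θ :* A :+ σ :* Z :* pi :* (pi :* θ) := e :+ σ :* θ :* (A :+ pi :* pi :* Z))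
             refl _ (σ i) (θ i) (A i) (Z i) (p ^ i) ⟩
      (p ^ M * s) * (σ i * (η (suc i) * D i)) + σ i * θ i * (A i + p ^ i * p ^ i * Z i)
        ≈⟨ +-congˡ (*-congˡ (V-rec-sh i a α)) ⟩
      (p ^ M * s) * (σ i * (η (suc i) * D i)) + σ i * θ i * (p ^ i * (X i + Y i) + S D i + S (λ i → (p ^ i * s) * Z i) i)
        ≈⟨ solve 7 (λ e σ θ W pi u v → e :+ σ :* θ :* (pi :* W :+ u :+ v) := e :+ σ :* W :* (pi :* θ) :+ σ :* (θ :* (u :+ v)))
             refl _ (σ i) (θ i) (X i + Y i) (p ^ i) (S D i) (S (λ i → (p ^ i * s) * Z i) i) ⟩
      (p ^ M * s) * (σ i * (η (suc i) * D i)) + σ i * (X i + Y i) * (p ^ i * θ i) + w i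
        ≈⟨ +-congʳ (+-congˡ (*-congˡ (sh-scale i p (gx L) (suc M)))) ⟩
      (p ^ M * s) * (σ i * (η (suc i) * D i)) + σ i * (X i + Y i) * (p ^ suc M * η i) + w i
        ≈⟨ solve 6 (λ e σ W P η w → e :+ σ :* W :* (P :* η) :+ w := e :+ P :* (σ :* (η :* W)) :+ con 0 :+ w)
             refl _ (σ i) (X i + Y i) (p ^ suc M) (η i) (w i) ⟩
      g i + 0# + w i ∎

    end : w (suc B) ≈ 0#
    end = *-zeroʳ (*-zeroˡ (≡⇒≈ (sh-over (suc B) (scale p (gx L)) (suc M) (s≤s M≤B))))

    sums : sumTo B f ≈ sumTo B g
    sums = begin
      sumTo B f             ≈⟨ +-identityʳ _ ⟨
      sumTo B f + 0#        ≈⟨ +-congˡ end ⟨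
      sumTo B f + w (suc B) ≈⟨ telescope {f} {g} {w} {λ _ → 0#} B
                                 (*-zeroʳ (*-zeroʳ (+-identityˡ _))) step ⟩
      sumTo B g + 0#        ≈⟨ +-identityʳ _ ⟩
      sumTo B g             ∎

  -- This is `V-rec` term for term: summation over i preserves the recurrence.
  G₀-rec : ∀ {B M} a α → suc M ≤ B →
    G₀ B (suc M) a (suc α) + p ^ suc M * p ^ suc M * S (S (G₀ B (suc M) a)) (suc α)
    ≈ p ^ suc M * (S (S (G₀ B (suc M) (suc a))) (suc α) + lower (G₀ B (suc M)) a (suc α))
      + G₀ B M a (suc α) + (p ^ M * s) * S (G₀ B M a) (suc α)
  G₀-rec {B} {M} a α M≤B = begin
    G₀ B (suc M) a (suc α) + PP * S (S (G₀ B (suc M) a)) (suc α)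
      ≈⟨ +-cong (trans (sum-cong B (λ i → trans (*-congˡ (*-congʳ (sh-gx-dual i L (suc M))))
                    (solve 4 (λ σ x y A → σ :* ((x :+ y) :* A) := σ :* (x :* A) :+ σ :* (y :* A)) refl (σ i) (γ (suc i)) (θ i) (A i))))
                  (sum-+ B)) (*-congˡ (eqZ α)) ⟩
    (G₀ B M a (suc α) + sumTo B (λ i → σ i * (θ i * A i))) + PP * sumTo B (λ i → σ i * (ζ i * Z i))
      ≈⟨ trans (+-assoc _ _ _) (+-congˡ (sym (sum-lin B PP {f} (λ i → refl)))) ⟩
    G₀ B M a (suc α) + sumTo B f
      ≈⟨ +-congˡ (trans sums (trans (sum-+ B) (+-cong (sum-*ˡ B _) (sum-*ˡ B _)))) ⟩
    G₀ B M a (suc α) + ((p ^ M * s) * S (G₀ B M a) (suc α) + P * sumTo B (λ i → σ i * (η i * (X i + Y i))))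
      ≈⟨ +-congˡ (+-congˡ (*-congˡ (trans (sum-cong B (λ i →
            solve 4 (λ σ e x y → σ :* (e :* (x :+ y)) := σ :* (e :* x) :+ σ :* (e :* y)) refl (σ i) (η i) (X i) (Y i)))
            (trans (sum-+ B) (sym (+-cong (eqX α) (eqY a))))))) ⟩
    G₀ B M a (suc α) + ((p ^ M * s) * S (G₀ B M a) (suc α) + P * (S (S (G₀ B (suc M) (suc a))) (suc α) + lower (G₀ B (suc M)) a (suc α)))
      ≈⟨ solve 3 (λ x y z → x :+ (y :+ z) := z :+ x :+ y) refl _ _ _ ⟩
    P * (S (S (G₀ B (suc M) (suc a))) (suc α) + lower (G₀ B (suc M)) a (suc α))
      + G₀ B M a (suc α) + (p ^ M * s) * S (G₀ B M a) (suc α) ∎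
    where
    open BaseSum B M a α (α ℕ.+ a) M≤B
    P = p ^ suc M
    PP = p ^ suc M * p ^ suc M
    vanish : ∀ {w z : Seq} → sumTo B (λ i → w i * (z i * 0#)) ≈ 0#
    vanish = sum-zero B (λ i → *-zeroʳ (zeroʳ _))
    eqZ : ∀ α → S (G₀ B (suc M) a) α ≈ sumTo B (λ i → σ i * (sh i (gx (α ℕ.+ a)) (suc M) * sh (suc i) (V i a) α))
    eqZ zero    = sym vanish
    eqZ (suc α) = refl
    eqX : ∀ α → S (G₀ B (suc M) (suc a)) α
          ≈ sumTo B (λ i → σ i * (sh i (gx (suc (α ℕ.+ a))) (suc M) * sh (suc i) (V i (suc a)) α))
    eqX zero    = sym vanish
    eqX (suc α) = ≡⇒≈ (≡.cong (λ L → sumTo B (λ i → σ i * (sh i (gx (suc L)) (suc M) * sh i (V i (suc a)) α))) (ℕₚ.+-suc α a))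
    eqY : ∀ a → lower (G₀ B (suc M)) a (suc α)
          ≈ sumTo B (λ i → σ i * (sh i (gx (suc (α ℕ.+ a))) (suc M) * lower (λ a → sh i (V i a)) a (suc α)))
    eqY zero    = trans (eqS α) (≡⇒≈ (≡.cong (λ L → sumTo B (λ i → σ i * (sh i (gx L) (suc M) * sh (suc i) (V i 1) α))) (ℕₚ.+-suc α 0)))
      where
      eqS : ∀ α → S (G₀ B (suc M) 1) α ≈ sumTo B (λ i → σ i * (sh i (gx (α ℕ.+ 1)) (suc M) * sh (suc i) (V i 1) α))
      eqS zero    = sym vanish
      eqS (suc α) = refl
    eqY (suc a) = ≡⇒≈ (≡.cong (λ L → sumTo B (λ i → σ i * (sh i (gx (suc L)) (suc M) * sh i (V i a) (suc α)))) (≡.sym (ℕₚ.+-suc α a)))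

  sum-gx₀ : ∀ B L (w t : Seq) → sumTo B (λ i → w i * (sh i (gx (suc L)) 0 * t i)) ≈ w 0 * t 0
  sum-gx₀ B L w t = trans (sum-first B (λ i → *-zeroʳ (zeroˡ _))) (*-congˡ (*-identityˡ _))

  V-at-0 : ∀ M a → V M a 0 ≈ gx (suc a) M
  V-at-0 M a = trans (*-cong (cf₀ M) (trans (*-identityˡ _) (sft-E₀ M a))) (trans (*-identityˡ _) (gx-sym M a))
    where
    cf₀ : ∀ M → cf M 0 ≈ 1#
    cf₀ zero    = refl
    cf₀ (suc M) = trans (+-cong (cf₀ M) (zeroʳ _)) (+-identityʳ _)

  -- Lexicographic induction on M, α and a: `lower` either decreases a or, at a = 0, passes to a = 1
  -- with α smaller by two.
  G₀-closed : ∀ {B} M α a → M ≤ B → G₀ B M a α ≈ V M a α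
  G₀-closed-S² : ∀ {B} M α a → M ≤ B → S (S (G₀ B M a)) α ≈ S (S (V M a)) α
  G₀-closed-lower : ∀ {B} M α a → M ≤ B → lower (G₀ B M) a α ≈ lower (V M) a α
  G₀-closed {B} zero α a M≤B = trans (sum-gx₀ B (α ℕ.+ a) _ _) (*-identityˡ _)
  G₀-closed {B} (suc M) zero a M≤B = trans (sum-first B (λ i → *-zeroʳ (zeroʳ _)))
    (trans (*-identityˡ _) (trans (*-congˡ (trans (V-at-0 0 a) refl)) (trans (*-identityʳ _) (sym (V-at-0 (suc M) a)))))
  G₀-closed {B} (suc M) (suc α) a M≤B = +-cancelʳ (PP * S (S (V (suc M) a)) (suc α)) _ _ (begin
    G₀ B (suc M) a (suc α) + PP * S (S (V (suc M) a)) (suc α)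
      ≈⟨ +-congˡ (*-congˡ (G₀-closed-S² (suc M) (suc α) a M≤B)) ⟨
    G₀ B (suc M) a (suc α) + PP * S (S (G₀ B (suc M) a)) (suc α)
      ≈⟨ G₀-rec a α M≤B ⟩
    P * (S (S (G₀ B (suc M) (suc a))) (suc α) + lower (G₀ B (suc M)) a (suc α))
      + G₀ B M a (suc α) + (p ^ M * s) * S (G₀ B M a) (suc α)
      ≈⟨ +-cong (+-cong (*-congˡ (+-cong (G₀-closed-S² (suc M) (suc α) (suc a) M≤B) (G₀-closed-lower (suc M) (suc α) a M≤B)))
          (G₀-closed M (suc α) a (ℕₚ.<⇒≤ M≤B))) (*-congˡ (G₀-closed M α a (ℕₚ.<⇒≤ M≤B))) ⟩
    P * (S (S (V (suc M) (suc a))) (suc α) + lower (V (suc M)) a (suc α))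
      + V M a (suc α) + (p ^ M * s) * S (V M a) (suc α)
      ≈⟨ V-rec M a (suc α) ⟨
    V (suc M) a (suc α) + PP * S (S (V (suc M) a)) (suc α) ∎)
    where
    P = p ^ suc M
    PP = P * P
  G₀-closed-S² M zero a M≤B = refl
  G₀-closed-S² M (suc zero) a M≤B = refl
  G₀-closed-S² M (suc (suc α)) a M≤B = G₀-closed M α a M≤B
  G₀-closed-lower M α zero    M≤B = G₀-closed-S² M α 1 M≤B
  G₀-closed-lower M α (suc a) M≤B = G₀-closed M α a M≤B

  T₀≈V : ∀ M a k → T M 0 a k ≈ V M a k
  T₀≈V M a = U-≡ (cf M) a (≡.cong suc (ℕₚ.+-identityʳ M)) (≡.refl {x = suc M})

  G-closed : ∀ {B M} b → M ≤ B → ∀ a α → G B b M a α ≈ F b M a α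
  G-closed {B} {M} zero M≤B a α = begin
    G B 0 M a α   ≈⟨ sum-cong B (λ i → *-congˡ (*-congˡ (sh-cong i (T₀≈V i a) α))) ⟩
    G₀ B M a α    ≈⟨ G₀-closed M α a M≤B ⟩
    V M a α       ≈⟨ T₀≈V M a α ⟨
    T M 0 a α     ≈⟨ *-identityˡ _ ⟨
    F 0 M a α     ∎
  G-closed (suc b) M≤B a α = G-closed-step b M≤B (G-closed b M≤B) α a

  -- Warnaar's first transformation, for T(L,M;a,b) written as sh a (T M b a) L.
  T-transform : ∀ {B M} b a L → M ≤ B →
    sumTo B (λ i → s ^ (i ℕ.* i) * (sh i (gx (suc L)) M * sh (i ℕ.+ a) (T i b a) L))
    ≈ s ^ (b ℕ.* b) * sh (b ℕ.+ a) (T M b (b ℕ.+ a)) L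
  T-transform {B} {M} b a L M≤B with ℕₚ.<-≤-connex L a
  ... | Sum.inj₁ L<a = trans (sum-zero B (λ i → *-zeroʳ (*-zeroʳ (≡⇒≈ (sh-over (i ℕ.+ a) (T i b a) L (ℕₚ.m≤n⇒m≤o+n i L<a))))))
    (sym (*-zeroʳ (≡⇒≈ (sh-over (b ℕ.+ a) (T M b (b ℕ.+ a)) L (ℕₚ.m≤n⇒m≤o+n b L<a)))))
  ... | Sum.inj₂ a≤L with ℕₚ.m≤n⇒∃[o]m+o≡n a≤L
  ... | α , ≡.refl = begin
    sumTo B (λ i → σ i * (sh i (gx (suc (a ℕ.+ α))) M * sh (i ℕ.+ a) (T i b a) (a ℕ.+ α)))
      ≈⟨ sum-cong B (λ i → *-congˡ (*-cong (≡⇒≈ (≡.cong (λ L → sh i (gx (suc L)) M) (ℕₚ.+-comm a α))) (move i (T i b a)))) ⟩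
    G B b M a α
      ≈⟨ G-closed b M≤B a α ⟩
    σ b * sh b (T M b (b ℕ.+ a)) α
      ≈⟨ *-congˡ (move b (T M b (b ℕ.+ a))) ⟨
    σ b * sh (b ℕ.+ a) (T M b (b ℕ.+ a)) (a ℕ.+ α) ∎
    where
    σ : Seq
    σ i = s ^ (i ℕ.* i)
    move : ∀ i f → sh (i ℕ.+ a) f (a ℕ.+ α) ≈ sh i f α
    move i f = trans (≡⇒≈ (≡.trans (≡.cong (λ n → sh n f (a ℕ.+ α)) (ℕₚ.+-comm i a))
      (≡.sym (sh-sh a i f (a ℕ.+ α))))) (≡⇒≈ (sh-at a (sh i f) α))

  -- Second transformation: the passage from b to b + 1.

  -- The second transformation is stated with the common factor s^(a²) of s^((a+α)²) divided out,
  -- since p need not be cancellable.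
  ω : ℕ → Seq
  ω a α = s ^ (α ℕ.* α) * p ^ (a ℕ.* α)

  ω-up : ∀ a α → ω (suc a) α ≈ ω a α * p ^ α
  ω-up a α = trans (*-congˡ (trans (^-+ p α (a ℕ.* α)) (*-comm _ _))) (sym (*-assoc _ _ _))

  ω-suc : ∀ a α → ω a (suc α) ≈ ω (suc a) α * (p ^ a * s)
  ω-suc a α = trans (*-cong (square-suc α) (trans (^-congʳ p (ℕₚ.*-suc a α)) (^-+ p a (a ℕ.* α))))
    (trans (solve 5 (λ x y s z w → x :* (y :* s) :* (z :* w) := x :* (y :* w) :* (z :* s)) refl _ _ s _ _)
      (*-congʳ (*-congˡ (sym (^-+ p α (a ℕ.* α))))))

  sum-S : ∀ B f → f B ≈ 0# → sumTo B (S f) ≈ sumTo B f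
  sum-S zero    f f≈0 = sym f≈0
  sum-S (suc B) f f≈0 = trans (sum-head B (S f)) (trans (+-identityˡ _)
    (sym (trans (+-congˡ f≈0) (+-identityʳ _))))

  sh-rel₄ : ∀ n {f₁ f₂ f₃ f₄} x y z → (∀ k → f₁ k + x * f₂ k ≈ y * f₃ k + z * f₄ k) →
            ∀ k → sh n f₁ k + x * sh n f₂ k ≈ y * sh n f₃ k + z * sh n f₄ k
  sh-rel₄ zero    x y z eq k       = eq k
  sh-rel₄ (suc n) x y z eq zero    = solve 3 (λ x y z → con 0 :+ x :* con 0 := y :* con 0 :+ z :* con 0) refl x y z
  sh-rel₄ (suc n) x y z eq (suc k) = sh-rel₄ n x y z eq k

  J-≡ : ∀ u a {m m' d d'} → m ≡ m' → d ≡ d' → ∀ k → J u m d a k ≈ J u m' d' a k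
  J-≡ u a ≡.refl ≡.refl k = refl

  -- What remains of `T M (suc b)` after cancelling 1 - x and, up to a power of p, of `T M b` after
  -- cancelling 1 - y. It mediates between b + 1 and b.
  JT : ℕ → ℕ → ℕ → Seq
  JT M b a = J (cf M) (suc (M ℕ.+ b)) (M ∸ b) a

  T-J-x : ∀ M b a k → T M (suc b) a k ≈ JT M b a k + 1# * S (S (T M (suc b) (suc a))) k
  T-J-x M b a k = trans (U-≡ (cf M) a e (≡.refl {x = M ∸ b}) k)
    (trans (U-x-dual (cf M) (M ℕ.+ b) (M ∸ b) a k)
      (+-congˡ (*-congˡ (S-cong (S-cong (U-≡ (cf M) (suc a) (≡.sym e) (≡.refl {x = M ∸ b}))) k))))
    where
    e : suc (M ℕ.+ suc b) ≡ suc (suc (M ℕ.+ b))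
    e = ≡.cong suc (ℕₚ.+-suc M b)

  T-J-y : ∀ M b a k → T M b (suc a) k ≈ T M b a k + p ^ suc a * JT M b (suc a) k
  T-J-y M b a k with ℕₚ.<-≤-connex M b
  ... | Sum.inj₁ M<b = trans (T-zero M b (suc a) k M<b) (sym (trans (+-cong (T-zero M b a k M<b)
          (*-zeroʳ (trans (J-≡ (cf M) (suc a) (≡.refl {x = suc (M ℕ.+ b)}) (ℕₚ.m≤n⇒m∸n≡0 (ℕₚ.<⇒≤ M<b)) k)
            (J-zero (cf M) (suc (M ℕ.+ b)) (suc a) k)))) (+-identityˡ _)))
  ... | Sum.inj₂ b≤M = trans (U-≡ (cf M) (suc a) (≡.refl {x = suc (M ℕ.+ b)}) e k)
    (trans (U-y-dual (cf M) (suc (M ℕ.+ b)) (M ∸ b) a k)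
      (+-congʳ (U-≡ (cf M) a (≡.refl {x = suc (M ℕ.+ b)}) (≡.sym e) k)))
    where
    e : suc M ∸ b ≡ suc (M ∸ b)
    e = ℕₚ.+-∸-assoc 1 b≤M

  K-scale : ∀ u m d a k → K (scale p u) m d a k ≈ p ^ k * U u m d a k
  K-scale u m d a k = conv-scale p u _ k

  -- Split 1 + sz off the numerator and cancel one more first factor, in x or in y. Numerator and
  -- both denominators are then dilated by p, so `K-scale` gives p^k times `T M b` or `T M (suc b)`.
  JT-lower : ∀ M b a k → JT (suc M) b a k + (p ^ k * (p ^ a * s)) * S (T M (suc b) (suc a)) k
             ≈ s * S (JT (suc M) b (suc a)) k + p ^ k * T M b a k
  JT-lower M b a k with ℕₚ.<-≤-connex M b
  ... | Sum.inj₁ M<b = begin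
    JT (suc M) b a k + x * S (T M (suc b) (suc a)) k
      ≈⟨ +-cong (JT-zero a k) (*-congˡ (S-zero (λ k → T-zero M (suc b) (suc a) k (ℕₚ.m<n⇒m<1+n M<b)) k)) ⟩
    0# + x * 0#
      ≈⟨ solve 3 (λ x y z → con 0 :+ x :* con 0 := y :* con 0 :+ z :* con 0) refl x s (p ^ k) ⟩
    s * 0# + p ^ k * 0#
      ≈⟨ +-cong (*-congˡ (S-zero (JT-zero (suc a)) k)) (*-congˡ (T-zero M b a k M<b)) ⟨
    s * S (JT (suc M) b (suc a)) k + p ^ k * T M b a k ∎
    where
    x = p ^ k * (p ^ a * s)
    JT-zero : ∀ a k → JT (suc M) b a k ≈ 0#
    JT-zero a k = trans (J-≡ (cf (suc M)) a (≡.refl {x = suc (suc M ℕ.+ b)}) (ℕₚ.m≤n⇒m∸n≡0 M<b) k)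
      (J-zero (cf (suc M)) (suc (suc M ℕ.+ b)) a k)
  ... | Sum.inj₂ b≤M = begin
    JT (suc M) b a k + (p ^ k * (p ^ a * s)) * S (T M (suc b) (suc a)) k
      ≈⟨ +-congʳ (trans (split a k) (+-congʳ (trans (J-x û (M ℕ.+ b) (suc M ∸ b) a k) (+-congʳ (K-scale (cf M) (suc (M ℕ.+ b)) (suc M ∸ b) a k))))) ⟩
    ((p ^ k * T M b a k + p * SSj) + s * S (j a) k) + (p ^ k * (p ^ a * s)) * S (T M (suc b) (suc a)) k
      ≈⟨ solve 7 (λ t s ssj sj P pa q → ((t :+ s :* s :* ssj) :+ s :* sj) :+ (P :* (pa :* s)) :* q
             := s :* ((sj :+ pa :* (P :* q)) :+ s :* ssj) :+ t) refl (p ^ k * T M b a k) s SSj (S (j a) k) (p ^ k) (p ^ a) (S (T M (suc b) (suc a)) k) ⟩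
    s * ((S (j a) k + p ^ a * (p ^ k * S (T M (suc b) (suc a)) k)) + s * SSj) + p ^ k * T M b a k
      ≈⟨ +-congʳ (*-congˡ (trans (S-lin s (split (suc a)) k) (+-congʳ
            (trans (S-lin (p ^ suc a) jy k) (+-congˡ
              (trans (solve 3 (λ p x y → (p :* x) :* y := x :* (p :* y)) refl p (p ^ a) _) (*-congˡ (S-scale p (T M (suc b) (suc a)) k)))))))) ⟨
    s * S (JT (suc M) b (suc a)) k + p ^ k * T M b a k ∎
    where
    û : Seq
    û = scale p (cf M)
    j : ℕ → Seq
    j a = J û (suc (suc M ℕ.+ b)) (suc M ∸ b) a
    SSj = S (S (j (suc a))) k
    split : ∀ a k → JT (suc M) b a k ≈ j a k + s * S (j a) k
    split a k = trans (conv-linˡ _ s (cf-dual M) k) (+-congˡ (*-congˡ (conv-Sˡ û _ k)))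
    e : suc M ∸ b ≡ suc (M ∸ b)
    e = ℕₚ.+-∸-assoc 1 b≤M
    jy : ∀ k → j (suc a) k ≈ j a k + p ^ suc a * scale p (T M (suc b) (suc a)) k
    jy k = trans (J-≡ û (suc a) (≡.refl {x = suc (suc M ℕ.+ b)}) e k)
      (trans (J-y û (suc (suc M ℕ.+ b)) (M ∸ b) a k)
        (+-cong (J-≡ û a (≡.refl {x = suc (suc M ℕ.+ b)}) (≡.sym e) k)
          (*-congˡ (trans (K-scale (cf M) (suc (suc M ℕ.+ b)) (M ∸ b) (suc a) k)
            (*-congˡ (U-≡ (cf M) (suc a) (≡.cong suc (≡.sym (ℕₚ.+-suc M b))) (≡.refl {x = M ∸ b}) k))))))

  -- The left-hand side of the second transformation after the substitutions i = a + α and M = a +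
  -- M', with s^(a²) removed.
  H : ℕ → ℕ → ℕ → ℕ → Seq
  H B b a M' L = sumTo B λ α → ω a α * (sh α (gx (suc L)) M' * sh (a ℕ.+ α) (λ μ → T μ b a α) L)

  module RaiseDual (B b a M' L : ℕ) (M'≤B : suc M' ≤ B) where
    A Bs C D j j' γ γ⁺ θ ω' : Seq
    A  α = sh (a ℕ.+ α) (λ μ → T μ (suc b) a α) L
    Bs α = sh (a ℕ.+ α) (λ μ → S (S (T μ (suc b) (suc a))) α) L
    C  α = sh (a ℕ.+ α) (λ μ → S (T μ b (suc a)) α) L
    D  α = sh (a ℕ.+ α) (λ μ → S (T μ b a) α) L
    j  α = sh (a ℕ.+ α) (λ μ → JT μ b a α) L
    j' α = sh (a ℕ.+ α) (λ μ → S (JT μ b (suc a)) α) L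
    γ  α = sh α (gx (suc L)) M'
    γ⁺ α = sh α (gx (suc L)) (suc M')
    θ  α = sh α (scale p (gx L)) (suc M')
    ω' = S (ω (suc a))

    vanish : ∀ n → sh n (λ _ → 0#) L ≈ 0#
    vanish n = sh-zero n (λ _ → refl) L

    relA : ∀ α → A α ≈ j α + 1# * Bs α
    relA α = sh-lin (a ℕ.+ α) 1# (λ μ → T-J-x μ b a α) L

    relC : ∀ α → C α ≈ D α + p ^ suc a * j' α
    relC α = sh-lin (a ℕ.+ α) (p ^ suc a) (λ μ → S-lin (p ^ suc a) (T-J-y μ b a) α) L

    relJ : ∀ α → j α + (p ^ α * (p ^ a * s)) * Bs (suc α) ≈ s * j' α + p ^ α * D (suc α)
    relJ α = begin
      j α + x * sh (a ℕ.+ suc α) (λ μ → S (T μ (suc b) (suc a)) α) L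
        ≈⟨ +-congˡ (*-congˡ (fix (λ μ → S (T μ (suc b) (suc a)) α))) ⟩
      j α + x * sh (a ℕ.+ α) (S (λ μ → S (T μ (suc b) (suc a)) α)) L
        ≈⟨ sh-rel₄ (a ℕ.+ α) {f₂ = S (λ μ → S (T μ (suc b) (suc a)) α)} {f₄ = S (λ μ → T μ b a α)} x s (p ^ α) rel L ⟩
      s * j' α + p ^ α * sh (a ℕ.+ α) (S (λ μ → T μ b a α)) L
        ≈⟨ +-congˡ (*-congˡ (fix (λ μ → T μ b a α))) ⟨
      s * j' α + p ^ α * D (suc α) ∎
      where
      x = p ^ α * (p ^ a * s)
      fix : ∀ f → sh (a ℕ.+ suc α) f L ≈ sh (a ℕ.+ α) (S f) L
      fix f = ≡⇒≈ (≡.trans (≡.cong (λ n → sh n f L) (ℕₚ.+-suc a α)) (≡.sym (sh-S (a ℕ.+ α) f L)))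
      JT₀ : ∀ a k → JT 0 b a k ≈ 0#
      JT₀ a k = trans (J-≡ (cf 0) a (≡.refl {x = suc b}) (ℕₚ.0∸n≡0 b) k) (J-zero (cf 0) (suc b) a k)
      rel : ∀ μ → JT μ b a α + x * S (λ μ → S (T μ (suc b) (suc a)) α) μ
                  ≈ s * S (JT μ b (suc a)) α + p ^ α * S (λ μ → T μ b a α) μ
      rel zero    = trans (+-congʳ (JT₀ a α)) (trans (solve 3 (λ x y z → con 0 :+ x :* con 0 := y :* con 0 :+ z :* con 0) refl x s (p ^ α))
        (sym (+-congʳ (*-congˡ (S-zero (JT₀ (suc a)) α)))))
      rel (suc μ) = JT-lower μ b a α

    -- `relJ` produces the term `j'` with weight ω, while `relC` absorbs it with weight ω'. The
    -- identity `ω-suc` reconciles the two for α > 0, and at α = 0 the term itself is zero.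
    relω : ∀ α → ω a α * (s * j' α) ≈ ω' α * (p ^ suc a * j' α)
    relω zero    = trans (*-congˡ (*-zeroʳ (vanish (a ℕ.+ 0)))) (trans (zeroʳ _) (sym (zeroˡ _)))
    relω (suc α) = trans (*-congʳ (ω-suc a α))
      (solve 4 (λ w x s j → w :* (x :* s) :* (s :* j) := w :* (s :* s :* x :* j)) refl (ω (suc a) α) (p ^ a) s (j' (suc α)))

    relγ : ∀ α → γ⁺ α ≈ γ α + θ α
    relγ α = sh-gx-dual α L (suc M')

    f g u v : Seq
    f α = ω a α * (γ α * A α) + ω a α * (θ α * Bs α)
    g α = ω' α * (γ α * C α) + ω' α * (θ α * D α)
    u α = ω a α * (γ⁺ α * Bs α)
    v α = ω' α * (γ⁺ α * D α)

    step : ∀ α → f α + u (suc α) + v α ≈ g α + v (suc α) + u α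
    step α = begin
      f α + u (suc α) + v α
        ≈⟨ +-congʳ (+-cong (+-congʳ (*-congˡ (*-congˡ (relA α))))
             (*-congʳ (trans (ω-suc a α) (*-congʳ (ω-up a α))))) ⟩
      (w * (γ α * (j α + 1# * Bs α)) + w * (θ α * Bs α)) + (w * p ^ α * (p ^ a * s)) * (γ α * Bs (suc α)) + v α
        ≈⟨ solve 9 (λ w g j B t P y B' v → (w :* (g :* (j :+ con 1 :* B)) :+ w :* (t :* B)) :+ (w :* P :* y) :* (g :* B') :+ v
             := g :* (w :* (j :+ (P :* y) :* B')) :+ w :* ((g :+ t) :* B) :+ v)
           refl w (γ α) (j α) (Bs α) (θ α) (p ^ α) (p ^ a * s) (Bs (suc α)) (v α) ⟩
      γ α * (w * (j α + (p ^ α * (p ^ a * s)) * Bs (suc α))) + w * ((γ α + θ α) * Bs α) + v α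
        ≈⟨ +-cong (+-cong (*-congˡ (trans (*-congˡ (relJ α)) (trans (distribˡ _ _ _) (+-congʳ (relω α)))))
                          (*-congˡ (*-congʳ (sym (relγ α))))) (*-congˡ (*-congʳ (relγ α))) ⟩
      γ α * (ω' α * (p ^ suc a * j' α) + w * (p ^ α * D (suc α))) + u α + ω' α * ((γ α + θ α) * D α)
        ≈⟨ solve 9 (λ w g x t P D' u w' D → g :* (w' :* x :+ w :* (P :* D')) :+ u :+ w' :* ((g :+ t) :* D)
             := (w' :* (g :* (D :+ x)) :+ w' :* (t :* D)) :+ (w :* P) :* (g :* D') :+ u)
           refl w (γ α) (p ^ suc a * j' α) (θ α) (p ^ α) (D (suc α)) (u α) (ω' α) (D α) ⟩
      (ω' α * (γ α * (D α + p ^ suc a * j' α)) + ω' α * (θ α * D α)) + (w * p ^ α) * (γ α * D (suc α)) + u α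
        ≈⟨ +-congʳ (+-cong (+-congʳ (*-congˡ (*-congˡ (relC α)))) (*-congʳ (ω-up a α))) ⟨
      g α + v (suc α) + u α ∎
      where w = ω a α

    init : u 0 ≈ v 0
    init = trans (*-congˡ (*-zeroʳ (vanish (a ℕ.+ 0)))) (trans (zeroʳ _) (sym (zeroˡ _)))

    end : γ⁺ (suc B) ≈ 0#
    end = ≡⇒≈ (sh-over (suc B) (gx (suc L)) (suc M') (s≤s M'≤B))

    sums : sumTo B f ≈ sumTo B g
    sums = begin
      sumTo B f                ≈⟨ +-identityʳ _ ⟨
      sumTo B f + 0#           ≈⟨ +-congˡ (*-zeroʳ (*-zeroˡ end)) ⟨
      sumTo B f + u (suc B)    ≈⟨ telescope {f} {g} {u} {v} B init step ⟩
      sumTo B g + v (suc B)    ≈⟨ +-congˡ (*-zeroʳ (*-zeroˡ end)) ⟩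
      sumTo B g + 0#           ≈⟨ +-identityʳ _ ⟩
      sumTo B g                ∎

  -- The sum with b + 1 recurs with a raised and both M' and L lowered by one, so induction on L
  -- determines it.
  H-raise : ∀ {B} b a M' L → suc M' ≤ B →
    H B (suc b) a M' L + p ^ (suc (a ℕ.+ M' ℕ.+ a)) * S (λ M' → S (H B (suc b) (suc a) M') L) M'
    ≈ S (λ M' → H B b (suc a) M' L) M' + p ^ M' * S (H B b a M') L
  H-raise {B} b a M' L M'<B = begin
    H B (suc b) a M' L + p ^ (suc (a ℕ.+ M' ℕ.+ a)) * S (λ M' → S (H B (suc b) (suc a) M') L) M'
      ≈⟨ +-congˡ eqB ⟨
    H B (suc b) a M' L + sumTo B (λ α → ω a α * (θ α * Bs α))
      ≈⟨ sum-+ B ⟨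
    sumTo B f
      ≈⟨ sums ⟩
    sumTo B g
      ≈⟨ trans (sum-+ B) (+-cong eqC eqD) ⟩
    S (λ M' → H B b (suc a) M' L) M' + p ^ M' * S (H B b a M') L ∎
    where
    open RaiseDual B b a M' L M'<B
    null : ∀ {w z : Seq} → sumTo B (λ i → w i * (z i * 0#)) ≈ 0#
    null = sum-zero B (λ i → *-zeroʳ (zeroʳ _))
    gone : ∀ L x y → x * (sh B (gx L) M' * y) ≈ 0#
    gone L x y = *-zeroʳ (*-zeroˡ (≡⇒≈ (sh-over B (gx L) M' M'<B)))
    +suc : ∀ α f → sh (a ℕ.+ suc α) f L ≈ sh (suc (a ℕ.+ α)) f L
    +suc α f = ≡⇒≈ (≡.cong (λ n → sh n f L) (ℕₚ.+-suc a α))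
    eqC : sumTo B (λ α → ω' α * (γ α * C α)) ≈ S (λ M' → H B b (suc a) M' L) M'
    eqC = trans (sum-cong B shape) (trans (sum-S B gC gone⁺) (lift M'))
      where
      gC : Seq
      gC α = ω (suc a) α * (sh (suc α) (gx (suc L)) M' * sh (suc a ℕ.+ α) (λ μ → T μ b (suc a) α) L)
      shape : ∀ α → ω' α * (γ α * C α) ≈ S gC α
      shape zero    = zeroˡ _
      shape (suc α) = *-congˡ (*-congˡ (+suc α (λ μ → T μ b (suc a) α)))
      gone⁺ : ω (suc a) B * (sh (suc B) (gx (suc L)) M' * sh (suc a ℕ.+ B) (λ μ → T μ b (suc a) B) L) ≈ 0#
      gone⁺ = *-zeroʳ (*-zeroˡ (≡⇒≈ (sh-over (suc B) (gx (suc L)) M' (ℕₚ.m<n⇒m<1+n M'<B))))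
      lift : ∀ M' → sumTo B (λ α → ω (suc a) α * (sh (suc α) (gx (suc L)) M' * sh (suc a ℕ.+ α) (λ μ → T μ b (suc a) α) L))
             ≈ S (λ M' → H B b (suc a) M' L) M'
      lift zero    = sum-zero B (λ i → *-zeroʳ (zeroˡ _))
      lift (suc M') = refl
    eqD : sumTo B (λ α → ω' α * (θ α * D α)) ≈ p ^ M' * S (H B b a M') L
    eqD = trans (sum-cong B shape) (trans (sum-S B gD (*-zeroʳ (gone L _ _))) (trans (sum-*ˡ B _) (*-congˡ (lift L))))
      where
      hD : ℕ → Seq
      hD L α = ω a α * (sh α (gx L) M' * sh (suc (a ℕ.+ α)) (λ μ → T μ b a α) L)
      gD : Seq
      gD α = p ^ M' * hD L α
      shape : ∀ α → ω' α * (θ α * D α) ≈ S gD α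
      shape zero    = zeroˡ _
      shape (suc α) = trans (*-cong (ω-up a α) (*-congˡ (+suc α (λ μ → T μ b a α))))
        (trans (solve 4 (λ w x y z → (w :* x) :* (y :* z) := (x :* y) :* (w :* z)) refl (ω a α) (p ^ α) _ _)
          (trans (*-congʳ (sh-scale α p (gx L) M')) (solve 4 (λ w x y z → (x :* y) :* (w :* z) := x :* (w :* (y :* z))) refl (ω a α) (p ^ M') _ _)))
      lift : ∀ L → sumTo B (hD L) ≈ S (H B b a M') L
      lift zero    = null
      lift (suc L) = refl
    eqB : sumTo B (λ α → ω a α * (θ α * Bs α)) ≈ p ^ (suc (a ℕ.+ M' ℕ.+ a)) * S (λ M' → S (H B (suc b) (suc a) M') L) M'
    eqB = trans (sum-cong B (shape M')) (trans (sum-S B (S (gB M')) (gone⁺⁺ B M'<B)) (trans (sum-S B (gB M') (gone⁺ M' B (ℕₚ.<⇒≤ M'<B))) (lift M')))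
      where
      hB : ℕ → ℕ → Seq
      hB M'' L α = ω (suc a) α * (sh α (gx L) M'' * sh (suc (suc (a ℕ.+ α))) (λ μ → T μ (suc b) (suc a) α) L)
      y = (p ^ suc a * s) * (p ^ a * s)
      gB : ℕ → Seq
      gB zero     α = 0#
      gB (suc M'') α = p ^ M'' * y * hB M'' L α
      gone⁺ : ∀ M' α → M' ≤ α → gB M' α ≈ 0#
      gone⁺ zero     α _   = refl
      gone⁺ (suc M'') α M'≤α = *-zeroʳ (*-zeroʳ (*-zeroˡ (≡⇒≈ (sh-over α (gx L) M'' M'≤α))))
      gone⁺⁺ : ∀ B → suc M' ≤ B → S (gB M') B ≈ 0#
      gone⁺⁺ (suc B) (s≤s M'≤B) = gone⁺ M' B M'≤B
      shape : ∀ M' α → ω a α * (sh α (scale p (gx L)) (suc M') * Bs α) ≈ S (S (gB M')) α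
      shape M' zero = *-zeroʳ (*-zeroʳ (vanish (a ℕ.+ 0)))
      shape M' (suc zero) = *-zeroʳ (*-zeroʳ (vanish (a ℕ.+ 1)))
      shape zero (suc (suc α)) = *-zeroʳ (zeroˡ _)
      shape (suc M'') (suc (suc α)) = trans
        (*-cong (trans (ω-suc a (suc α)) (*-congʳ (trans (ω-suc (suc a) α) (*-congʳ (ω-up (suc a) α)))))
          (*-congˡ (≡⇒≈ (≡.cong (λ n → sh n (λ μ → T μ (suc b) (suc a) α) L) (≡.trans (ℕₚ.+-suc a (suc α)) (≡.cong suc (ℕₚ.+-suc a α)))))))
        (trans (solve 6 (λ w P u v g t → ((w :* P) :* u) :* v :* (g :* t) := (P :* g) :* (u :* v) :* (w :* t)) refl
            (ω (suc a) α) (p ^ α) (p ^ suc a * s) (p ^ a * s) _ _)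
          (trans (*-congʳ (*-congʳ (sh-scale α p (gx L) M'')))
            (solve 5 (λ P g y w t → (P :* g) :* y :* (w :* t) := P :* y :* (w :* (g :* t))) refl (p ^ M'') _ y _ _)))
      lift : ∀ M' → sumTo B (gB M') ≈ p ^ (suc (a ℕ.+ M' ℕ.+ a)) * S (λ M' → S (H B (suc b) (suc a) M') L) M'
      lift zero = trans (sum-zero B (λ _ → refl)) (sym (zeroʳ _))
      lift (suc M'') = trans (sum-*ˡ B _) (*-cong
        (sym (trans (*-congˡ (trans (^-+ p (a ℕ.+ suc M'') a) (*-congʳ (^-+ p a (suc M'')))))
          (solve 3 (λ s x P → s :* s :* ((x :* (s :* s :* P)) :* x) := P :* ((s :* s :* x :* s) :* (x :* s))) refl s (p ^ a) (p ^ M''))))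
        (liftL L))
        where
        liftL : ∀ L → sumTo B (hB M'' L) ≈ S (H B (suc b) (suc a) M'') L
        liftL zero    = null
        liftL (suc L) = refl

  -- cc N A n = s^(n²) p^(nA) [N brack n + A]_p
  cc : ℕ → ℕ → Seq
  cc N       zero    n = cf N n
  cc zero    (suc A) n = 0#
  cc (suc N) (suc A) n = cc N (suc A) n + p ^ (N ∸ A) * cc N A n

  cc-over : ∀ N A n → N ℕ.< A → cc N A n ≈ 0#
  cc-over zero    (suc A) n _         = refl
  cc-over (suc N) (suc A) n (s≤s N<A) = trans
    (+-cong (cc-over N (suc A) n (ℕₚ.m<n⇒m<1+n N<A)) (*-zeroʳ (cc-over N A n N<A))) (+-identityˡ _)

  -- The binomial depends only on n + A, and the exponents of s satisfy (n+1)² + 2A(n+1) = (2A+1) +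
  -- n² + 2n(A+1). One unit thus moves from n to A.
  cc-suc : ∀ N A n → cc N A (suc n) ≈ (p ^ A * s) * cc N (suc A) n
  cc-suc zero zero n = sym (zeroʳ _)
  cc-suc zero (suc A) n = sym (zeroʳ _)
  cc-suc (suc N) zero n = trans (+-congʳ (cc-suc N 0 n))
    (solve 4 (λ x P s f → (con 1 :* s) :* x :+ (P :* s) :* f := (con 1 :* s) :* (x :+ P :* f)) refl (cc N 1 n) (p ^ N) s (cf N n))
  cc-suc (suc N) (suc A) n = trans (+-cong (cc-suc N (suc A) n) (*-congˡ (cc-suc N A n)))
    (trans (solve 6 (λ s x c₂ z P c₁ → (s :* s :* x :* s) :* c₂ :+ z :* ((x :* s) :* c₁)
        := (s :* s :* x :* s) :* c₂ :+ (x :* s) :* (z :* c₁)) refl s (p ^ A) (cc N (suc (suc A)) n) (p ^ (N ∸ A)) (p ^ (N ∸ suc A)) (cc N (suc A) n))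
      (trans (+-congˡ (*-congˡ (drop (ℕₚ.<-≤-connex N (suc A)))))
        (solve 5 (λ s x c₂ z c₁ → (s :* s :* x :* s) :* c₂ :+ (x :* s) :* ((s :* s :* z) :* c₁)
          := (s :* s :* x :* s) :* (c₂ :+ z :* c₁)) refl s (p ^ A) (cc N (suc (suc A)) n) (p ^ (N ∸ suc A)) (cc N (suc A) n))))
    where
    -- `N ∸ A` exceeds `N ∸ suc A` by one only for A < N. In the remaining case the coefficient
    -- beside it vanishes.
    drop : N ℕ.< suc A Sum.⊎ suc A ≤ N → p ^ (N ∸ A) * cc N (suc A) n ≈ (p * p ^ (N ∸ suc A)) * cc N (suc A) n
    drop (Sum.inj₁ N<A) = trans (*-congˡ (cc-over N (suc A) n N<A)) (trans (zeroʳ _)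
      (sym (*-zeroʳ (cc-over N (suc A) n N<A))))
    drop (Sum.inj₂ A<N) = *-congʳ (^-congʳ p (≡.trans (ℕₚ.+-∸-assoc 1 {N} {suc A} A<N) ≡.refl))

  cf-over : ∀ M n → M ℕ.< n → cf M n ≈ 0#
  cf-over zero    (suc n) _         = refl
  cf-over (suc M) (suc n) (s≤s M<n) = trans
    (+-cong (cf-over M (suc n) (ℕₚ.m<n⇒m<1+n M<n)) (*-zeroʳ (cf-over M n M<n))) (+-identityˡ _)

  -- W B (M - b) (M + b) (a + b) M L is S(L,M;a+b,a).
  W : ℕ → ℕ → ℕ → ℕ → ℕ → Seq
  W B μ N A M L = sumTo B λ n → cf μ n * (cc N A n * sh (A ℕ.+ (n ℕ.+ n)) (gx (suc M)) L)

  sum-S-out : ∀ B (x y : Seq) (d : ℕ → ℕ) f L →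
    S (λ L → sumTo B (λ n → x n * (y n * sh (d n) f L))) L ≈ sumTo B (λ n → x n * (y n * sh (suc (d n)) f L))
  sum-S-out B x y d f zero    = sym (sum-zero B (λ n → *-zeroʳ (zeroʳ _)))
  sum-S-out B x y d f (suc L) = refl

  W-over : ∀ B μ N A M L → N ℕ.< A → W B μ N A M L ≈ 0#
  W-over B μ N A M L N<A = sum-zero B (λ n → *-zeroʳ (*-zeroˡ (cc-over N A n N<A)))

  -- The sum with upper entries μ + 1 and N + 1 is expanded by a Pascal rule in the one or in the
  -- other binomial. The two expansions are the two sides.
  W-raise : ∀ {B} μ N A M L → μ ℕ.< B →
    W B μ (suc N) (suc A) M L + p ^ (suc (μ ℕ.+ suc A)) * S (W B μ (suc N) (suc (suc A)) M) L
    ≈ W B (suc μ) N (suc A) M L + p ^ (N ∸ A) * S (W B (suc μ) N A M) L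
  W-raise {B} μ N A M L μ<B = begin
    W B μ (suc N) (suc A) M L + p ^ (suc (μ ℕ.+ suc A)) * S (W B μ (suc N) (suc (suc A)) M) L
      ≈⟨ +-congˡ (*-congˡ (sum-S-out B (cf μ) (cc (suc N) (suc (suc A))) (λ n → suc (suc A) ℕ.+ (n ℕ.+ n)) (gx (suc M)) L)) ⟩
    W B μ (suc N) (suc A) M L + p ^ (suc (μ ℕ.+ suc A)) * sumTo B (λ n → cf μ n * (cc (suc N) (suc (suc A)) n * t (suc (suc (suc A) ℕ.+ (n ℕ.+ n)))))
      ≈⟨ +-congˡ (trans (sym (sum-*ˡ B _)) (trans (sum-cong B shape) (sym (sum-S B X (*-zeroˡ (cf-over μ B μ<B)))))) ⟩
    W B μ (suc N) (suc A) M L + sumTo B (S X)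
      ≈⟨ +-congˡ (trans (sum-cong B shape′) (sum-*ˡ B _)) ⟩
    W B μ (suc N) (suc A) M L + (p ^ μ * s) * sumTo B (λ n → S (cf μ) n * Z n)
      ≈⟨ sum-lin B (p ^ μ * s) (λ n → trans (distribʳ _ _ _) (+-congˡ (*-assoc _ _ _))) ⟨
    sumTo B (λ n → cf (suc μ) n * Z n)
      ≈⟨ sum-lin B (p ^ (N ∸ A)) (λ n → solve 5 (λ f x y P z → f :* ((x :+ P :* y) :* z) := f :* (x :* z) :+ P :* (f :* (y :* z))) refl
           (cf (suc μ) n) (cc N (suc A) n) (cc N A n) (p ^ (N ∸ A)) (t (suc A ℕ.+ (n ℕ.+ n)))) ⟩
    W B (suc μ) N (suc A) M L + p ^ (N ∸ A) * sumTo B (λ n → cf (suc μ) n * (cc N A n * t (suc (A ℕ.+ (n ℕ.+ n)))))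
      ≈⟨ +-congˡ (*-congˡ (sum-S-out B (cf (suc μ)) (cc N A) (λ n → A ℕ.+ (n ℕ.+ n)) (gx (suc M)) L)) ⟨
    W B (suc μ) N (suc A) M L + p ^ (N ∸ A) * S (W B (suc μ) N A M) L ∎
    where
    t : ℕ → Carrier
    t d = sh d (gx (suc M)) L
    Z X : Seq
    Z n = cc (suc N) (suc A) n * t (suc A ℕ.+ (n ℕ.+ n))
    X n = cf μ n * ((p ^ μ * s) * Z (suc n))
    shape : ∀ n → p ^ (suc (μ ℕ.+ suc A)) * (cf μ n * (cc (suc N) (suc (suc A)) n * t (suc (suc (suc A) ℕ.+ (n ℕ.+ n))))) ≈ X n
    shape n = sym (trans (*-congˡ (*-congˡ (*-cong (cc-suc (suc N) (suc A) n)
        (≡⇒≈ (≡.cong t (≡.cong suc (≡.trans (≡.cong (A ℕ.+_) (≡.cong suc (ℕₚ.+-suc n n))) (≡.trans (ℕₚ.+-suc A _) (≡.cong suc (ℕₚ.+-suc A _))))))))))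
      (trans (solve 6 (λ f P s Q c t → f :* ((P :* s) :* ((Q :* s) :* c :* t)) := (s :* s :* (P :* Q)) :* (f :* (c :* t))) refl
          (cf μ n) (p ^ μ) s (p ^ suc A) _ _)
        (*-congʳ (*-congˡ (sym (^-+ p μ (suc A)))))))
    shape′ : ∀ n → S X n ≈ (p ^ μ * s) * (S (cf μ) n * Z n)
    shape′ zero    = sym (*-zeroʳ (zeroˡ _))
    shape′ (suc n) = solve 3 (λ f P z → f :* (P :* z) := P :* (f :* z)) refl _ _ _

  H-closed-step : ∀ {B M} b μ → M ℕ.< B → μ ℕ.+ suc b ≡ M →
    (∀ a M' L → a ℕ.+ M' ≡ M → H B b a M' L ≈ W B (suc μ) (b ℕ.+ M) (b ℕ.+ a) M L) →
    ∀ L a M' → a ℕ.+ M' ≡ M → H B (suc b) a M' L ≈ W B μ (suc b ℕ.+ M) (suc b ℕ.+ a) M L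
  H-closed-step {B} {M} b μ M<B μ+b≡M ih = go
    where
    go : ∀ L a M' → a ℕ.+ M' ≡ M → H B (suc b) a M' L ≈ W B μ (suc b ℕ.+ M) (suc b ℕ.+ a) M L
    go₂ : ∀ L a M' → a ℕ.+ M' ≡ M →
          S (λ M' → S (H B (suc b) (suc a) M') L) M' ≈ S (W B μ (suc b ℕ.+ M) (suc b ℕ.+ suc a) M) L
    go L a M' a+M'≡M = +-cancelʳ (x * S (λ M' → S (H B (suc b) (suc a) M') L) M') _ _ (begin
      H B (suc b) a M' L + x * S (λ M' → S (H B (suc b) (suc a) M') L) M'
        ≈⟨ H-raise b a M' L (ℕₚ.≤-<-trans (ℕₚ.m+n≤o⇒n≤o a (ℕₚ.≤-reflexive a+M'≡M)) M<B) ⟩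
      S (λ M' → H B b (suc a) M' L) M' + p ^ M' * S (H B b a M') L
        ≈⟨ +-cong (third M' a+M'≡M) (*-cong (^-congʳ p (≡.sym e₂)) (S-cong (λ L → ih a M' L a+M'≡M) L)) ⟩
      W B (suc μ) (b ℕ.+ M) (suc (b ℕ.+ a)) M L + p ^ ((b ℕ.+ M) ∸ (b ℕ.+ a)) * S (W B (suc μ) (b ℕ.+ M) (b ℕ.+ a) M) L
        ≈⟨ W-raise μ (b ℕ.+ M) (b ℕ.+ a) M L (ℕₚ.≤-<-trans (ℕₚ.m+n≤o⇒m≤o μ (ℕₚ.≤-reflexive μ+b≡M)) M<B) ⟨
      W B μ (suc b ℕ.+ M) (suc b ℕ.+ a) M L + p ^ (suc (μ ℕ.+ suc (b ℕ.+ a))) * S (W B μ (suc b ℕ.+ M) (suc (suc (b ℕ.+ a))) M) L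
        ≈⟨ +-congˡ (*-cong (^-congʳ p e₁) (trans (≡⇒≈ (≡.cong (λ A → S (W B μ (suc b ℕ.+ M) (suc A) M) L) (≡.sym (ℕₚ.+-suc b a)))) (sym (go₂ L a M' a+M'≡M)))) ⟩
      W B μ (suc b ℕ.+ M) (suc b ℕ.+ a) M L + x * S (λ M' → S (H B (suc b) (suc a) M') L) M' ∎)
      where
      x = p ^ (suc (a ℕ.+ M' ℕ.+ a))
      e₁ : suc (μ ℕ.+ suc (b ℕ.+ a)) ≡ suc (a ℕ.+ M' ℕ.+ a)
      e₁ = ≡.cong suc (≡.trans (≡.sym (ℕₚ.+-assoc μ (suc b) a)) (≡.cong (ℕ._+ a) (≡.trans μ+b≡M (≡.sym a+M'≡M))))
      e₂ : (b ℕ.+ M) ∸ (b ℕ.+ a) ≡ M'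
      e₂ = ≡.trans (ℕₚ.[m+n]∸[m+o]≡n∸o b M a) (≡.trans (≡.cong (_∸ a) (≡.sym a+M'≡M)) (ℕₚ.m+n∸m≡n a M'))
      third : ∀ M' → a ℕ.+ M' ≡ M → S (λ M' → H B b (suc a) M' L) M' ≈ W B (suc μ) (b ℕ.+ M) (suc (b ℕ.+ a)) M L
      -- M' = 0 means a = M, and the corresponding `W` has a lower entry above its upper entry b +
      -- M.
      third zero eq = sym (W-over B (suc μ) (b ℕ.+ M) (suc (b ℕ.+ a)) M L
        (s≤s (ℕₚ.+-monoʳ-≤ b (ℕₚ.≤-reflexive (≡.trans (≡.sym eq) (ℕₚ.+-identityʳ a))))))
      third (suc M') eq = trans (ih (suc a) M' L (≡.trans (≡.sym (ℕₚ.+-suc a M')) eq))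
        (≡⇒≈ (≡.cong (λ A → W B (suc μ) (b ℕ.+ M) A M L) (ℕₚ.+-suc b a)))
    go₂ L a zero eq = sym (S-zero (λ L → W-over B μ (suc b ℕ.+ M) (suc b ℕ.+ suc a) M L
      (ℕₚ.+-monoʳ-< (suc b) (s≤s (ℕₚ.≤-reflexive (≡.trans (≡.sym eq) (ℕₚ.+-identityʳ a)))))) L)
    go₂ zero    a (suc M') eq = refl
    go₂ (suc L) a (suc M') eq = go L (suc a) M' (≡.trans (≡.sym (ℕₚ.+-suc a M')) eq)

  -- Second transformation: the case b = 0.

  V-dual : ∀ μ a k → V (suc μ) a k + S (S (V (suc μ) a)) k
    ≈ S (S (V (suc μ) (suc a))) k + lower (V (suc μ)) a k + p ^ a * (p ^ k * V μ a k + s * S (scale p (V μ a)) k)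
  V-dual μ a k = trans (core a) (+-congˡ (*-congˡ (K-split a k)))
    where
    u : Seq
    u = cf (suc μ)
    -- Cancelling 1 - x and 1 - y leaves both denominators dilated. Splitting 1 + sz off dilates the
    -- numerator as well, so the rest is V μ at pz.
    K-split : ∀ a k → K u (suc μ) (suc μ) a k ≈ p ^ k * V μ a k + s * S (scale p (V μ a)) k
    K-split a k = trans (conv-linˡ _ s (cf-dual μ) k) (+-cong (K-scale (cf μ) (suc μ) (suc μ) a k)
      (*-congˡ (trans (conv-Sˡ _ _ k) (S-cong (K-scale (cf μ) (suc μ) (suc μ) a) k))))
    t : ℕ → Seq
    t = V (suc μ)
    j : ℕ → Seq
    j = J u (suc (suc μ)) (suc μ)
    core : ∀ a → t a k + S (S (t a)) k ≈ S (S (t (suc a))) k + lower t a k + p ^ a * K u (suc μ) (suc μ) a k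
    core zero = begin
      t 0 k + S (S (t 0)) k
        ≈⟨ +-congʳ (trans (U-x-dual u μ (suc (suc μ)) 0 k) (+-congʳ (trans (J-sym u (suc μ) (suc (suc μ)) k) (J-x u μ (suc μ) 0 k)))) ⟩
      ((K u (suc μ) (suc μ) 0 k + p * S (S (j 1)) k) + 1# * S (S (t 1)) k) + S (S (t 0)) k
        ≈⟨ solve 5 (λ κ j t₁ t₀ s → ((κ :+ s :* s :* j) :+ con 1 :* t₁) :+ t₀ := t₁ :+ (t₀ :+ (s :* s :* con 1) :* j) :+ con 1 :* κ) refl _ _ _ _ s ⟩
      S (S (t 1)) k + (S (S (t 0)) k + p ^ 1 * S (S (j 1)) k) + 1# * K u (suc μ) (suc μ) 0 k
        ≈⟨ +-congʳ (+-congˡ (S-lin (p ^ 1) (S-lin (p ^ 1) (U-y-dual u (suc (suc μ)) (suc μ) 0)) k)) ⟨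
      S (S (t 1)) k + S (S (t 1)) k + 1# * K u (suc μ) (suc μ) 0 k ∎
    core (suc a) = begin
      t (suc a) k + S (S (t (suc a))) k
        ≈⟨ +-congʳ (trans (U-y-dual u (suc (suc μ)) (suc μ) a k) (+-congˡ (*-congˡ (J-x u μ (suc μ) (suc a) k)))) ⟩
      (t a k + p ^ suc a * (K u (suc μ) (suc μ) (suc a) k + p * S (S (j (suc (suc a)))) k)) + S (S (t (suc a))) k
        ≈⟨ solve 6 (λ t P κ s j t' → (t :+ P :* (κ :+ s :* s :* j)) :+ t' := (t' :+ (s :* s :* P) :* j) :+ t :+ P :* κ) refl (t a k) (p ^ suc a) _ s _ _ ⟩
      (S (S (t (suc a))) k + p ^ suc (suc a) * S (S (j (suc (suc a)))) k) + t a k + p ^ suc a * K u (suc μ) (suc μ) (suc a) k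
        ≈⟨ +-congʳ (+-congʳ (S-lin _ (S-lin _ (U-y-dual u (suc (suc μ)) (suc μ) (suc a))) k)) ⟨
      S (S (t (suc (suc a)))) k + t a k + p ^ suc a * K u (suc μ) (suc μ) (suc a) k ∎

  H₀ : ℕ → ℕ → ℕ → Seq
  H₀ B a M' L = sumTo B λ α → ω a α * (sh α (gx (suc L)) M' * sh (a ℕ.+ α) (λ μ → V μ a α) L)

  -- Lowering a at fixed M' lowers M = a + M' by one. At a = 0 the reflection to a = 1 then leaves
  -- M' - 2.
  lowerH : ℕ → ℕ → ℕ → Seq
  lowerH B zero    M' L = S (S (λ M' → S (H₀ B 1 M') L)) M'
  lowerH B (suc a) M' L = S (H₀ B a M') L

  sh-rel₅ : ∀ n {f₁ f₂ f₃ f₄ f₅} x → (∀ k → f₁ k + f₂ k ≈ f₃ k + f₄ k + x * f₅ k) →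
            ∀ k → sh n f₁ k + sh n f₂ k ≈ sh n f₃ k + sh n f₄ k + x * sh n f₅ k
  sh-rel₅ zero    x eq k       = eq k
  sh-rel₅ (suc n) x eq zero    = solve 1 (λ x → con 0 :+ con 0 := con 0 :+ con 0 :+ x :* con 0) refl x
  sh-rel₅ (suc n) x eq (suc k) = sh-rel₅ n x eq k

  sum-SS : ∀ B f → S f B ≈ 0# → f B ≈ 0# → sumTo B (S (S f)) ≈ sumTo B f
  sum-SS B f e e' = trans (sum-S B (S f) e) (sum-S B f e')

  module BaseDual (B a M' L₁ : ℕ) (M'<B : suc M' ≤ B) where
    L : ℕ
    L = suc L₁

    A X Y Z D Es θ w : Seq
    A α = sh (a ℕ.+ α) (λ μ → V μ a α) L
    X α = sh (a ℕ.+ α) (λ μ → S (S (V μ (suc a))) α) L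
    Y α = sh (a ℕ.+ α) (λ μ → lower (V μ) a α) L
    Z α = sh (a ℕ.+ α) (λ μ → S (S (V μ a)) α) L
    D α = sh (suc (a ℕ.+ α)) (λ μ → V μ a α) L
    Es α = sh (suc (a ℕ.+ α)) (λ μ → S (scale p (V μ a)) α) L
    θ α = sh α (scale p (gx L)) M'
    w = ω a

    vanish : ∀ n → sh n (λ _ → 0#) L ≈ 0#
    vanish n = sh-zero n (λ _ → refl) L

    rel : ∀ α → A α + Z α ≈ X α + Y α + p ^ a * (p ^ α * D α + s * Es α)
    rel α = trans (lifted a α) (+-congˡ (*-congˡ (trans (sh-lin (suc (a ℕ.+ α)) {g = λ μ → p ^ α * V μ a α} {h = λ μ → S (scale p (V μ a)) α} s (λ k → refl) L)
        (+-congʳ (sh-hom (suc (a ℕ.+ α)) {g = λ μ → V μ a α} (p ^ α) (λ k → refl) L)))))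
      where
      Q : ℕ → ℕ → Seq
      Q a α μ = p ^ α * V μ a α + s * S (scale p (V μ a)) α
      all : ∀ a α n → sh n (S (Q a α)) L ≈ S (sh n (Q a α)) L
      all a α n = ≡⇒≈ (sh-S n (Q a α) L)
      Lifted : ℕ → ℕ → ℕ → Set ℓ
      Lifted a α n = sh n (λ μ → V μ a α) L + sh n (λ μ → S (S (V μ a)) α) L
        ≈ sh n (λ μ → S (S (V μ (suc a))) α) L + sh n (λ μ → lower (V μ) a α) L + p ^ a * sh (suc n) (Q a α) L
      from₀ : ∀ a α n → (V 0 a α + S (S (V 0 a)) α ≈ S (S (V 0 (suc a))) α + lower (V 0) a α) → Lifted a α n
      from₀ a α n eq₀ = trans (sh-rel₅ n {f₅ = S (Q a α)} (p ^ a) at L) (+-congˡ (*-congˡ (all a α n)))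
        where
        at : ∀ μ → V μ a α + S (S (V μ a)) α ≈ S (S (V μ (suc a))) α + lower (V μ) a α + p ^ a * S (Q a α) μ
        at zero    = trans eq₀ (sym (trans (+-congˡ (zeroʳ _)) (+-identityʳ _)))
        at (suc μ) = V-dual μ a α
      lifted : ∀ a α → Lifted a α (a ℕ.+ α)
      -- Only at a = α = 0 would the constant term of (1 - x)(1 - y) V 0 interfere. There nothing is
      -- shifted and `L` is a successor, so `V-dual` applies as it stands.
      lifted zero    zero    = V-dual L₁ 0 0
      lifted (suc a) zero    = from₀ (suc a) 0 (suc a ℕ.+ 0) (trans (+-identityʳ _) (trans (V₀-suc a 0) (sym (+-identityˡ _))))
      lifted a       (suc α) = from₀ a (suc α) (a ℕ.+ suc α) (V₀-rec a α)

    ΣA ΣX ΣY ΣZ ΣE : Carrier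
    ΣA = sumTo B (λ α → w α * (θ α * A α))
    ΣX = sumTo B (λ α → w α * (θ α * X α))
    ΣY = sumTo B (λ α → w α * (θ α * Y α))
    ΣZ = sumTo B (λ α → w α * (θ α * Z α))
    ΣE = sumTo B (λ α → w α * (θ α * Es α))

    sumD : sumTo B (λ α → p ^ α * (w α * (θ α * D α))) ≈ p ^ M' * H₀ B a M' L₁
    sumD = trans (sum-cong B (λ α → trans (solve 4 (λ P w t d → P :* (w :* (t :* d)) := (P :* t) :* (w :* d)) refl (p ^ α) (w α) (θ α) (D α))
        (trans (*-congʳ (sh-scale α p (gx L) M')) (solve 4 (λ P t w d → (P :* t) :* (w :* d) := P :* (w :* (t :* d))) refl (p ^ M') _ (w α) (D α)))))
      (sum-*ˡ B _)

    sumA : H₀ B a M' L ≈ S (λ M' → H₀ B a M' L) M' + ΣA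
    sumA = trans (trans (sum-cong B (λ α → trans (*-congˡ (*-congʳ (sh-gx-dual α L M')))
        (solve 4 (λ w x y A → w :* ((x :+ y) :* A) := w :* (x :* A) :+ w :* (y :* A)) refl (w α) _ (θ α) (A α))))
      (sum-+ B)) (+-congʳ (lift M'))
      where
      lift : ∀ M' → sumTo B (λ α → w α * (sh (suc α) (gx (suc L)) M' * A α)) ≈ S (λ M' → H₀ B a M' L) M'
      lift zero     = sum-zero B (λ i → *-zeroʳ (zeroˡ _))
      lift (suc M') = refl

    total : ΣA + ΣZ ≈ ΣX + ΣY + (p ^ (a ℕ.+ M') * H₀ B a M' L₁ + (p ^ a * s) * ΣE)
    total = begin
      ΣA + ΣZ
        ≈⟨ sum-+ B ⟨
      sumTo B (λ α → w α * (θ α * A α) + w α * (θ α * Z α))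
        ≈⟨ sum-cong B (λ α → trans (solve 4 (λ w t a z → w :* (t :* a) :+ w :* (t :* z) := w :* (t :* (a :+ z))) refl (w α) (θ α) (A α) (Z α))
             (trans (*-congˡ (*-congˡ (rel α)))
               (solve 9 (λ w t x y Pa P d s e → w :* (t :* (x :+ y :+ Pa :* (P :* d :+ s :* e)))
                 := w :* (t :* x) :+ w :* (t :* y) :+ (Pa :* (P :* (w :* (t :* d))) :+ (Pa :* s) :* (w :* (t :* e))))
                 refl (w α) (θ α) (X α) (Y α) (p ^ a) (p ^ α) (D α) s (Es α)))) ⟩
      sumTo B (λ α → w α * (θ α * X α) + w α * (θ α * Y α)
          + (p ^ a * (p ^ α * (w α * (θ α * D α))) + (p ^ a * s) * (w α * (θ α * Es α))))
        ≈⟨ trans (sum-+ B) (+-cong (sum-+ B) (trans (sum-+ B) (+-cong (sum-*ˡ B _) (sum-*ˡ B _)))) ⟩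
      ΣX + ΣY + (p ^ a * sumTo B (λ α → p ^ α * (w α * (θ α * D α))) + (p ^ a * s) * ΣE)
        ≈⟨ +-congˡ (+-congʳ (trans (*-congˡ sumD) (trans (sym (*-assoc _ _ _)) (*-congʳ (sym (^-+ p a M')))))) ⟩
      ΣX + ΣY + (p ^ (a ℕ.+ M') * H₀ B a M' L₁ + (p ^ a * s) * ΣE) ∎

    nil : ∀ {x y z} → y ≈ 0# → x * (y * z) ≈ 0#
    nil eq = *-zeroʳ (*-zeroˡ eq)

    nilʳ : ∀ {x y z} → z ≈ 0# → x * (y * z) ≈ 0#
    nilʳ eq = *-zeroʳ (*-zeroʳ eq)

    sumX : ΣX ≈ p ^ (M' ℕ.+ (a ℕ.+ a)) * S (S (λ M' → H₀ B (suc a) M' L₁)) M'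
    sumX = trans (sum-cong B (shape M')) (trans (sum-SS B (g M') (end₁ B M'<B) (end₂ M' B (ℕₚ.<⇒≤ M'<B))) (lift M'))
      where
      hX : ℕ → Seq
      hX M'' α = ω (suc a) α * (sh α (gx L) M'' * sh (suc a ℕ.+ α) (λ μ → V μ (suc a) α) L₁)
      g : ℕ → Seq
      g (suc (suc M'')) α = p ^ M'' * ((p ^ suc a * s) * (p ^ a * s)) * hX M'' α
      g _ α = 0#
      end₂ : ∀ M' α → M' ≤ α → g M' α ≈ 0#
      end₂ zero           α _    = refl
      end₂ (suc zero)     α _    = refl
      end₂ (suc (suc M'')) α M'≤α = *-zeroʳ (nil (≡⇒≈ (sh-over α (gx L) M'' (ℕₚ.<⇒≤ M'≤α))))
      end₁ : ∀ B → suc M' ≤ B → S (g M') B ≈ 0#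
      end₁ (suc B) (s≤s M'≤B) = end₂ M' B M'≤B
      shape : ∀ M' α → w α * (sh α (scale p (gx L)) M' * X α) ≈ S (S (g M')) α
      shape M' zero = nilʳ (vanish (a ℕ.+ 0))
      shape M' (suc zero) = nilʳ (vanish (a ℕ.+ 1))
      shape zero (suc (suc α)) = nil refl
      shape (suc zero) (suc (suc α)) = nil refl
      shape (suc (suc M'')) (suc (suc α)) = trans
        (*-cong (trans (ω-suc a (suc α)) (*-congʳ (trans (ω-suc (suc a) α) (*-congʳ (ω-up (suc a) α))))) (*-congˡ (≡⇒≈ (≡.cong (λ n → sh n (λ μ → V μ (suc a) α) L) (≡.trans (ℕₚ.+-suc a (suc α)) (≡.cong suc (ℕₚ.+-suc a α)))))))
        (trans (solve 6 (λ w P u v g t → ((w :* P) :* u) :* v :* (g :* t) := (P :* g) :* (u :* v) :* (w :* t)) refl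
            (ω (suc a) α) (p ^ α) (p ^ suc a * s) (p ^ a * s) _ _)
          (trans (*-congʳ (*-congʳ (sh-scale α p (gx L) M'')))
            (solve 5 (λ P g y w t → (P :* g) :* y :* (w :* t) := P :* y :* (w :* (g :* t))) refl (p ^ M'') _ ((p ^ suc a * s) * (p ^ a * s)) _ _)))
      lift : ∀ M' → sumTo B (g M') ≈ p ^ (M' ℕ.+ (a ℕ.+ a)) * S (S (λ M' → H₀ B (suc a) M' L₁)) M'
      lift zero            = trans (sum-zero B (λ _ → refl)) (sym (zeroʳ _))
      lift (suc zero)      = trans (sum-zero B (λ _ → refl)) (sym (zeroʳ _))
      lift (suc (suc M'')) = trans (sum-*ˡ B _) (*-congʳ (sym (trans (*-congˡ (*-congˡ (trans (^-+ p M'' (a ℕ.+ a)) (*-congˡ (^-+ p a a)))))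
        (solve 3 (λ s P x → s :* s :* (s :* s :* (P :* (x :* x))) := P :* ((s :* s :* x :* s) :* (x :* s))) refl s (p ^ M'') (p ^ a)))))


    -- After reindexing, the dual Pascal rule splits the sum of the `Es` into two. The first is
    -- `ΣZ`, which cancels against the left of `total` in `H₀-rec`.
    Z-E : (p ^ a * s) * ΣE ≈ ΣZ + S (λ M'' → p ^ suc ((M'' ℕ.+ M'') ℕ.+ (a ℕ.+ a)) * S (H₀ B a M'') L₁) M'
    Z-E = go M' M'<B
      where
      V̂ : Seq
      V̂ δ = sh (suc (suc (a ℕ.+ δ))) (λ μ → V μ a δ) L
      y = p ^ a * s
      go : ∀ M' → suc M' ≤ B → y * sumTo B (λ α → w α * (sh α (scale p (gx L)) M' * Es α))
           ≈ sumTo B (λ α → w α * (sh α (scale p (gx L)) M' * Z α))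
             + S (λ M'' → p ^ suc ((M'' ℕ.+ M'') ℕ.+ (a ℕ.+ a)) * S (H₀ B a M'') L₁) M'
      go zero _ = trans (*-congˡ (trans (sum-first B (λ i → nil refl)) (nilʳ (vanish (suc (a ℕ.+ 0))))))
        (trans (zeroʳ _) (sym (trans (+-identityʳ _) (trans (sum-first B (λ i → nil refl)) (nilʳ (vanish (a ℕ.+ 0)))))))
      go (suc M'') M'<B = begin
        y * sumTo B (λ α → w α * (sh α (scale p (gx L)) (suc M'') * Es α))
          ≈⟨ *-congˡ (trans (sum-cong B shapeE) (trans (sum-S B gE endE) (sum-*ˡ B _))) ⟩
        y * (p ^ M'' * sumTo B (λ δ → w (suc δ) * (sh δ (gx L) M'' * V̂ δ)))
          ≈⟨ *-congˡ (*-congˡ (trans (sum-cong B (λ δ → trans (*-congˡ (*-congʳ (sh-gx-dual δ L₁ M'')))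
                (solve 4 (λ w a b v → w :* ((a :+ b) :* v) := w :* (a :* v) :+ w :* (b :* v)) refl (w (suc δ)) _ _ (V̂ δ)))) (sum-+ B))) ⟩
        y * (p ^ M'' * (sumTo B (λ δ → w (suc δ) * (sh (suc δ) (gx L) M'' * V̂ δ)) + sumTo B (λ δ → w (suc δ) * (sh δ (scale p (gx L₁)) M'' * V̂ δ))))
          ≈⟨ solve 4 (λ y P a b → y :* (P :* (a :+ b)) := (y :* P) :* a :+ (y :* P) :* b) refl y (p ^ M'') _ _ ⟩
        (y * p ^ M'') * sumTo B (λ δ → w (suc δ) * (sh (suc δ) (gx L) M'' * V̂ δ)) + (y * p ^ M'') * sumTo B (λ δ → w (suc δ) * (sh δ (scale p (gx L₁)) M'' * V̂ δ))
          ≈⟨ +-cong (trans (sym (sum-*ˡ B _)) (trans (sym (sum-SS B gZ (endZ₁ B M'<B) (endZ₂ B (ℕₚ.<⇒≤ M'<B)))) (sym (sum-cong B shapeZ))))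
               (trans (*-congˡ (trans (sum-cong B shapeR) (sum-*ˡ B _))) (trans (sym (*-assoc _ _ _)) (*-cong expo (liftR L₁)))) ⟩
        sumTo B (λ α → w α * (sh α (scale p (gx L)) (suc M'') * Z α)) + p ^ suc ((M'' ℕ.+ M'') ℕ.+ (a ℕ.+ a)) * S (H₀ B a M'') L₁ ∎
        where
        gE gZ : Seq
        gE δ = p ^ M'' * (w (suc δ) * (sh δ (gx L) M'' * V̂ δ))
        gZ δ = (y * p ^ M'') * (w (suc δ) * (sh (suc δ) (gx L) M'' * V̂ δ))
        endE : gE B ≈ 0#
        endE = *-zeroʳ (nil (≡⇒≈ (sh-over B (gx L) M'' (ℕₚ.<⇒≤ M'<B))))
        endZ₂ : ∀ δ → suc M'' ≤ δ → gZ δ ≈ 0#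
        endZ₂ δ M''<δ = *-zeroʳ (nil (≡⇒≈ (sh-over (suc δ) (gx L) M'' (ℕₚ.m<n⇒m<1+n M''<δ))))
        endZ₁ : ∀ B → suc (suc M'') ≤ B → S gZ B ≈ 0#
        endZ₁ (suc B) (s≤s M''<B) = endZ₂ B M''<B
        shapeE : ∀ α → w α * (sh α (scale p (gx L)) (suc M'') * Es α) ≈ S gE α
        shapeE zero    = nilʳ (vanish (suc (a ℕ.+ 0)))
        shapeE (suc δ) = trans (*-congˡ (*-congˡ (trans (≡⇒≈ (≡.cong (λ n → sh (suc n) (λ μ → p ^ δ * V μ a δ) L) (ℕₚ.+-suc a δ)))
            (sh-hom (suc (suc (a ℕ.+ δ))) {g = λ μ → V μ a δ} (p ^ δ) (λ _ → refl) L))))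
          (trans (solve 4 (λ w t P v → w :* (t :* (P :* v)) := (P :* t) :* (w :* v)) refl (w (suc δ)) _ (p ^ δ) (V̂ δ))
            (trans (*-congʳ (sh-scale δ p (gx L) M''))
              (solve 4 (λ w t P v → (P :* t) :* (w :* v) := P :* (w :* (t :* v))) refl (w (suc δ)) _ (p ^ M'') (V̂ δ))))
        shapeZ : ∀ α → w α * (sh α (scale p (gx L)) (suc M'') * Z α) ≈ S (S gZ) α
        shapeZ zero          = nilʳ (vanish (a ℕ.+ 0))
        shapeZ (suc zero)    = nilʳ (vanish (a ℕ.+ 1))
        shapeZ (suc (suc δ)) = trans (*-cong (trans (ω-suc a (suc δ)) (*-congʳ (ω-up a (suc δ))))
            (*-congˡ (≡⇒≈ (≡.cong (λ n → sh n (λ μ → V μ a δ) L) (≡.trans (ℕₚ.+-suc a (suc δ)) (≡.cong suc (ℕₚ.+-suc a δ)))))))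
          (trans (solve 5 (λ w P y t v → w :* P :* y :* (t :* v) := (P :* t) :* (y :* w :* v)) refl (w (suc δ)) (p ^ suc δ) y _ (V̂ δ))
            (trans (*-congʳ (sh-scale (suc δ) p (gx L) (M'')))
              (solve 5 (λ w P y t v → (P :* t) :* (y :* w :* v) := (y :* P) :* (w :* (t :* v))) refl (w (suc δ)) (p ^ M'') y _ (V̂ δ))))
        shapeR : ∀ δ → w (suc δ) * (sh δ (scale p (gx L₁)) M'' * V̂ δ) ≈ (y * p ^ M'') * (w δ * (sh δ (gx L₁) M'' * V̂ δ))
        shapeR δ = trans (*-congʳ (trans (ω-suc a δ) (*-congʳ (ω-up a δ))))
          (trans (solve 5 (λ w P y t v → w :* P :* y :* (t :* v) := (P :* t) :* (y :* w :* v)) refl (w δ) (p ^ δ) y _ (V̂ δ))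
            (trans (*-congʳ (sh-scale δ p (gx L₁) M''))
              (solve 5 (λ w P y t v → (P :* t) :* (y :* w :* v) := (y :* P) :* (w :* (t :* v))) refl (w δ) (p ^ M'') y _ (V̂ δ))))
        expo : (y * p ^ M'') * (y * p ^ M'') ≈ p ^ suc ((M'' ℕ.+ M'') ℕ.+ (a ℕ.+ a))
        expo = sym (trans (*-congˡ (trans (^-+ p (M'' ℕ.+ M'') (a ℕ.+ a)) (*-cong (^-+ p M'' M'') (^-+ p a a))))
          (solve 3 (λ s P x → s :* s :* ((P :* P) :* (x :* x)) := ((x :* s) :* P) :* ((x :* s) :* P)) refl s (p ^ M'') (p ^ a)))
        liftR : ∀ L₁ → sumTo B (λ δ → w δ * (sh δ (gx L₁) M'' * sh (suc (suc (a ℕ.+ δ))) (λ μ → V μ a δ) (suc L₁))) ≈ S (H₀ B a M'') L₁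
        liftR zero    = sum-zero B (λ _ → nilʳ refl)
        liftR (suc _) = refl

  sumY : ∀ B a M' L₁ M'<B → BaseDual.ΣY B a M' L₁ M'<B ≈ p ^ M' * lowerH B a M' (suc L₁)
  -- At a = 0 reflection makes this sum equal to `ΣX`.
  sumY B zero M' L₁ M'<B = trans (BaseDual.sumX B 0 M' L₁ M'<B) (*-congʳ (^-congʳ p (ℕₚ.+-identityʳ M')))
  sumY B (suc a) M' L₁ M'<B = trans (sum-cong B (λ α → trans (*-congʳ (ω-up a α))
      (trans (solve 4 (λ w P t v → w :* P :* (t :* v) := (P :* t) :* (w :* v)) refl (ω a α) (p ^ α) _ _)
        (trans (*-congʳ (sh-scale α p (gx (suc L₁)) M'))
          (solve 4 (λ w P t v → (P :* t) :* (w :* v) := P :* (w :* (t :* v))) refl (ω a α) (p ^ M') _ _)))))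
    (sum-*ˡ B _)

  H₀-rec : ∀ {B} a M' L → suc M' ≤ B →
    H₀ B a M' (suc L) ≈ p ^ (a ℕ.+ M') * H₀ B a M' L + S (λ M' → H₀ B a M' (suc L)) M' + p ^ M' * lowerH B a M' (suc L)
      + p ^ (M' ℕ.+ (a ℕ.+ a)) * S (S (λ M' → H₀ B (suc a) M' L)) M'
      + S (λ M'' → p ^ suc ((M'' ℕ.+ M'') ℕ.+ (a ℕ.+ a)) * S (H₀ B a M'') L) M'
  H₀-rec {B} a M' L M'<B = +-cancelʳ ΣZ _ _ (begin
    H₀ B a M' (suc L) + ΣZ
      ≈⟨ trans (+-congʳ sumA) (trans (+-assoc _ _ _) (+-congˡ total)) ⟩
    h₁ + (ΣX + ΣY + (h₀ + (p ^ a * s) * ΣE))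
      ≈⟨ +-congˡ (+-cong (+-cong sumX (sumY B a M' L M'<B)) (+-congˡ Z-E)) ⟩
    h₁ + (hx + hy + (h₀ + (ΣZ + hz)))
      ≈⟨ solve 6 (λ h₁ x y h₀ Z z → h₁ :+ (x :+ y :+ (h₀ :+ (Z :+ z))) := (h₀ :+ h₁ :+ y :+ x :+ z) :+ Z) refl h₁ hx hy h₀ ΣZ hz ⟩
    (h₀ + h₁ + hy + hx + hz) + ΣZ ∎)
    where
    open BaseDual B a M' L M'<B hiding (L)
    h₀ = p ^ (a ℕ.+ M') * H₀ B a M' L
    h₁ = S (λ M' → H₀ B a M' (suc L)) M'
    hx = p ^ (M' ℕ.+ (a ℕ.+ a)) * S (S (λ M' → H₀ B (suc a) M' L)) M'
    hy = p ^ M' * lowerH B a M' (suc L)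
    hz = S (λ M'' → p ^ suc ((M'' ℕ.+ M'') ℕ.+ (a ℕ.+ a)) * S (H₀ B a M'') L) M'

  cf-at-0 : ∀ M → cf M 0 ≈ 1#
  cf-at-0 zero    = refl
  cf-at-0 (suc M) = trans (+-cong (cf-at-0 M) (zeroʳ _)) (+-identityʳ _)

  -- The counterpart of p^M' `lowerH` on the line a + M' = M + 1. At a = 0 the reflected term has A
  -- = 1.
  lowerW : ℕ → ℕ → ℕ → ℕ → Carrier
  lowerW B M zero    L = p ^ suc M * W B M M 1 M L
  lowerW B M (suc a) L = p ^ (M ∸ a) * W B M M a M L

  -- One Pascal rule for each of the three binomials in the summand. The outcome has the same five
  -- terms as `H₀-rec`.
  W-rec : ∀ {B} M a L → a ≤ suc M → M ℕ.< B →
    W B (suc M) (suc M) a (suc M) (suc L)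
    ≈ p ^ suc M * W B (suc M) (suc M) a (suc M) L + W B M M a M (suc L) + lowerW B M a L
      + p ^ (suc M ℕ.+ a) * W B M M (suc a) M L + p ^ suc (M ℕ.+ M) * S (W B M M a M) L
  W-rec {B} M a L a≤ M<B = begin
    W B (suc M) (suc M) a (suc M) (suc L)
      ≈⟨ sum-lin B (p ^ suc M) {g = λ n → cf (suc M) n * (cc (suc M) a n * t (a ℕ.+ (n ℕ.+ n)))} split ⟩
    sumTo B (λ n → cf (suc M) n * (cc (suc M) a n * t (a ℕ.+ (n ℕ.+ n)))) + p ^ suc M * W B (suc M) (suc M) a (suc M) L
      ≈⟨ +-congʳ (trans (sum-lin B y {g = R₁ a} {h = λ n → S (cf M) n * (cc (suc M) a n * t (a ℕ.+ (n ℕ.+ n)))}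
            (λ n → trans (distribʳ _ _ _) (+-congˡ (*-assoc _ _ _))))
           (+-congˡ (*-congˡ (trans (sum-cong B shape) (sum-S B (R₂ a) (*-zeroˡ (cf-over M B M<B))))))) ⟩
    (sumTo B (R₁ a) + y * sumTo B (R₂ a)) + p ^ suc M * W B (suc M) (suc M) a (suc M) L
      ≈⟨ +-congʳ (main a a≤) ⟩
    (W B M M a M (suc L) + lowerW B M a L + p ^ (suc M ℕ.+ a) * W B M M (suc a) M L + p ^ suc (M ℕ.+ M) * S (W B M M a M) L)
      + p ^ suc M * W B (suc M) (suc M) a (suc M) L
      ≈⟨ solve 5 (λ a b d e f → (a :+ b :+ d :+ e) :+ f := f :+ a :+ b :+ d :+ e) refl _ _ _ _ _ ⟩
    p ^ suc M * W B (suc M) (suc M) a (suc M) L + W B M M a M (suc L) + lowerW B M a L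
      + p ^ (suc M ℕ.+ a) * W B M M (suc a) M L + p ^ suc (M ℕ.+ M) * S (W B M M a M) L ∎
    where
    y = p ^ M * s
    t : ℕ → Carrier
    t d = sh d (gx (suc M)) (suc L)
    R₁ R₂ : ℕ → Seq
    R₁ a n = cf M n * (cc (suc M) a n * t (a ℕ.+ (n ℕ.+ n)))
    R₂ a n = cf M n * (cc (suc M) a (suc n) * t (suc (suc (a ℕ.+ (n ℕ.+ n)))))
    dbl : ∀ a n → a ℕ.+ (suc n ℕ.+ suc n) ≡ suc (suc (a ℕ.+ (n ℕ.+ n)))
    dbl a n = ≡.trans (≡.cong (λ m → a ℕ.+ suc m) (ℕₚ.+-suc n n)) (≡.trans (ℕₚ.+-suc a _) (≡.cong suc (ℕₚ.+-suc a _)))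
    shape : ∀ n → S (cf M) n * (cc (suc M) a n * t (a ℕ.+ (n ℕ.+ n))) ≈ S (R₂ a) n
    shape zero    = zeroˡ _
    shape (suc n) = *-congˡ (*-congˡ (≡⇒≈ (≡.cong t (dbl a n))))
    split : ∀ n → cf (suc M) n * (cc (suc M) a n * sh (a ℕ.+ (n ℕ.+ n)) (gx (suc (suc M))) (suc L))
            ≈ cf (suc M) n * (cc (suc M) a n * t (a ℕ.+ (n ℕ.+ n)))
              + p ^ suc M * (cf (suc M) n * (cc (suc M) a n * sh (a ℕ.+ (n ℕ.+ n)) (gx (suc (suc M))) L))
    split n = trans (*-congˡ (*-congˡ (trans (sh-lin d (p ^ suc M) (gx-pascal (suc M)) (suc L)) (+-congˡ (*-congˡ (≡⇒≈ (sh-S d _ (suc L))))))))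
      (solve 5 (λ x y a P b → x :* (y :* (a :+ P :* b)) := x :* (y :* a) :+ P :* (x :* (y :* b))) refl (cf (suc M) n) (cc (suc M) a n) _ (p ^ suc M) _)
      where d = a ℕ.+ (n ℕ.+ n)
    outS : ∀ a → sumTo B (λ n → cf M n * (cc M a n * sh (suc (a ℕ.+ (n ℕ.+ n))) (gx (suc M)) L)) ≈ S (W B M M a M) L
    outS a = sym (sum-S-out B (cf M) (cc M a) (λ n → a ℕ.+ (n ℕ.+ n)) (gx (suc M)) L)
    main : ∀ a → a ≤ suc M → sumTo B (R₁ a) + y * sumTo B (R₂ a)
           ≈ W B M M a M (suc L) + lowerW B M a L + p ^ (suc M ℕ.+ a) * W B M M (suc a) M L + p ^ suc (M ℕ.+ M) * S (W B M M a M) L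
    main zero _ = begin
      sumTo B (R₁ 0) + y * sumTo B (R₂ 0)
        ≈⟨ +-cong (trans (sum-lin B y {h = λ n → cf M n * (S (cf M) n * t (n ℕ.+ n))} (λ n →
               solve 5 (λ f g P h t → f :* ((g :+ P :* h) :* t) := f :* (g :* t) :+ P :* (f :* (h :* t))) refl (cf M n) (cf M n) y (S (cf M) n) (t (n ℕ.+ n))))
             (+-congˡ (*-congˡ (trans (sum-cong B flip) (trans (sum-S B X (*-zeroʳ (*-zeroˡ (cf-over M B M<B)))) (sum-*ˡ B _))))))
           (*-congˡ (trans (sum-cong B (λ n → trans (*-congˡ (*-congʳ (+-congʳ (cc-suc M 0 n))))
               (solve 6 (λ f o g P h t → f :* ((o :* g :+ P :* h) :* t) := o :* (f :* (g :* t)) :+ P :* (f :* (h :* t))) refl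
                  (cf M n) (p ^ 0 * s) (cc M 1 n) y (cf M n) (sh (suc (n ℕ.+ n)) (gx (suc M)) L))))
             (trans (sum-+ B) (+-cong (sum-*ˡ B _) (trans (sum-*ˡ B _) (*-congˡ (outS 0))))))) ⟩
      (W B M M 0 M (suc L) + y * ((p ^ 0 * s) * W B M M 1 M L)) + y * ((p ^ 0 * s) * W B M M 1 M L + y * S (W B M M 0 M) L)
        ≈⟨ solve 5 (λ w P s u v → (w :+ (P :* s) :* ((con 1 :* s) :* u)) :+ (P :* s) :* ((con 1 :* s) :* u :+ (P :* s) :* v)
              := w :+ (s :* s :* P) :* u :+ (s :* s :* P) :* u :+ (s :* s :* (P :* P)) :* v) refl _ (p ^ M) s _ _ ⟩
      W B M M 0 M (suc L) + p ^ suc M * W B M M 1 M L + p ^ suc M * W B M M 1 M L + (p * (p ^ M * p ^ M)) * S (W B M M 0 M) L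
        ≈⟨ +-cong (+-congˡ (*-congʳ (^-congʳ p (≡.cong suc (≡.sym (ℕₚ.+-identityʳ M)))))) (*-congʳ (*-congˡ (sym (^-+ p M M)))) ⟩
      W B M M 0 M (suc L) + p ^ suc M * W B M M 1 M L + p ^ (suc M ℕ.+ 0) * W B M M 1 M L + p ^ suc (M ℕ.+ M) * S (W B M M 0 M) L ∎
      where
      X : Seq
      X n = (p ^ 0 * s) * (cf M n * (cc M 1 n * sh (suc (n ℕ.+ n)) (gx (suc M)) L))
      -- The source of the reflected term: at a = 0 the two binomials coincide, so lowering n in one
      -- of them can be traded for raising A in the other.
      flip : ∀ n → cf M n * (S (cf M) n * t (n ℕ.+ n)) ≈ S X n
      flip zero    = *-zeroʳ (zeroˡ _)
      flip (suc n) = trans (*-cong (cc-suc M 0 n) (*-congˡ (≡⇒≈ (≡.cong t (dbl 0 n)))))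
        (solve 4 (λ o g f t → (o :* g) :* (f :* t) := o :* (f :* (g :* t))) refl (p ^ 0 * s) (cc M 1 n) (cf M n) _)
    main (suc a) (s≤s a≤M) = begin
      sumTo B (R₁ (suc a)) + y * sumTo B (R₂ (suc a))
        ≈⟨ +-cong (sum-lin B z (λ n → solve 5 (λ f g P h t → f :* ((g :+ P :* h) :* t) := f :* (g :* t) :+ P :* (f :* (h :* t))) refl
                      (cf M n) (cc M (suc a) n) z (cc M a n) _))
                  (*-congˡ (trans (sum-cong B (λ n → trans (*-congˡ (*-congʳ (+-cong (cc-suc M (suc a) n) (*-congˡ (cc-suc M a n)))))
                      (solve 7 (λ f o g P q h t → f :* ((o :* g :+ P :* (q :* h)) :* t) := o :* (f :* (g :* t)) :+ (P :* q) :* (f :* (h :* t))) refl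
                        (cf M n) (p ^ suc a * s) (cc M (suc (suc a)) n) z (p ^ a * s) (cc M (suc a) n) _)))
                    (trans (sum-+ B) (+-cong (sum-*ˡ B _) (trans (sum-*ˡ B _) (*-congˡ (outS (suc a)))))))) ⟩
      (W B M M (suc a) M (suc L) + z * W B M M a M L) + y * ((p ^ suc a * s) * W B M M (suc (suc a)) M L + (z * (p ^ a * s)) * S (W B M M (suc a) M) L)
        ≈⟨ solve 7 (λ x P s Q u Z v → x :+ (P :* s) :* ((s :* s :* Q :* s) :* u :+ (Z :* (Q :* s)) :* v)
             := x :+ (s :* s :* (P :* (s :* s :* Q))) :* u :+ (s :* s :* (P :* (Q :* Z))) :* v) refl _ (p ^ M) s (p ^ a) _ z _ ⟩
      (W B M M (suc a) M (suc L) + z * W B M M a M L) + (p * (p ^ M * p ^ suc a)) * W B M M (suc (suc a)) M L + (p * (p ^ M * (p ^ a * z))) * S (W B M M (suc a) M) L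
        ≈⟨ +-cong (+-congˡ (*-congʳ (*-congˡ (sym (^-+ p M (suc a))))))
             (*-congʳ (*-congˡ (trans (*-congˡ (trans (sym (^-+ p a (M ∸ a))) (^-congʳ p (ℕₚ.m+[n∸m]≡n a≤M)))) (sym (^-+ p M M))))) ⟩
      W B M M (suc a) M (suc L) + z * W B M M a M L + p ^ (suc M ℕ.+ suc a) * W B M M (suc (suc a)) M L + p ^ suc (M ℕ.+ M) * S (W B M M (suc a) M) L ∎
      where z = p ^ (M ∸ a)

  -- Lexicographic induction on M and L along a + M' = M. Where M' is too small for a term of the
  -- recurrence, the matching `W` has A above its upper entry and is zero.
  H₀-closed : ∀ {B} M L a M' → a ℕ.+ M' ≡ M → M ℕ.< B → H₀ B a M' L ≈ W B M M a M L
  H₀-closed-S : ∀ {B} M L a M' → a ℕ.+ M' ≡ M → M ℕ.< B → S (H₀ B a M') L ≈ S (W B M M a M) L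
  H₀-closed-S {B} M zero    a M' eq M<B = refl
  H₀-closed-S {B} M (suc L) a M' eq M<B = H₀-closed M L a M' eq M<B
  H₀-closed {B} zero L zero zero eq M<B = trans
    (sum-first B (λ α → *-zeroʳ (zeroˡ _)))
    (trans (*-cong (*-identityˡ _) (trans (*-identityˡ _) (trans (V-at-0 L 0) (gx-one L))))
      (sym (trans (sum-first B (λ n → zeroˡ _)) (*-congˡ (trans (*-identityˡ _) (gx-one L))))))
  H₀-closed {B} (suc M) zero zero M' eq M<B = trans
    (sum-first B (λ α → *-zeroʳ (zeroʳ _)))
    (trans (trans (*-cong (*-identityˡ _) (*-cong (gx-one M') (V-at-0 0 0))) (trans (*-identityˡ _) (*-identityˡ _)))
      (sym (trans (sum-first B (λ n → *-zeroʳ (zeroʳ _)))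
        (trans (*-cong (cf-at-0 (suc M)) (*-congʳ (cf-at-0 (suc M)))) (trans (*-identityˡ _) (*-identityˡ _))))))
  H₀-closed {B} (suc M) zero (suc a) M' eq M<B = trans (sum-zero B (λ α → *-zeroʳ (zeroʳ _)))
    (sym (sum-zero B (λ α → *-zeroʳ (zeroʳ _))))
  H₀-closed {B} (suc M) (suc L) a M' eq M<B = begin
    H₀ B a M' (suc L)
      ≈⟨ H₀-rec a M' L (ℕₚ.≤-<-trans (ℕₚ.m+n≤o⇒n≤o a (ℕₚ.≤-reflexive eq)) M<B) ⟩
    p ^ (a ℕ.+ M') * H₀ B a M' L + S (λ M' → H₀ B a M' (suc L)) M' + p ^ M' * lowerH B a M' (suc L)
      + p ^ (M' ℕ.+ (a ℕ.+ a)) * S (S (λ M' → H₀ B (suc a) M' L)) M'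
      + S (λ M'' → p ^ suc ((M'' ℕ.+ M'') ℕ.+ (a ℕ.+ a)) * S (H₀ B a M'') L) M'
      ≈⟨ +-cong (+-cong (+-cong (+-cong (*-cong (^-congʳ p eq) (H₀-closed (suc M) L a M' eq M<B)) (same M' eq)) (low a M' eq)) (*-cong (^-congʳ p expo) (up a M' eq))) (last M' eq) ⟩
    p ^ suc M * W B (suc M) (suc M) a (suc M) L + W B M M a M (suc L) + lowerW B M a L
      + p ^ (suc M ℕ.+ a) * W B M M (suc a) M L + p ^ suc (M ℕ.+ M) * S (W B M M a M) L
      ≈⟨ W-rec M a L (ℕₚ.m+n≤o⇒m≤o a (ℕₚ.≤-reflexive eq)) M<B' ⟨
    W B (suc M) (suc M) a (suc M) (suc L) ∎
    where
    M<B' : M ℕ.< B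
    M<B' = ℕₚ.<-trans (ℕₚ.n<1+n M) M<B
    pred-eq : ∀ {a M'} → a ℕ.+ suc M' ≡ suc M → a ℕ.+ M' ≡ M
    pred-eq {a} {M'} e = ℕₚ.suc-injective (≡.trans (≡.sym (ℕₚ.+-suc a M')) e)
    M<a : ∀ {a} → a ℕ.+ 0 ≡ suc M → M ℕ.< a
    M<a {a} e = ℕₚ.≤-reflexive (≡.trans (≡.sym e) (ℕₚ.+-identityʳ a))
    expo : M' ℕ.+ (a ℕ.+ a) ≡ suc M ℕ.+ a
    expo = ≡.trans (≡.sym (ℕₚ.+-assoc M' a a)) (≡.cong (ℕ._+ a) (≡.trans (ℕₚ.+-comm M' a) eq))
    same : ∀ M' → a ℕ.+ M' ≡ suc M → S (λ M' → H₀ B a M' (suc L)) M' ≈ W B M M a M (suc L)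
    same zero     e = sym (W-over B M M a M (suc L) (M<a e))
    same (suc M') e = H₀-closed M (suc L) a M' (pred-eq e) M<B'
    up : ∀ a M' → a ℕ.+ M' ≡ suc M → S (S (λ M' → H₀ B (suc a) M' L)) M' ≈ W B M M (suc a) M L
    up a zero            e = sym (W-over B M M (suc a) M L (ℕₚ.m<n⇒m<1+n (M<a e)))
    up a (suc zero)      e = sym (W-over B M M (suc a) M L (s≤s (ℕₚ.≤-reflexive (≡.trans (≡.sym (pred-eq e)) (ℕₚ.+-identityʳ a)))))
    up a (suc (suc M'')) e = H₀-closed M L (suc a) M'' (≡.trans (≡.sym (ℕₚ.+-suc a M'')) (pred-eq e)) M<B'
    low : ∀ a M' → a ℕ.+ M' ≡ suc M → p ^ M' * lowerH B a M' (suc L) ≈ lowerW B M a L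
    low zero M' e = *-cong (^-congʳ p e) (up 0 M' e)
    low (suc a) M' e = *-cong (^-congʳ p (≡.sym (≡.trans (≡.cong (_∸ a) (≡.sym (ℕₚ.suc-injective e))) (ℕₚ.m+n∸m≡n a M'))))
      (H₀-closed M L a M' (ℕₚ.suc-injective e) M<B')
    last : ∀ M' → a ℕ.+ M' ≡ suc M → S (λ M'' → p ^ suc ((M'' ℕ.+ M'') ℕ.+ (a ℕ.+ a)) * S (H₀ B a M'') L) M' ≈ p ^ suc (M ℕ.+ M) * S (W B M M a M) L
    last zero      e = sym (*-zeroʳ (S-zero (λ L → W-over B M M a M L (M<a e)) L))
    last (suc M'') e = *-cong (^-congʳ p (≡.cong suc (≡.trans (ℕₚ.+-comm (M'' ℕ.+ M'') (a ℕ.+ a)) (≡.trans (swap a M'') (≡.cong₂ ℕ._+_ (pred-eq e) (pred-eq e))))))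
      (H₀-closed-S M L a M'' (pred-eq e) M<B')
      where
      swap : ∀ a b → (a ℕ.+ a) ℕ.+ (b ℕ.+ b) ≡ (a ℕ.+ b) ℕ.+ (a ℕ.+ b)
      swap a b = ≡.trans (ℕₚ.+-assoc a a _) (≡.trans (≡.cong (a ℕ.+_) (≡.trans (≡.sym (ℕₚ.+-assoc a b b)) (≡.trans (≡.cong (ℕ._+ b) (ℕₚ.+-comm a b)) (ℕₚ.+-assoc b a b)))) (≡.sym (ℕₚ.+-assoc a b _)))

  H-closed : ∀ {B M} b μ → M ℕ.< B → μ ℕ.+ b ≡ M → ∀ a M' L → a ℕ.+ M' ≡ M →
             H B b a M' L ≈ W B μ (b ℕ.+ M) (b ℕ.+ a) M L
  H-closed {B} {M} zero μ M<B μ+0≡M a M' L a+M'≡M = begin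
    H B 0 a M' L   ≈⟨ sum-cong B (λ α → *-congˡ (*-congˡ (sh-cong (a ℕ.+ α) (λ μ → T₀≈V μ a α) L))) ⟩
    H₀ B a M' L    ≈⟨ H₀-closed M L a M' a+M'≡M M<B ⟩
    W B M M a M L  ≈⟨ ≡⇒≈ (≡.cong (λ μ → W B μ M a M L) (≡.trans (≡.sym μ+0≡M) (ℕₚ.+-identityʳ μ))) ⟩
    W B μ M a M L  ∎
  H-closed {B} {M} (suc b) μ M<B μ+b≡M a M' L a+M'≡M =
    H-closed-step b μ M<B μ+b≡M (H-closed b (suc μ) M<B (≡.trans (≡.sym (ℕₚ.+-suc μ b)) μ+b≡M)) L a M' a+M'≡M

  -- Second transformation: the substitution i = a + α undone.

  sum-sh : ∀ B a g → (∀ α → B ℕ.< a ℕ.+ α → g α ≈ 0#) → sumTo B (sh a g) ≈ sumTo B g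
  sum-sh B zero    g g≈0 = refl
  sum-sh B (suc a) g g≈0 = trans (sum-S B (sh a g) end) (sum-sh B a g (λ α B< → g≈0 α (ℕₚ.m<n⇒m<1+n B<)))
    where
    end : sh a g B ≈ 0#
    end with ℕₚ.<-≤-connex B a
    ... | Sum.inj₁ B<a = ≡⇒≈ (sh-over a g B B<a)
    ... | Sum.inj₂ a≤B with ℕₚ.m≤n⇒∃[o]m+o≡n a≤B
    ...   | α , ≡.refl = trans (≡⇒≈ (sh-at a g α)) (g≈0 α ℕₚ.≤-refl)

  square-+ : ∀ a α → s ^ ((a ℕ.+ α) ℕ.* (a ℕ.+ α)) ≈ s ^ (a ℕ.* a) * ω a α
  square-+ a zero = trans (^-congʳ s (≡.cong₂ ℕ._*_ (ℕₚ.+-identityʳ a) (ℕₚ.+-identityʳ a)))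
    (sym (trans (*-congˡ (trans (*-identityˡ _) (^-congʳ p (ℕₚ.*-zeroʳ a)))) (*-identityʳ _)))
  square-+ a (suc α) = trans (^-congʳ s (≡.cong₂ ℕ._*_ (ℕₚ.+-suc a α) (ℕₚ.+-suc a α)))
    (trans (square-suc (a ℕ.+ α)) (trans (*-cong (square-+ a α) (*-congʳ (^-+ p a α)))
      (trans (solve 5 (λ x w u v s → x :* w :* (u :* v :* s) := x :* (w :* v :* (u :* s))) refl _ _ _ _ s)
        (*-congˡ (sym (trans (ω-suc a α) (*-congʳ (ω-up a α))))))))

  -- Warnaar's second transformation, from T to S.
  T-to-S : ∀ {B M} b a L → M ℕ.< B → ∀ μ → μ ℕ.+ b ≡ M →
    sumTo B (λ i → s ^ (i ℕ.* i) * (sh i (gx (suc L)) M * sh i (λ μ → sh a (T μ b a) i) L))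
    ≈ s ^ (a ℕ.* a) * W B μ (b ℕ.+ M) (b ℕ.+ a) M L
  T-to-S-over : ∀ {B M} b a L → M ℕ.< B → M ℕ.< a →
    sumTo B (λ i → s ^ (i ℕ.* i) * (sh i (gx (suc L)) M * sh i (λ μ → sh a (T μ b a) i) L)) ≈ 0#
  T-to-S-over {B} {M} b a L M<B M<a = sum-zero B (λ i → go i (ℕₚ.<-≤-connex i a))
    where
    go : ∀ i → i ℕ.< a Sum.⊎ a ≤ i → s ^ (i ℕ.* i) * (sh i (gx (suc L)) M * sh i (λ μ → sh a (T μ b a) i) L) ≈ 0#
    go i (Sum.inj₁ i<a) = *-zeroʳ (*-zeroʳ (sh-zero i (λ μ → ≡⇒≈ (sh-over a (T μ b a) i i<a)) L))
    go i (Sum.inj₂ a≤i) = *-zeroʳ (*-zeroˡ (≡⇒≈ (sh-over i (gx (suc L)) M (ℕₚ.<-≤-trans M<a a≤i))))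
  T-to-S {B} {M} b a L M<B μ μ+b≡M with ℕₚ.<-≤-connex M a
  ... | Sum.inj₁ M<a = trans (T-to-S-over b a L M<B M<a)
          (sym (*-zeroʳ (W-over B μ (b ℕ.+ M) (b ℕ.+ a) M L (ℕₚ.+-monoʳ-< b M<a))))
  ... | Sum.inj₂ a≤M with ℕₚ.m≤n⇒∃[o]m+o≡n a≤M
  ...   | M' , ≡.refl = begin
    sumTo B f
      ≈⟨ sum-cong B (λ i → split i (ℕₚ.<-≤-connex i a)) ⟩
    sumTo B (sh a g)
      ≈⟨ sum-sh B a g (λ α B<a+α → *-zeroʳ (*-zeroʳ (*-zeroˡ (over α (ℕₚ.<-trans M<B B<a+α))))) ⟩
    sumTo B g
      ≈⟨ sum-*ˡ B _ ⟩
    s ^ (a ℕ.* a) * H B b a M' L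
      ≈⟨ *-congˡ (H-closed b μ M<B μ+b≡M a M' L ≡.refl) ⟩
    s ^ (a ℕ.* a) * W B μ (b ℕ.+ M) (b ℕ.+ a) M L ∎
    where
    f g : Seq
    f i = s ^ (i ℕ.* i) * (sh i (gx (suc L)) M * sh i (λ μ → sh a (T μ b a) i) L)
    g α = s ^ (a ℕ.* a) * (ω a α * (sh α (gx (suc L)) M' * sh (a ℕ.+ α) (λ μ → T μ b a α) L))
    over : ∀ α → a ℕ.+ M' ℕ.< a ℕ.+ α → sh α (gx (suc L)) M' ≈ 0#
    over α lt = ≡⇒≈ (sh-over α (gx (suc L)) M' (ℕₚ.+-cancelˡ-< a M' α lt))
    split : ∀ i → i ℕ.< a Sum.⊎ a ≤ i → f i ≈ sh a g i
    split i (Sum.inj₁ i<a) = trans (*-congˡ (*-zeroʳ (sh-zero i (λ μ → ≡⇒≈ (sh-over a (T μ b a) i i<a)) L)))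
      (trans (zeroʳ _) (sym (≡⇒≈ (sh-over a g i i<a))))
    split i (Sum.inj₂ a≤i) with ℕₚ.m≤n⇒∃[o]m+o≡n a≤i
    ... | α , ≡.refl = trans (*-cong (square-+ a α) (*-cong
          (≡⇒≈ (≡.trans (≡.sym (sh-sh a α (gx (suc L)) (a ℕ.+ M'))) (sh-at a (sh α (gx (suc L))) M')))
          (sh-cong (a ℕ.+ α) (λ μ → ≡⇒≈ (sh-at a (T μ b a) α)) L)))
        (trans (*-assoc _ _ _) (≡⇒≈ (≡.sym (sh-at a g α))))

  sh-rel₃₂ : ∀ n {f₁ f₂ f₃ f₄ f₅} x y z → (∀ k → f₁ k + x * f₂ k + y * f₃ k ≈ f₄ k + z * f₅ k) →
             ∀ k → sh n f₁ k + x * sh n f₂ k + y * sh n f₃ k ≈ sh n f₄ k + z * sh n f₅ k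
  sh-rel₃₂ zero    x y z eq k       = eq k
  sh-rel₃₂ (suc n) x y z eq zero    = solve 3 (λ x y z → con 0 :+ x :* con 0 :+ y :* con 0 := con 0 :+ z :* con 0) refl x y z
  sh-rel₃₂ (suc n) x y z eq (suc k) = sh-rel₃₂ n x y z eq k

  sh-rel₂₂ : ∀ n {f₁ f₂ f₄ f₅} x z → (∀ k → f₁ k + x * f₂ k ≈ f₄ k + z * f₅ k) →
             ∀ k → sh n f₁ k + x * sh n f₂ k ≈ sh n f₄ k + z * sh n f₅ k
  sh-rel₂₂ zero    x z eq k       = eq k
  sh-rel₂₂ (suc n) x z eq zero    = solve 2 (λ x z → con 0 :+ x :* con 0 := con 0 :+ z :* con 0) refl x z
  sh-rel₂₂ (suc n) x z eq (suc k) = sh-rel₂₂ n x z eq k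

  -- Quadratic contiguity relations for quotients by (x;p)_m (y;p)_l.

  module Contiguous (u : Seq) where

    P : ℕ → ℕ → ℕ → Seq
    P = U u

    -- `both`, `left` and `right` multiply out two last factors of the denominators: one in x and
    -- one in y, two in x, two in y.
    both : ∀ m l a k → P (suc m) l (suc a) k + p ^ suc m * S (S (P (suc (suc m)) (suc l) (suc (suc a)))) k
             + p ^ l * P (suc (suc m)) (suc l) a k
           ≈ P (suc (suc m)) (suc l) (suc a) k + (p ^ suc m * p ^ l) * S (S (P (suc (suc m)) (suc l) (suc a))) k
    both m l a k = begin
      n + x * F₂ + y * P (suc (suc m)) (suc l) a k
        ≈⟨ +-congˡ (*-congˡ (U-x u m (suc l) a k)) ⟩
      n + x * F₂ + y * (h + x * F₁)
        ≈⟨ solve 6 (λ n x F₂ y h F₁ → n :+ x :* F₂ :+ y :* (h :+ x :* F₁) := (n :+ y :* h) :+ x :* F₂ :+ (x :* y) :* F₁) refl n x F₂ y h F₁ ⟩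
      (n + y * h) + x * F₂ + (x * y) * F₁
        ≈⟨ +-congʳ (trans (U-x u m (suc l) (suc a) k) (+-congʳ (U-y u (suc m) l a k))) ⟨
      P (suc (suc m)) (suc l) (suc a) k + (x * y) * F₁ ∎
      where
      x = p ^ suc m
      y = p ^ l
      n = P (suc m) l (suc a) k
      h = P (suc m) (suc l) a k
      F₂ = S (S (P (suc (suc m)) (suc l) (suc (suc a)))) k
      F₁ = S (S (P (suc (suc m)) (suc l) (suc a))) k

    left : ∀ m l a k → P (suc m) l a k + (p ^ suc (suc m) + p ^ suc m) * S (S (P (suc (suc (suc m))) l (suc a))) k
           ≈ P (suc (suc (suc m))) l a k + (p ^ suc (suc m) * p ^ suc m) * S (S (S (S (P (suc (suc (suc m))) l (suc (suc a)))))) k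
    left m l a k = begin
      n + (x' + x) * F₁
        ≈⟨ +-congˡ (trans (distribʳ F₁ x' x) (+-congˡ (*-congˡ (S-lin x' (S-lin x' (U-x u (suc m) l (suc a))) k)))) ⟩
      n + (x' * F₁ + x * (h + x' * F₂))
        ≈⟨ solve 6 (λ n x' F₁ x h F₂ → n :+ (x' :* F₁ :+ x :* (h :+ x' :* F₂)) := (n :+ x :* h) :+ x' :* F₁ :+ (x' :* x) :* F₂) refl n x' F₁ x h F₂ ⟩
      (n + x * h) + x' * F₁ + (x' * x) * F₂
        ≈⟨ +-congʳ (trans (U-x u (suc m) l a k) (+-congʳ (U-x u m l a k))) ⟨
      P (suc (suc (suc m))) l a k + (x' * x) * F₂ ∎
      where
      x = p ^ suc m
      x' = p ^ suc (suc m)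
      n = P (suc m) l a k
      h = S (S (P (suc (suc m)) l (suc a))) k
      F₁ = S (S (P (suc (suc (suc m))) l (suc a))) k
      F₂ = S (S (S (S (P (suc (suc (suc m))) l (suc (suc a)))))) k

    right : ∀ m l a k → P m l (suc (suc a)) k + (p ^ suc l + p ^ l) * P m (suc (suc l)) (suc a) k
            ≈ P m (suc (suc l)) (suc (suc a)) k + (p ^ suc l * p ^ l) * P m (suc (suc l)) a k
    right m l a k = begin
      n + (y' + y) * F₁
        ≈⟨ +-congˡ (trans (distribʳ F₁ y' y) (+-congˡ (*-congˡ (U-y u m (suc l) a k)))) ⟩
      n + (y' * F₁ + y * (P m (suc l) (suc a) k + y' * F₀))
        ≈⟨ solve 6 (λ n x' F₁ x h F₂ → n :+ (x' :* F₁ :+ x :* (h :+ x' :* F₂)) := (n :+ x :* h) :+ x' :* F₁ :+ (x' :* x) :* F₂) refl n y' F₁ y _ F₀ ⟩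
      (n + y * P m (suc l) (suc a) k) + y' * F₁ + (y' * y) * F₀
        ≈⟨ +-congʳ (trans (U-y u m (suc l) (suc a) k) (+-congʳ (U-y u m l (suc a) k))) ⟨
      P m (suc (suc l)) (suc (suc a)) k + (y' * y) * F₀ ∎
      where
      y = p ^ l
      y' = p ^ suc l
      n = P m l (suc (suc a)) k
      F₁ = P m (suc (suc l)) (suc a) k
      F₀ = P m (suc (suc l)) a k

    -- (1 - z²p^(m+l-1))(1 - z²p^(m+l)) as an identity in x and y with z² = xy.
    interior : ∀ m l a k →
      P (3 ℕ.+ m) (2 ℕ.+ l) (suc a) k
        + (p ^ (2 ℕ.+ m) * p ^ l) * (p ^ (2 ℕ.+ m) * p ^ suc l) * S (S (S (S (P (3 ℕ.+ m) (2 ℕ.+ l) (suc a))))) k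
      ≈ (p ^ (2 ℕ.+ m) * p ^ l + p ^ (2 ℕ.+ m) * p ^ suc l) * S (S (P (3 ℕ.+ m) (2 ℕ.+ l) (suc a))) k
        + P (2 ℕ.+ m) (suc l) (suc a) k + (p ^ (2 ℕ.+ m) * p ^ l) * S (S (P (2 ℕ.+ m) (suc l) (suc a))) k
        + p ^ (2 ℕ.+ m) * S (S (P (3 ℕ.+ m) l (suc (suc a)))) k + p ^ suc l * P (suc m) (2 ℕ.+ l) a k
    -- With X = p^(m+2) x and Y = p^(l+1) y this is (1 - XY/p)(1 - XY) = (1 + XY/p)(1 - X)(1 - Y) +
    -- X(1 - Y/p)(1 - Y) + Y(1 - X/p)(1 - X). `eq₁` and `eq₂` expand the first product, `eq₃` and
    -- `eq₄` the other two; `Z` gathers the terms moved across.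
    interior m l a k = +-cancelʳ Z _ _ (begin
      (X + (x' * y) * (x' * y') * g) + Z
        ≈⟨ solve 10 (λ X g s x y a X' e d b →
             (X :+ (s :* s :* x :* y) :* (s :* s :* x :* (s :* s :* y)) :* g)
               :+ (((s :* s :* x) :* a :+ (s :* s :* y) :* X') :+ (s :* s :* x :* y) :* ((s :* s :* x) :* e :+ (s :* s :* y) :* d)
                 :+ (s :* s :* x) :* ((s :* s :* y :+ y) :* b) :+ (s :* s :* y) :* ((s :* s :* x :+ x) :* b))
             := (s :* s :* x :* y :+ s :* s :* x :* (s :* s :* y)) :* b :+ (X :+ (s :* s :* x :* (s :* s :* y)) :* b)
               :+ (s :* s :* x :* y) :* (b :+ (s :* s :* x :* (s :* s :* y)) :* g)
               :+ (s :* s :* x) :* (a :+ (s :* s :* y :* y) :* d) :+ (s :* s :* y) :* (X' :+ (s :* s :* x :* x) :* e))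
             refl X g s x y A X' e d b ⟩
      (x' * y + x' * y') * b + (X + (x' * y') * b) + (x' * y) * (b + (x' * y') * g)
        + x' * (A + (y' * y) * d) + y' * (X' + (x' * x) * e)
        ≈⟨ +-cong (+-cong (+-cong (+-congˡ eq₁) (*-congˡ eq₂)) (*-congˡ eq₃)) (*-congˡ eq₄) ⟨
      (x' * y + x' * y') * b + (n₁ + x' * A + y' * X') + (x' * y) * (n₂ + x' * e + y' * d)
        + x' * (n₃ + (y' + y) * b) + y' * (n₄ + (x' + x) * b)
        ≈⟨ solve 13 (λ n₁ n₂ n₃ n₄ x' x y' y a X' e d b →
             (x' :* y :+ x' :* y') :* b :+ (n₁ :+ x' :* a :+ y' :* X') :+ (x' :* y) :* (n₂ :+ x' :* e :+ y' :* d)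
               :+ x' :* (n₃ :+ (y' :+ y) :* b) :+ y' :* (n₄ :+ (x' :+ x) :* b)
             := ((x' :* y :+ x' :* y') :* b :+ n₁ :+ (x' :* y) :* n₂ :+ x' :* n₃ :+ y' :* n₄)
               :+ ((x' :* a :+ y' :* X') :+ (x' :* y) :* (x' :* e :+ y' :* d) :+ x' :* ((y' :+ y) :* b) :+ y' :* ((x' :+ x) :* b)))
             refl n₁ n₂ n₃ n₄ x' x y' y A X' e d b ⟩
      ((x' * y + x' * y') * b + n₁ + (x' * y) * n₂ + x' * n₃ + y' * n₄) + Z ∎)
      where
      x = p ^ suc m
      x' = p ^ (2 ℕ.+ m)
      y = p ^ l
      y' = p ^ suc l
      f : ℕ → Seq
      f i = P (3 ℕ.+ m) (2 ℕ.+ l) (i ℕ.+ a)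
      X = f 1 k
      X' = f 0 k
      A = S (S (f 2)) k
      b = S (S (f 1)) k
      d = S (S (f 0)) k
      e = S (S (S (S (f 2)))) k
      g = S (S (S (S (f 1)))) k
      n₁ = P (2 ℕ.+ m) (suc l) (suc a) k
      n₂ = S (S (P (2 ℕ.+ m) (suc l) (suc a))) k
      n₃ = S (S (P (3 ℕ.+ m) l (suc (suc a)))) k
      n₄ = P (suc m) (2 ℕ.+ l) a k
      Z = (x' * A + y' * X') + (x' * y) * (x' * e + y' * d) + x' * ((y' + y) * b) + y' * ((x' + x) * b)
      eq₁ : n₁ + x' * A + y' * X' ≈ X + (x' * y') * b
      eq₁ = both (suc m) (suc l) a k
      eq₂ : n₂ + x' * e + y' * d ≈ b + (x' * y') * g
      eq₂ = sh-rel₃₂ 2 x' y' (x' * y') (both (suc m) (suc l) a) k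
      eq₃ : n₃ + (y' + y) * b ≈ A + (y' * y) * d
      eq₃ = sh-rel₂₂ 2 (y' + y) (y' * y) (right (3 ℕ.+ m) l a) k
      eq₄ : n₄ + (x' + x) * b ≈ X' + (x' * x) * e
      eq₄ = left m (2 ℕ.+ l) a k

    -- Because `E 0` is zero, cancelling 1 - y annihilates the coefficients with positive a. Thus y
    -- acts there as the identity.
    flat : ∀ m a k → P m 1 (suc a) k ≈ P m 1 a k
    flat m a k = trans (U-y u m 0 a k) (trans (+-cong (U-zero u m (suc a) k) (*-identityˡ _)) (+-identityˡ _))

    -- Since y acts as the identity, x acts as xy = z², and `left` turns into the product of two
    -- factors in z².
    edge : ∀ m a k →
      P (3 ℕ.+ m) 1 (suc a) k + p ^ suc m * p ^ (2 ℕ.+ m) * S (S (S (S (P (3 ℕ.+ m) 1 (suc a))))) k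
      ≈ (p ^ suc m + p ^ (2 ℕ.+ m)) * S (S (P (3 ℕ.+ m) 1 (suc a))) k + P (suc m) 1 a k
    edge m a k = begin
      P (3 ℕ.+ m) 1 (suc a) k + p ^ suc m * p ^ (2 ℕ.+ m) * S (S (S (S (P (3 ℕ.+ m) 1 (suc a))))) k
        ≈⟨ +-cong (flat (3 ℕ.+ m) a k) (*-cong (*-comm _ _)
             (sym (sh-cong 4 (flat (3 ℕ.+ m) (suc a)) k))) ⟩
      P (3 ℕ.+ m) 1 a k + p ^ (2 ℕ.+ m) * p ^ suc m * S (S (S (S (P (3 ℕ.+ m) 1 (suc (suc a)))))) k
        ≈⟨ left m 1 a k ⟨
      P (suc m) 1 a k + (p ^ (2 ℕ.+ m) + p ^ suc m) * S (S (P (3 ℕ.+ m) 1 (suc a))) k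
        ≈⟨ trans (+-comm _ _) (+-congʳ (*-congʳ (+-comm _ _))) ⟩
      (p ^ suc m + p ^ (2 ℕ.+ m)) * S (S (P (3 ℕ.+ m) 1 (suc a))) k + P (suc m) 1 a k ∎

    both₀ : ∀ M k → P (suc M) (suc M) 0 k + p ^ suc M * S (S (P (2 ℕ.+ M) (2 ℕ.+ M) 1)) k + p ^ suc M * S (S (P (2 ℕ.+ M) (2 ℕ.+ M) 1)) k
            ≈ P (2 ℕ.+ M) (2 ℕ.+ M) 0 k + (p ^ suc M * p ^ suc M) * S (S (P (2 ℕ.+ M) (2 ℕ.+ M) 0)) k
    both₀ M k = begin
      n + x * F₁ + x * F₁
        ≈⟨ +-congʳ (+-congˡ (*-congˡ (S-lin x (S-lin x (U-y u (2 ℕ.+ M) (suc M) 0)) k))) ⟩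
      n + x * (h + x * F₀) + x * F₁
        ≈⟨ solve 5 (λ n x h F₀ F₁ → n :+ x :* (h :+ x :* F₀) :+ x :* F₁ := (n :+ x :* h) :+ x :* F₁ :+ (x :* x) :* F₀) refl n x h F₀ F₁ ⟩
      (n + x * h) + x * F₁ + (x * x) * F₀
        ≈⟨ +-congʳ (trans (U-x u M (2 ℕ.+ M) 0 k) (+-congʳ (trans (U-sym u (suc M) (2 ℕ.+ M) k) (U-x u M (suc M) 0 k)))) ⟨
      P (2 ℕ.+ M) (2 ℕ.+ M) 0 k + (x * x) * F₀ ∎
      where
      x = p ^ suc M
      n = P (suc M) (suc M) 0 k
      h = S (S (P (2 ℕ.+ M) (suc M) 1)) k
      F₀ = S (S (P (2 ℕ.+ M) (2 ℕ.+ M) 0)) k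
      F₁ = S (S (P (2 ℕ.+ M) (2 ℕ.+ M) 1)) k

    right₀ : ∀ M k → P (2 ℕ.+ M) M 1 k + (p ^ suc M + p ^ M) * P (2 ℕ.+ M) (2 ℕ.+ M) 0 k
             ≈ P (2 ℕ.+ M) (2 ℕ.+ M) 1 k + (p ^ M * p ^ suc M) * S (S (P (2 ℕ.+ M) (2 ℕ.+ M) 1)) k
    right₀ M k = begin
      n + (x + y) * F₀
        ≈⟨ +-congˡ (trans (distribʳ F₀ x y) (+-congˡ (*-congˡ (trans (U-x u M (2 ℕ.+ M) 0 k) (+-congʳ (U-sym u (suc M) (2 ℕ.+ M) k)))))) ⟩
      n + (x * F₀ + y * (h + x * F₁))
        ≈⟨ solve 6 (λ n x F₀ y h F₁ → n :+ (x :* F₀ :+ y :* (h :+ x :* F₁)) := ((n :+ y :* h) :+ x :* F₀) :+ (y :* x) :* F₁) refl n x F₀ y h F₁ ⟩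
      ((n + y * h) + x * F₀) + (y * x) * F₁
        ≈⟨ +-congʳ (trans (U-y u (2 ℕ.+ M) (suc M) 0 k) (+-congʳ (U-y u (2 ℕ.+ M) M 0 k))) ⟨
      P (2 ℕ.+ M) (2 ℕ.+ M) 1 k + (y * x) * F₁ ∎
      where
      x = p ^ suc M
      y = p ^ M
      n = P (2 ℕ.+ M) M 1 k
      h = P (2 ℕ.+ M) (suc M) 0 k
      F₀ = P (2 ℕ.+ M) (2 ℕ.+ M) 0 k
      F₁ = S (S (P (2 ℕ.+ M) (2 ℕ.+ M) 1)) k

    -- The analogue of `interior` on the diagonal at a = 0. The term with a = -1 is the mirror image
    -- of the one with a = 1, so the contributions of x and y coincide.
    reflected : ∀ M k →
      P (2 ℕ.+ M) (2 ℕ.+ M) 0 k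
        + (p ^ suc M * p ^ M) * (p ^ suc M * p ^ suc M) * S (S (S (S (P (2 ℕ.+ M) (2 ℕ.+ M) 0)))) k
      ≈ (p ^ suc M * p ^ M + p ^ suc M * p ^ suc M) * S (S (P (2 ℕ.+ M) (2 ℕ.+ M) 0)) k
        + P (suc M) (suc M) 0 k + (p ^ suc M * p ^ M) * S (S (P (suc M) (suc M) 0)) k
        + p ^ suc M * S (S (P (2 ℕ.+ M) M 1)) k + p ^ suc M * S (S (P (2 ℕ.+ M) M 1)) k
    reflected M k = +-cancelʳ Z _ _ (begin
      (X + (x * y) * (x * x) * g) + Z
        ≈⟨ solve 7 (λ X g x y a e b →
             (X :+ (x :* y) :* (x :* x) :* g) :+ ((x :* a :+ x :* a) :+ (x :* y) :* (x :* e :+ x :* e) :+ x :* ((x :+ y) :* b) :+ x :* ((x :+ y) :* b))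
             := (x :* y :+ x :* x) :* b :+ (X :+ (x :* x) :* b) :+ (x :* y) :* (b :+ (x :* x) :* g) :+ x :* (a :+ (y :* x) :* e) :+ x :* (a :+ (y :* x) :* e))
             refl X g x y A e b ⟩
      (x * y + x * x) * b + (X + (x * x) * b) + (x * y) * (b + (x * x) * g) + x * (A + (y * x) * e) + x * (A + (y * x) * e)
        ≈⟨ +-cong (+-cong (+-cong (+-congˡ (both₀ M k)) (*-congˡ eq₂)) (*-congˡ eq₃)) (*-congˡ eq₃) ⟨
      (x * y + x * x) * b + (n₁ + x * A + x * A) + (x * y) * (n₂ + x * e + x * e) + x * (n₃ + (x + y) * b) + x * (n₃ + (x + y) * b)
        ≈⟨ solve 8 (λ n₁ n₂ n₃ x y a e b →
             (x :* y :+ x :* x) :* b :+ (n₁ :+ x :* a :+ x :* a) :+ (x :* y) :* (n₂ :+ x :* e :+ x :* e) :+ x :* (n₃ :+ (x :+ y) :* b) :+ x :* (n₃ :+ (x :+ y) :* b)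
             := ((x :* y :+ x :* x) :* b :+ n₁ :+ (x :* y) :* n₂ :+ x :* n₃ :+ x :* n₃)
                :+ ((x :* a :+ x :* a) :+ (x :* y) :* (x :* e :+ x :* e) :+ x :* ((x :+ y) :* b) :+ x :* ((x :+ y) :* b)))
             refl n₁ n₂ n₃ x y A e b ⟩
      ((x * y + x * x) * b + n₁ + (x * y) * n₂ + x * n₃ + x * n₃) + Z ∎)
      where
      x = p ^ suc M
      y = p ^ M
      X = P (2 ℕ.+ M) (2 ℕ.+ M) 0 k
      b = S (S (P (2 ℕ.+ M) (2 ℕ.+ M) 0)) k
      g = S (S (S (S (P (2 ℕ.+ M) (2 ℕ.+ M) 0)))) k
      A = S (S (P (2 ℕ.+ M) (2 ℕ.+ M) 1)) k
      e = S (S (S (S (P (2 ℕ.+ M) (2 ℕ.+ M) 1)))) k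
      n₁ = P (suc M) (suc M) 0 k
      n₂ = S (S (P (suc M) (suc M) 0)) k
      n₃ = S (S (P (2 ℕ.+ M) M 1)) k
      Z = (x * A + x * A) + (x * y) * (x * e + x * e) + x * ((x + y) * b) + x * ((x + y) * b)
      eq₂ : n₂ + x * e + x * e ≈ b + (x * x) * g
      eq₂ = sh-rel₃₂ 2 x x (x * x) (both₀ M) k
      eq₃ : n₃ + (x + y) * b ≈ A + (y * x) * e
      eq₃ = sh-rel₂₂ 2 (x + y) (y * x) (right₀ M) k

  -- Translation into `qbin`, `qbinℤ` and `Sref`.

  qbin-over : ∀ x n k → n ℕ.< k → qbin x n k ≈ 0#
  qbin-over x zero    (suc k) _         = refl
  qbin-over x (suc n) (suc k) (s≤s n<k) = trans
    (+-cong (qbin-over x n k n<k) (*-zeroʳ (qbin-over x n (suc k) (ℕₚ.m<n⇒m<1+n n<k)))) (+-identityˡ _)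

  qbin-0 : ∀ x n → qbin x n 0 ≈ 1#
  qbin-0 x zero    = refl
  qbin-0 x (suc n) = refl

  qbin-diag : ∀ x n → qbin x n n ≈ 1#
  qbin-diag x zero    = refl
  qbin-diag x (suc n) = trans (+-cong (qbin-diag x n) (*-zeroʳ (qbin-over x n (suc n) ℕₚ.≤-refl))) (+-identityʳ _)

  qbin-cong : ∀ {x y} → x ≈ y → ∀ n k → qbin x n k ≈ qbin y n k
  qbin-cong x≈y zero    zero    = refl
  qbin-cong x≈y zero    (suc k) = refl
  qbin-cong x≈y (suc n) zero    = refl
  qbin-cong x≈y (suc n) (suc k) = +-cong (qbin-cong x≈y n k) (*-cong (^-congˡ (suc k) x≈y) (qbin-cong x≈y n (suc k)))

  qbin-dual : ∀ x N A → qbin x (suc N) (suc A) ≈ qbin x N (suc A) + x ^ (N ∸ A) * qbin x N A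
  qbin-dual x zero zero = solve 1 (λ x → con 1 :+ x :* con 1 :* con 0 := con 0 :+ con 1 :* con 1) refl x
  qbin-dual x zero (suc A) = solve 1 (λ y → con 0 :+ y :* con 0 := con 0 :+ con 1 :* con 0) refl (x ^ suc (suc A))
  qbin-dual x (suc N) zero = trans (+-congˡ (*-congˡ (trans (qbin-dual x N 0) (+-congˡ (*-congˡ (qbin-0 x N))))))
    (trans (solve 3 (λ x b P → con 1 :+ x :* con 1 :* (b :+ P :* con 1) := con 1 :+ x :* con 1 :* b :+ x :* P :* con 1) refl x (qbin x N 1) (x ^ N))
      (+-congʳ (+-congʳ (sym (qbin-0 x N)))))
  qbin-dual x (suc N) (suc A) = trans (+-cong (qbin-dual x N A) (*-congˡ (qbin-dual x N (suc A))))
    (trans (solve 6 (λ b P a Q d S → b :+ P :* a :+ Q :* (d :+ S :* b) := (b :+ Q :* d) :+ (P :* a :+ (Q :* S) :* b)) refl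
        (qbin x N (suc A)) (x ^ (N ∸ A)) (qbin x N A) (x ^ suc (suc A)) (qbin x N (suc (suc A))) (x ^ (N ∸ suc A)))
      (+-congˡ (trans (+-congˡ (swap (ℕₚ.<-≤-connex N (suc A))))
        (solve 4 (λ P a Q b → P :* a :+ (P :* Q) :* b := P :* (a :+ Q :* b)) refl (x ^ (N ∸ A)) _ (x ^ suc A) _))))
    where
    swap : N ℕ.< suc A Sum.⊎ suc A ≤ N →
           (x ^ suc (suc A) * x ^ (N ∸ suc A)) * qbin x N (suc A) ≈ (x ^ (N ∸ A) * x ^ suc A) * qbin x N (suc A)
    swap (Sum.inj₁ N<A) = trans (*-congˡ (qbin-over x N (suc A) N<A)) (trans (zeroʳ _) (sym (*-zeroʳ (qbin-over x N (suc A) N<A))))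
    swap (Sum.inj₂ A<N) = *-congʳ (trans (solve 3 (λ x y z → (x :* y) :* z := (x :* z) :* y) refl x (x ^ suc A) (x ^ (N ∸ suc A)))
      (*-congʳ (^-congʳ x (≡.sym (ℕₚ.+-∸-assoc 1 {N} {suc A} A<N)))))

  gx-qbin : ∀ L k → gx (suc L) k ≈ qbin p (L ℕ.+ k) L
  gx-qbin zero    k       = trans (gx-one k) (sym (qbin-0 p k))
  gx-qbin (suc L) zero    = sym (trans (reflexive (≡.cong (λ n → qbin p (suc n) (suc L)) (ℕₚ.+-identityʳ L))) (qbin-diag p (suc L)))
  gx-qbin (suc L) (suc k) = +-cong (gx-qbin L (suc k)) (*-congˡ (trans (gx-qbin (suc L) k)
    (reflexive (≡.cong (λ n → qbin p n (suc L)) (≡.sym (ℕₚ.+-suc L k))))))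

  gx-qbin′ : ∀ L k → gx (suc L) k ≈ qbin p (L ℕ.+ k) k
  gx-qbin′ L k = trans (gx-sym L k) (trans (gx-qbin k L) (reflexive (≡.cong (λ n → qbin p n k) (ℕₚ.+-comm k L))))

  cf-qbin : ∀ M n → cf M n ≈ s ^ (n ℕ.* n) * qbin p M n
  cf-qbin zero    zero    = sym (*-identityˡ _)
  cf-qbin zero    (suc n) = sym (zeroʳ _)
  cf-qbin (suc M) zero    = trans (cf-at-0 (suc M)) (sym (*-identityˡ _))
  cf-qbin (suc M) (suc n) = trans (cf-dual M (suc n)) (trans
    (+-cong (*-congˡ (trans (cf-qbin M (suc n)) (*-congʳ (square-suc n)))) (*-congˡ (*-congˡ (cf-qbin M n))))
    (trans (solve 6 (λ s P σ a Q b → Q :* ((σ :* (P :* s)) :* a) :+ s :* (P :* (σ :* b)) := (σ :* (P :* s)) :* (b :+ Q :* a)) refl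
        s (p ^ n) (s ^ (n ℕ.* n)) (qbin p M (suc n)) (p ^ suc n) (qbin p M n))
      (*-congʳ (sym (square-suc n)))))

  cc-qbin : ∀ N A n → cc N A n ≈ s ^ (n ℕ.* n) * p ^ (A ℕ.* n) * qbin p N (A ℕ.+ n)
  cc-qbin N A zero = trans (at-0 N A) (sym (trans (*-congʳ (trans (*-identityˡ _) (^-congʳ p (ℕₚ.*-zeroʳ A))))
      (trans (*-identityˡ _) (reflexive (≡.cong (qbin p N) (ℕₚ.+-identityʳ A))))))
    where
    at-0 : ∀ N A → cc N A 0 ≈ qbin p N A
    at-0 zero    zero    = refl
    at-0 zero    (suc A) = refl
    at-0 (suc N) zero    = cf-at-0 (suc N)
    at-0 (suc N) (suc A) = trans (+-cong (at-0 N (suc A)) (*-congˡ (at-0 N A))) (sym (qbin-dual p N A))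
  cc-qbin N A (suc n) = trans (cc-suc N A n) (trans (*-congˡ (cc-qbin N (suc A) n))
    (trans (trans (*-congˡ (*-congʳ (trans (ω-up A n) refl))) (solve 5 (λ P s w Q b → (P :* s) :* ((w :* Q) :* b) := (w :* Q) :* (P :* s) :* b) refl (p ^ A) s (ω A n) (p ^ n) _))
      (*-cong (trans (*-congʳ (sym (ω-up A n))) (sym (ω-suc A n))) (reflexive (≡.cong (qbin p N) (≡.sym (ℕₚ.+-suc A n)))))))

  E-even : ∀ d k → E (suc d) (k ℕ.+ k) ≈ gx (suc d) k
  E-even zero    zero    = refl
  E-even (suc d) zero    = refl
  E-even d       (suc k) = trans (reflexive (≡.cong (λ n → E (suc d) (suc n)) (ℕₚ.+-suc k k))) (step d)
    where
    step : ∀ d → E (suc d) (suc (suc (k ℕ.+ k))) ≈ gx (suc d) (suc k)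
    step zero    = +-congˡ (*-congˡ (E-even 0 k))
    step (suc d) = +-cong (trans (reflexive (≡.cong (λ n → E (suc d) (suc n)) (≡.sym (ℕₚ.+-suc k k)))) (E-even d (suc k))) (*-congˡ (E-even (suc d) k))

  E-odd : ∀ d k → E d (suc (k ℕ.+ k)) ≈ 0#
  E-odd zero    k       = refl
  E-odd (suc d) zero    = refl
  E-odd (suc d) (suc k) = trans (reflexive (≡.cong (λ n → E (suc d) (suc (suc n))) (ℕₚ.+-suc k k)))
    (trans (+-cong (trans (reflexive (≡.cong (λ n → E d (suc (suc n))) (≡.sym (ℕₚ.+-suc k k)))) (E-odd d (suc k)))
      (*-zeroʳ (E-odd (suc d) k))) (+-identityˡ _))

  qbinℤ-pos : ∀ x X Y n → Y ≤ X → qbinℤ x (+ X ℤ.- + Y) (+ n) ≈ qbin x (X ∸ Y) n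
  qbinℤ-pos x X Y n Y≤X = reflexive (≡.cong (λ z → qbinℤ x z (+ n)) (≡.trans (ℤₚ.m-n≡m⊖n X Y) (ℤₚ.⊖-≥ Y≤X)))

  qbinℤ-neg : ∀ x X Y n → X ℕ.< Y → qbinℤ x (+ X ℤ.- + Y) (+ n) ≈ 0#
  qbinℤ-neg x X Y n X<Y = trans (reflexive (≡.cong (λ z → qbinℤ x z (+ n)) (≡.trans (ℤₚ.m-n≡m⊖n X Y) (ℤₚ.⊖-< X<Y)))) (neg (Y ∸ X) (ℕₚ.m<n⇒0<n∸m X<Y))
    where
    neg : ∀ d → 0 ℕ.< d → qbinℤ x (ℤ.- (+ d)) (+ n) ≈ 0#
    neg (suc d) _ = refl

  -- For L < Y the upper entry lies below M, whether negative or not, so the binomial is zero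
  -- exactly where `sh` puts zeros.
  qbinℤ-sh : ∀ M L Y → qbinℤ p (+ (M ℕ.+ L) ℤ.- + Y) (+ M) ≈ sh Y (gx (suc M)) L
  qbinℤ-sh M L Y with ℕₚ.<-≤-connex L Y
  ... | Sum.inj₂ Y≤L with ℕₚ.m≤n⇒∃[o]m+o≡n Y≤L
  ...   | l , ≡.refl = trans (qbinℤ-pos p (M ℕ.+ (Y ℕ.+ l)) Y M (ℕₚ.≤-trans Y≤L (ℕₚ.m≤n+m _ M)))
    (trans (reflexive (≡.cong (λ n → qbin p n M) (≡.trans (ℕₚ.+-∸-assoc M Y≤L) (≡.cong (M ℕ.+_) (ℕₚ.m+n∸m≡n Y l)))))
      (trans (sym (gx-qbin M l)) (≡⇒≈ (≡.sym (sh-at Y (gx (suc M)) l)))))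
  qbinℤ-sh M L Y | Sum.inj₁ L<Y = trans (small (ℕₚ.<-≤-connex (M ℕ.+ L) Y)) (≡⇒≈ (≡.sym (sh-over Y (gx (suc M)) L L<Y)))
    where
    small : M ℕ.+ L ℕ.< Y Sum.⊎ Y ≤ M ℕ.+ L → qbinℤ p (+ (M ℕ.+ L) ℤ.- + Y) (+ M) ≈ 0#
    small (Sum.inj₁ lt) = qbinℤ-neg p (M ℕ.+ L) Y M lt
    small (Sum.inj₂ le) = trans (qbinℤ-pos p (M ℕ.+ L) Y M le) (qbin-over p _ M
      (ℕₚ.+-cancelʳ-< Y (M ℕ.+ L ∸ Y) M (≡.subst (ℕ._< M ℕ.+ Y) (≡.sym (ℕₚ.m∸n+n≡m le)) (ℕₚ.+-monoʳ-< M L<Y))))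

  -- The two factors s^(n²) hidden in `cf` and `cc` combine with p^(An) to p^(n(n+A)).
  W-term : ∀ μ N A n t → p ^ (n ℕ.* (n ℕ.+ A)) * t * qbin p μ n * qbin p N (A ℕ.+ n) ≈ cf μ n * (cc N A n * t)
  W-term μ N A n t = sym (trans (*-cong (cf-qbin μ n) (*-congʳ (cc-qbin N A n)))
    (trans (solve 5 (λ σ b P d t → (σ :* b) :* ((σ :* P :* d) :* t) := ((σ :* σ) :* P) :* t :* b :* d) refl
        (s ^ (n ℕ.* n)) (qbin p μ n) (p ^ (A ℕ.* n)) (qbin p N (A ℕ.+ n)) t)
      (*-congʳ (*-congʳ (*-congʳ (trans (*-congʳ (sⁿsⁿ (n ℕ.* n))) (trans (sym (^-+ p (n ℕ.* n) (A ℕ.* n)))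
        (^-congʳ p (≡.trans (≡.cong (n ℕ.* n ℕ.+_) (ℕₚ.*-comm A n)) (≡.sym (ℕₚ.*-distribˡ-+ n n A))))))))))) 

  Sref-pos : ∀ B L M j b → j ≤ M → Sref B p L M (+ (j ℕ.+ b)) (+ b) ≈ W B (M ∸ j) (j ℕ.+ M) (j ℕ.+ b) M L
  Sref-pos B L M j b j≤M = sum-cong B term
    where
    A = j ℕ.+ b
    e₁ : ∀ X j b n → X ℤ.- (j ℤ.+ b) ℤ.- n ≡ X ℤ.- ((j ℤ.+ b) ℤ.+ n)
    e₁ = ℤS.solve 4 (λ X j b n → X ℤS.:- (j ℤS.:+ b) ℤS.:- n ℤS.:= X ℤS.:- ((j ℤS.:+ b) ℤS.:+ n)) ≡.refl
    e₂ : ∀ M j b → M ℤ.- (j ℤ.+ b) ℤ.+ b ≡ M ℤ.- j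
    e₂ = ℤS.solve 3 (λ M j b → M ℤS.:- (j ℤS.:+ b) ℤS.:+ b ℤS.:= M ℤS.:- j) ≡.refl
    e₃ : ∀ M j b → M ℤ.+ (j ℤ.+ b) ℤ.- b ≡ j ℤ.+ M
    e₃ = ℤS.solve 3 (λ M j b → M ℤS.:+ (j ℤS.:+ b) ℤS.:- b ℤS.:= j ℤS.:+ M) ≡.refl
    term : ∀ n → p ^ ∣ + n ℤ.* (+ n ℤ.+ + A) ∣ * qbinℤ p (+ (M ℕ.+ L) ℤ.- + A ℤ.- + (2 ℕ.* n)) (+ M)
             * qbinℤ p (+ M ℤ.- + A ℤ.+ + b) (+ n) * qbinℤ p (+ M ℤ.+ + A ℤ.- + b) (+ n ℤ.+ + A)
           ≈ cf (M ∸ j) n * (cc (j ℕ.+ M) A n * sh (A ℕ.+ (n ℕ.+ n)) (gx (suc M)) L)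
    term n = trans (*-cong (*-cong (*-cong (^-congʳ p (ℤₚ.abs-* (+ n) (+ (n ℕ.+ A))))
        (trans (reflexive (≡.cong (λ z → qbinℤ p z (+ M)) (≡.trans (e₁ (+ (M ℕ.+ L)) (+ j) (+ b) (+ (2 ℕ.* n)))
          (≡.cong (λ m → + (M ℕ.+ L) ℤ.- + (A ℕ.+ m)) (≡.cong (n ℕ.+_) (ℕₚ.+-identityʳ n)))))) (qbinℤ-sh M L (A ℕ.+ (n ℕ.+ n)))))
        (trans (reflexive (≡.cong (λ z → qbinℤ p z (+ n)) (e₂ (+ M) (+ j) (+ b)))) (qbinℤ-pos p M j n j≤M)))
        (reflexive (≡.cong₂ (qbinℤ p) (e₃ (+ M) (+ j) (+ b)) (≡.cong +_ (ℕₚ.+-comm n A)))))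
      (W-term (M ∸ j) (j ℕ.+ M) A n _)

  Sref-pos-over : ∀ B L M j b → M ℕ.< j → Sref B p L M (+ (j ℕ.+ b)) (+ b) ≈ 0#
  Sref-pos-over B L M j b M<j = sum-zero B (λ n → *-zeroˡ (trans (*-congˡ
      (trans (reflexive (≡.cong (λ z → qbinℤ p z (+ n)) (e₂ (+ M) (+ j) (+ b)))) (qbinℤ-neg p M j n M<j))) (zeroʳ _)))
    where
    e₂ : ∀ M j b → M ℤ.- (j ℤ.+ b) ℤ.+ b ≡ M ℤ.- j
    e₂ = ℤS.solve 3 (λ M j b → M ℤS.:- (j ℤS.:+ b) ℤS.:+ b ℤS.:= M ℤS.:- j) ≡.refl

  -- The symmetry S(L,M;-a,-b) = S(L,M;a,b): the substitution n = A + m exchanges the last two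
  -- binomials. The bound `M + M ≤ B` prevents the shifted range from losing nonzero terms.
  Sref-neg : ∀ B L M j b → j ≤ M → M ℕ.+ M ≤ B → Sref B p L M (ℤ.- (+ (j ℕ.+ b))) (ℤ.- (+ b)) ≈ W B (M ∸ j) (j ℕ.+ M) (j ℕ.+ b) M L
  Sref-neg B L M j b j≤M 2M≤B = trans (sum-cong B (λ n → term n (ℕₚ.<-≤-connex n A))) (sum-sh B A w over)
    where
    A = j ℕ.+ b
    w : Seq
    w n = cf (M ∸ j) n * (cc (j ℕ.+ M) A n * sh (A ℕ.+ (n ℕ.+ n)) (gx (suc M)) L)
    over : ∀ n → B ℕ.< A ℕ.+ n → w n ≈ 0#
    over n B<A+n = *-zeroʳ (*-zeroˡ (trans (cc-qbin (j ℕ.+ M) A n)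
        (*-zeroʳ (qbin-over p (j ℕ.+ M) (A ℕ.+ n) (ℕₚ.≤-<-trans (ℕₚ.≤-trans (ℕₚ.+-monoˡ-≤ M j≤M) 2M≤B) B<A+n)))))
    e₁ : ∀ X A n → X ℤ.- (ℤ.- A) ℤ.- (+ 2 ℤ.* (A ℤ.+ n)) ≡ X ℤ.- (A ℤ.+ (n ℤ.+ n))
    e₁ = ℤS.solve 3 (λ X A n → X ℤS.:- (ℤS.:- A) ℤS.:- (ℤS.con (+ 2) ℤS.:* (A ℤS.:+ n)) ℤS.:= X ℤS.:- (A ℤS.:+ (n ℤS.:+ n))) ≡.refl
    e₂ : ∀ M j b → M ℤ.- (ℤ.- (j ℤ.+ b)) ℤ.+ (ℤ.- b) ≡ j ℤ.+ M
    e₂ = ℤS.solve 3 (λ M j b → M ℤS.:- (ℤS.:- (j ℤS.:+ b)) ℤS.:+ (ℤS.:- b) ℤS.:= j ℤS.:+ M) ≡.refl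
    e₃ : ∀ M j b → M ℤ.+ (ℤ.- (j ℤ.+ b)) ℤ.- (ℤ.- b) ≡ M ℤ.- j
    e₃ = ℤS.solve 3 (λ M j b → M ℤS.:+ (ℤS.:- (j ℤS.:+ b)) ℤS.:- (ℤS.:- b) ℤS.:= M ℤS.:- j) ≡.refl
    e₄ : ∀ A n → A ℤ.+ n ℤ.+ (ℤ.- A) ≡ n
    e₄ = ℤS.solve 2 (λ A n → A ℤS.:+ n ℤS.:+ (ℤS.:- A) ℤS.:= n) ≡.refl
    term : ∀ n → n ℕ.< A Sum.⊎ A ≤ n →
      p ^ ∣ + n ℤ.* (+ n ℤ.+ ℤ.- (+ A)) ∣ * qbinℤ p (+ (M ℕ.+ L) ℤ.- ℤ.- (+ A) ℤ.- + (2 ℕ.* n)) (+ M)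
        * qbinℤ p (+ M ℤ.- ℤ.- (+ A) ℤ.+ ℤ.- (+ b)) (+ n) * qbinℤ p (+ M ℤ.+ ℤ.- (+ A) ℤ.- ℤ.- (+ b)) (+ n ℤ.+ ℤ.- (+ A))
      ≈ sh A w n
    term n (Sum.inj₁ n<A) = trans (*-zeroʳ (trans (reflexive (≡.cong₂ (qbinℤ p) (e₃ (+ M) (+ j) (+ b)) (≡.trans (ℤₚ.m-n≡m⊖n n A) (ℤₚ.⊖-< n<A))))
        (neg (A ∸ n) (ℕₚ.m<n⇒0<n∸m n<A)))) (≡⇒≈ (≡.sym (sh-over A w n n<A)))
      where
      neg : ∀ d → 0 ℕ.< d → qbinℤ p (+ M ℤ.- + j) (ℤ.- (+ d)) ≈ 0#
      neg (suc d) _ with + M ℤ.- + j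
      ... | + _      = refl
      ... | -[1+ _ ] = refl
    term n (Sum.inj₂ A≤n) with ℕₚ.m≤n⇒∃[o]m+o≡n A≤n
    ... | m , ≡.refl = trans (*-cong (*-cong (*-cong
          (^-congʳ p (≡.trans (≡.cong (λ z → ∣ + (A ℕ.+ m) ℤ.* z ∣) (e₄ (+ A) (+ m))) (≡.trans (ℤₚ.abs-* (+ (A ℕ.+ m)) (+ m))
              (≡.trans (ℕₚ.*-comm (A ℕ.+ m) m) (≡.cong (m ℕ.*_) (ℕₚ.+-comm A m))))))
          (trans (reflexive (≡.cong (λ z → qbinℤ p z (+ M)) (≡.trans (≡.cong (λ z → + (M ℕ.+ L) ℤ.- ℤ.- (+ A) ℤ.- z) (ℤₚ.pos-* 2 (A ℕ.+ m))) (e₁ (+ (M ℕ.+ L)) (+ A) (+ m)))))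
            (qbinℤ-sh M L (A ℕ.+ (m ℕ.+ m)))))
          (reflexive (≡.cong (λ z → qbinℤ p z (+ (A ℕ.+ m))) (e₂ (+ M) (+ j) (+ b)))))
          (trans (reflexive (≡.cong₂ (qbinℤ p) (e₃ (+ M) (+ j) (+ b)) (e₄ (+ A) (+ m)))) (qbinℤ-pos p M j m j≤M)))
        (trans (trans (*-assoc _ _ _) (trans (*-congˡ (*-comm _ _)) (sym (*-assoc _ _ _))))
          (trans (W-term (M ∸ j) (j ℕ.+ M) A m _) (≡⇒≈ (≡.sym (sh-at A w m)))))

  Sref-neg-over : ∀ B L M j b → M ℕ.< j → Sref B p L M (ℤ.- (+ (j ℕ.+ b))) (ℤ.- (+ b)) ≈ 0#
  Sref-neg-over B L M j b M<j = sum-zero B (λ n → *-zeroʳ (trans (reflexive (≡.cong (λ z → qbinℤ p z _) (≡.trans (e₃ (+ M) (+ j) (+ b))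
      (≡.trans (ℤₚ.m-n≡m⊖n M j) (ℤₚ.⊖-< M<j))))) (neg (j ∸ M) (ℕₚ.m<n⇒0<n∸m M<j) _)))
    where
    e₃ : ∀ M j b → M ℤ.+ (ℤ.- (j ℤ.+ b)) ℤ.- (ℤ.- b) ≡ M ℤ.- j
    e₃ = ℤS.solve 3 (λ M j b → M ℤS.:+ (ℤS.:- (j ℤS.:+ b)) ℤS.:- (ℤS.:- b) ℤS.:= M ℤS.:- j) ≡.refl
    neg : ∀ d → 0 ℕ.< d → ∀ z → qbinℤ p (ℤ.- (+ d)) z ≈ 0#
    neg (suc d) _ z = refl

-- The seed: evaluation of the weighted sum of T(L,M;j,j).

module Hierarchy {c ℓ : Level} (R : CommutativeRing c ℓ) (r : CommutativeRing.Carrier R) where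
  open CommutativeRing R
  open import Algebra.Properties.Semiring.Exp semiring
  open import Algebra.Properties.AbelianGroup +-abelianGroup using () renaming (∙-cancelʳ to +-cancelʳ)
  open import Algebra.Solver.Ring.NaturalCoefficients.Default commutativeSemiring
    using (solve; _:=_; _:+_; _:*_; con)
  open import Relation.Binary.Reasoning.Setoid setoid
  open Q R
  open Sequences R

  -- With r a square root of q, this is q^(3/2), so that `p` is q³.
  s : Carrier
  s = r * (r * r)

  open RefinedTrinomial R s
  module Root = RefinedTrinomial R r

  sh-rel₇ : ∀ n {f₁ f₂ f₃ f₄ f₅ f₆ f₇} a b c d e →
    (∀ k → f₁ k + a * f₂ k ≈ b * f₃ k + f₄ k + c * f₅ k + d * f₆ k + e * f₇ k) →
    ∀ k → sh n f₁ k + a * sh n f₂ k ≈ b * sh n f₃ k + sh n f₄ k + c * sh n f₅ k + d * sh n f₆ k + e * sh n f₇ k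
  sh-rel₇ zero    a b c d e eq k       = eq k
  sh-rel₇ (suc n) a b c d e eq zero    = solve 5 (λ a b c d e → con 0 :+ a :* con 0
    := b :* con 0 :+ con 0 :+ c :* con 0 :+ d :* con 0 :+ e :* con 0) refl a b c d e
  sh-rel₇ (suc n) a b c d e eq (suc k) = sh-rel₇ n a b c d e eq k

  sh-S² : ∀ n f k → sh n (S (S f)) k ≈ S (S (sh n f)) k
  sh-S² n f k = trans (≡⇒≈ (sh-S n (S f) k)) (S-cong (λ k → ≡⇒≈ (sh-S n f k)) k)

  sh-S⁴ : ∀ n f k → sh n (S (S (S (S f)))) k ≈ S (S (S (S (sh n f)))) k
  sh-S⁴ n f k = trans (sh-S² n (S (S f)) k) (S-cong (S-cong (sh-S² n f)) k)

  -- T (suc M) j j without the last factor 1 + z p^(M+1/2) of its numerator.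
  Φ : ℕ → ℕ → Seq
  Φ M j = U (cf M) (suc (suc M ℕ.+ j)) (suc (suc M) ∸ j) j

  -- 1 - x₁z² and 1 - x₂z² are the two factors by which (z²;p)_(2M+3) extends (z²;p)_(2M+1).
  x₁ x₂ : ℕ → Carrier
  x₁ M = p ^ suc (M ℕ.+ M)
  x₂ M = p ^ suc (suc (M ℕ.+ M))

  lowC : ℕ → ℕ → Carrier
  lowC M zero    = p ^ suc M
  lowC M (suc j) = p ^ (M ∸ j)

  lowT : ℕ → ℕ → Seq
  lowT M zero    = S (S (T M 1 1))
  lowT M (suc j) = T M j j

  -- The sum over j can close because multipliers in z alone suffice: (1 - x₁z²)(1 - x₂z²)Φ is
  -- expressed by T at j - 1, j and j + 1. `reflected` covers j = 0, `interior` covers 0 < j ≤ M and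
  -- `edge` covers j = M + 1; beyond that every term vanishes.
  Φ-rel : ∀ M j k →
    Φ M j k + x₁ M * x₂ M * S (S (S (S (Φ M j)))) k
    ≈ (x₁ M + x₂ M) * S (S (Φ M j)) k + T M j j k + x₁ M * S (S (T M j j)) k
      + p ^ suc (M ℕ.+ j) * S (S (T M (suc j) (suc j))) k + lowC M j * lowT M j k
  Φ-rel M zero k = begin
    Φ M 0 k + x₁ M * x₂ M * S (S (S (S (Φ M 0)))) k
      ≈⟨ +-cong (eΦ k) (*-cong (*-cong e₁ e₂) (sh-cong 4 eΦ k)) ⟩
    P (2 ℕ.+ M) (2 ℕ.+ M) 0 k + (p ^ suc M * p ^ M) * (p ^ suc M * p ^ suc M) * S (S (S (S (P (2 ℕ.+ M) (2 ℕ.+ M) 0)))) k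
      ≈⟨ reflected M k ⟩
    (p ^ suc M * p ^ M + p ^ suc M * p ^ suc M) * S (S (P (2 ℕ.+ M) (2 ℕ.+ M) 0)) k
        + P (suc M) (suc M) 0 k + (p ^ suc M * p ^ M) * S (S (P (suc M) (suc M) 0)) k
        + p ^ suc M * S (S (P (2 ℕ.+ M) M 1)) k + p ^ suc M * S (S (P (2 ℕ.+ M) M 1)) k
      ≈⟨ +-cong (+-cong (+-cong (+-cong (*-cong (+-cong e₁ e₂) (sh-cong 2 eΦ k)) (T₀≈V M 0 k)) (*-cong e₁ (sh-cong 2 (T₀≈V M 0) k)))
           (*-cong (^-congʳ p (≡.cong suc (ℕₚ.+-identityʳ M))) (sh-cong 2 eT k))) (*-congˡ (sh-cong 2 eT k)) ⟨
    (x₁ M + x₂ M) * S (S (Φ M 0)) k + T M 0 0 k + x₁ M * S (S (T M 0 0)) k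
      + p ^ suc (M ℕ.+ 0) * S (S (T M 1 1)) k + p ^ suc M * S (S (T M 1 1)) k ∎
    where
    open Contiguous (cf M)
    e₁ : x₁ M ≈ p ^ suc M * p ^ M
    e₁ = ^-+ p (suc M) M
    e₂ : x₂ M ≈ p ^ suc M * p ^ suc M
    e₂ = trans (^-congʳ p (≡.cong suc (≡.sym (ℕₚ.+-suc M M)))) (^-+ p (suc M) (suc M))
    eΦ : ∀ k → Φ M 0 k ≈ P (2 ℕ.+ M) (2 ℕ.+ M) 0 k
    eΦ = U-≡ (cf M) 0 (≡.cong (2 ℕ.+_) (ℕₚ.+-identityʳ M)) (≡.refl {x = 2 ℕ.+ M})
    eT : ∀ k → T M 1 1 k ≈ P (2 ℕ.+ M) M 1 k
    eT = U-≡ (cf M) 1 (≡.cong suc (ℕₚ.+-comm M 1)) (≡.refl {x = M})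
  Φ-rel M (suc a) k with ℕₚ.<-cmp M a
  ... | tri< M<a _ _ = begin
    Φ M (suc a) k + x₁ M * x₂ M * S (S (S (S (Φ M (suc a))))) k
      ≈⟨ +-cong (Φ-zero k) (*-congˡ (sh-zero 4 Φ-zero k)) ⟩
    0# + x₁ M * x₂ M * 0#
      ≈⟨ solve 4 (λ x y c d → con 0 :+ x :* y :* con 0 := (x :+ y) :* con 0 :+ con 0 :+ x :* con 0 :+ c :* con 0 :+ d :* con 0) refl (x₁ M) (x₂ M) _ _ ⟩
    (x₁ M + x₂ M) * 0# + 0# + x₁ M * 0# + p ^ suc (M ℕ.+ suc a) * 0# + p ^ (M ∸ a) * 0#
      ≈⟨ +-cong (+-cong (+-cong (+-cong (*-congˡ (sh-zero 2 Φ-zero k)) (T-zero M (suc a) (suc a) k (ℕₚ.m<n⇒m<1+n M<a)))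
           (*-congˡ (sh-zero 2 (λ k → T-zero M (suc a) (suc a) k (ℕₚ.m<n⇒m<1+n M<a)) k)))
           (*-congˡ (sh-zero 2 (λ k → T-zero M (suc (suc a)) (suc (suc a)) k (ℕₚ.m<n⇒m<1+n (ℕₚ.m<n⇒m<1+n M<a))) k)))
           (*-congˡ (T-zero M a a k M<a)) ⟨
    (x₁ M + x₂ M) * S (S (Φ M (suc a))) k + T M (suc a) (suc a) k + x₁ M * S (S (T M (suc a) (suc a))) k
      + p ^ suc (M ℕ.+ suc a) * S (S (T M (suc (suc a)) (suc (suc a)))) k + p ^ (M ∸ a) * T M a a k ∎
    where
    Φ-zero : ∀ k → Φ M (suc a) k ≈ 0#
    Φ-zero k = trans (U-≡ (cf M) (suc a) (≡.refl {x = suc (suc M ℕ.+ suc a)}) (ℕₚ.m≤n⇒m∸n≡0 M<a) k) (U-zero (cf M) (suc (suc M ℕ.+ suc a)) (suc a) k)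
  ... | tri≈ _ ≡.refl _ = begin
    Φ M (suc M) k + x₁ M * x₂ M * S (S (S (S (Φ M (suc M))))) k
      ≈⟨ +-cong (eΦ k) (*-congˡ (sh-cong 4 eΦ k)) ⟩
    P (3 ℕ.+ (M ℕ.+ M)) 1 (suc M) k + x₁ M * x₂ M * S (S (S (S (P (3 ℕ.+ (M ℕ.+ M)) 1 (suc M))))) k
      ≈⟨ edge (M ℕ.+ M) M k ⟩
    (x₁ M + x₂ M) * S (S (P (3 ℕ.+ (M ℕ.+ M)) 1 (suc M))) k + P (suc (M ℕ.+ M)) 1 M k
      ≈⟨ solve 5 (λ u v x c d → u :+ v := u :+ con 0 :+ x :* con 0 :+ c :* con 0 :+ con 1 :* v) refl _ _ (x₁ M) (p ^ suc (M ℕ.+ suc M)) 0# ⟩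
    (x₁ M + x₂ M) * S (S (P (3 ℕ.+ (M ℕ.+ M)) 1 (suc M))) k + 0# + x₁ M * 0# + p ^ suc (M ℕ.+ suc M) * 0# + p ^ 0 * P (suc (M ℕ.+ M)) 1 M k
      ≈⟨ +-cong (+-cong (+-cong (+-cong (*-congˡ (sh-cong 2 eΦ k)) (T-zero M (suc M) (suc M) k (ℕₚ.n<1+n M)))
           (*-congˡ (sh-zero 2 (λ k → T-zero M (suc M) (suc M) k (ℕₚ.n<1+n M)) k)))
           (*-congˡ (sh-zero 2 (λ k → T-zero M (suc (suc M)) (suc (suc M)) k (ℕₚ.m<n⇒m<1+n (ℕₚ.n<1+n M))) k)))
           (*-cong (^-congʳ p (ℕₚ.n∸n≡0 M)) (U-≡ (cf M) M (≡.refl {x = suc (M ℕ.+ M)}) (ℕₚ.m+n∸n≡m 1 M) k)) ⟨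
    (x₁ M + x₂ M) * S (S (Φ M (suc M))) k + T M (suc M) (suc M) k + x₁ M * S (S (T M (suc M) (suc M))) k
      + p ^ suc (M ℕ.+ suc M) * S (S (T M (suc (suc M)) (suc (suc M)))) k + p ^ (M ∸ M) * T M M M k ∎
    where
    open Contiguous (cf M)
    eΦ : ∀ k → Φ M (suc M) k ≈ P (3 ℕ.+ (M ℕ.+ M)) 1 (suc M) k
    eΦ = U-≡ (cf M) (suc M) (≡.cong (2 ℕ.+_) (ℕₚ.+-suc M M)) (ℕₚ.m+n∸n≡m 1 M)
  ... | tri> _ _ a<M with ℕₚ.m≤n⇒∃[o]m+o≡n a<M
  ... | l , ≡.refl = begin
    Φ M (suc a) k + x₁ M * x₂ M * S (S (S (S (Φ M (suc a))))) k
      ≈⟨ +-cong (eΦ k) (*-cong (*-cong e₁ e₂) (sh-cong 4 eΦ k)) ⟩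
    P (3 ℕ.+ m) (2 ℕ.+ l) (suc a) k
      + (p ^ (2 ℕ.+ m) * p ^ l) * (p ^ (2 ℕ.+ m) * p ^ suc l) * S (S (S (S (P (3 ℕ.+ m) (2 ℕ.+ l) (suc a))))) k
      ≈⟨ interior m l a k ⟩
    (p ^ (2 ℕ.+ m) * p ^ l + p ^ (2 ℕ.+ m) * p ^ suc l) * S (S (P (3 ℕ.+ m) (2 ℕ.+ l) (suc a))) k
      + P (2 ℕ.+ m) (suc l) (suc a) k + (p ^ (2 ℕ.+ m) * p ^ l) * S (S (P (2 ℕ.+ m) (suc l) (suc a))) k
      + p ^ (2 ℕ.+ m) * S (S (P (3 ℕ.+ m) l (suc (suc a)))) k + p ^ suc l * P (suc m) (2 ℕ.+ l) a k
      ≈⟨ +-cong (+-cong (+-cong (+-cong (*-cong (+-cong e₁ e₂) (sh-cong 2 eΦ k)) (eT k)) (*-cong e₁ (sh-cong 2 eT k)))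
           (*-cong (^-congʳ p (≡.cong suc (ℕₚ.+-suc M a))) (sh-cong 2 eT⁺ k)))
           (*-cong (^-congʳ p ∸₁) (U-≡ (cf M) a (≡.refl {x = suc m}) (≡.trans (ℕₚ.+-∸-assoc 1 {M} {a} (ℕₚ.<⇒≤ a<M)) (≡.cong suc ∸₁)) k)) ⟨
    (x₁ M + x₂ M) * S (S (Φ M (suc a))) k + T M (suc a) (suc a) k + x₁ M * S (S (T M (suc a) (suc a))) k
      + p ^ suc (M ℕ.+ suc a) * S (S (T M (suc (suc a)) (suc (suc a)))) k + p ^ (M ∸ a) * T M a a k ∎
    where
    open Contiguous (cf M)
    m = M ℕ.+ a
    ∸₁ : M ∸ a ≡ suc l
    ∸₁ = ≡.trans (≡.cong (_∸ a) (≡.sym (ℕₚ.+-suc a l))) (ℕₚ.m+n∸m≡n a (suc l))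
    size : suc (M ℕ.+ M) ≡ (2 ℕ.+ m) ℕ.+ l
    size = ≡.cong suc (≡.trans (ℕₚ.+-suc M (a ℕ.+ l)) (≡.cong suc (≡.sym (ℕₚ.+-assoc M a l))))
    e₁ : x₁ M ≈ p ^ (2 ℕ.+ m) * p ^ l
    e₁ = trans (^-congʳ p size) (^-+ p (2 ℕ.+ m) l)
    e₂ : x₂ M ≈ p ^ (2 ℕ.+ m) * p ^ suc l
    e₂ = trans (^-congʳ p (≡.trans (≡.cong suc size) (≡.sym (ℕₚ.+-suc (2 ℕ.+ m) l)))) (^-+ p (2 ℕ.+ m) (suc l))
    eΦ : ∀ k → Φ M (suc a) k ≈ P (3 ℕ.+ m) (2 ℕ.+ l) (suc a) k
    eΦ = U-≡ (cf M) (suc a) (≡.cong (2 ℕ.+_) (ℕₚ.+-suc M a))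
      (≡.trans (ℕₚ.+-∸-assoc 1 {M} {a} (ℕₚ.<⇒≤ a<M)) (≡.cong suc ∸₁))
    eT : ∀ k → T M (suc a) (suc a) k ≈ P (2 ℕ.+ m) (suc l) (suc a) k
    eT = U-≡ (cf M) (suc a) (≡.cong suc (ℕₚ.+-suc M a)) ∸₁
    eT⁺ : ∀ k → T M (suc (suc a)) (suc (suc a)) k ≈ P (3 ℕ.+ m) l (suc (suc a)) k
    eT⁺ = U-≡ (cf M) (suc (suc a)) (≡.cong suc (≡.trans (ℕₚ.+-suc M (suc a)) (≡.cong suc (ℕₚ.+-suc M a))))
      (ℕₚ.m+n∸m≡n (suc a) l)

  -- `τ M j k` is T(k,M;j,j). Indexing by L itself makes sequences with different j addable.
  τ Φ̂ : ℕ → ℕ → Seq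
  τ M j = sh j (T M j j)
  Φ̂ M j = sh j (Φ M j)

  lowτ : ℕ → ℕ → Seq
  lowτ M zero    = τ M 1
  lowτ M (suc j) = τ M j

  Φ̂-rel : ∀ M j k →
    Φ̂ M j k + x₁ M * x₂ M * S (S (S (S (Φ̂ M j)))) k
    ≈ (x₁ M + x₂ M) * S (S (Φ̂ M j)) k + τ M j k + x₁ M * S (S (τ M j)) k
      + p ^ suc (M ℕ.+ j) * S (τ M (suc j)) k + lowC M j * S (lowτ M j) k
  Φ̂-rel M j k = trans (+-congˡ (*-congˡ (sym (sh-S⁴ j _ k))))
    (trans (sh-rel₇ j _ _ _ _ _ (Φ-rel M j) k)
      (+-cong (+-cong (+-cong (+-congʳ (*-congˡ (sh-S² j _ k))) (*-congˡ (sh-S² j _ k))) (*-congˡ (sh-S² j _ k))) (*-congˡ (low j k))))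
    where
    low : ∀ j k → sh j (lowT M j) k ≈ S (lowτ M j) k
    low zero    k = refl
    low (suc j) k = refl

  -- κ j collects q^(3j²/2 + j) and q^(3j²/2 - j); the paper's sum over ℤ is folded onto ℕ.
  w⁺ w⁻ κ̃ κ : Seq
  w⁺ zero    = 1#
  w⁺ (suc j) = w⁺ j * (p ^ j * (r * r * r * r * r))
  w⁻ zero    = 1#
  w⁻ (suc j) = w⁻ j * (p ^ j * r)
  κ̃ j = w⁺ j + w⁻ j
  κ zero    = 1#
  κ (suc j) = κ̃ (suc j)

  τ-zero : ∀ M j k → M ℕ.< j → τ M j k ≈ 0#
  τ-zero M j k M<j = sh-zero j (λ k → T-zero M j j k M<j) k

  Στ : ℕ → ℕ → Seq
  Στ B M k = sumTo B λ j → κ j * τ M j k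

  ΣΦ : ℕ → ℕ → Seq
  ΣΦ B M k = sumTo B λ j → κ j * Φ̂ M j k

  S-sum : ∀ B (w : Seq) (f : ℕ → Seq) k → S (λ k → sumTo B (λ j → w j * f j k)) k ≈ sumTo B (λ j → w j * S (f j) k)
  S-sum B w f zero    = sym (sum-zero B (λ j → zeroʳ _))
  S-sum B w f (suc k) = refl

  S²-sum : ∀ B (w : Seq) (f : ℕ → Seq) k → S (S (λ k → sumTo B (λ j → w j * f j k))) k ≈ sumTo B (λ j → w j * S (S (f j)) k)
  S²-sum B w f k = trans (S-cong (S-sum B w f) k) (S-sum B w (λ j → S (f j)) k)

  -- Together with `t₃`, the coefficients of the three factors by which (-rz;r²)_(3M+3) extends
  -- (-rz;r²)_(3M). As t₁t₅ = x₁, the operator `Y M` is multiplication by (1 + t₁z)(1 + t₅z).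
  t₁ t₅ : ℕ → Carrier
  t₁ M = p ^ M * r
  t₅ M = p ^ M * (r * r * r * r * r)

  -- Over all integers j the weight is c_j = r^(3j²+2j), and c_(j+1) p^(M-j) = t₅ c_j while c_(j-1)
  -- p^(M+j) = t₁ c_j. The two neighbours of j thus contribute multiples of c_j that do not depend
  -- on j.
  crossing : ∀ {B} M k → M ℕ.< B →
    sumTo B (λ j → κ j * (p ^ suc (M ℕ.+ j) * S (τ M (suc j)) k + lowC M j * S (lowτ M j) k))
    ≈ (t₁ M + t₅ M) * S (Στ B M) k
  crossing {B} M k M<B = begin
    sumTo B (λ j → κ j * (p ^ suc (M ℕ.+ j) * u (suc j) + lowC M j * S (lowτ M j) k))
      ≈⟨ trans (sum-cong B regroup) (sum-+ B) ⟩
    sumTo B f + sumTo B (S g)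
      ≈⟨ +-cong (sym (sum-S B f (*-zeroʳ (u-zero (suc B) (ℕₚ.m<n⇒m<1+n M<B))))) (sum-S B g (*-zeroʳ (u-zero B M<B))) ⟩
    sumTo B (S f) + sumTo B g
      ≈⟨ sum-+ B ⟨
    sumTo B (λ j → S f j + g j)
      ≈⟨ trans (sum-cong B merge) (sum-*ˡ B _) ⟩
    (t₁ M + t₅ M) * sumTo B (λ j → κ j * u j)
      ≈⟨ *-congˡ (S-sum B κ (τ M) k) ⟨
    (t₁ M + t₅ M) * S (Στ B M) k ∎
    where
    u f g : Seq
    u j = S (τ M j) k
    f j = (κ̃ j * p ^ suc (M ℕ.+ j)) * u (suc j)
    g j = (κ̃ (suc j) * p ^ (M ∸ j)) * u j
    u-zero : ∀ j → M ℕ.< j → u j ≈ 0#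
    u-zero j M<j = S-zero (λ k → τ-zero M j k M<j) k
    regroup : ∀ j → κ j * (p ^ suc (M ℕ.+ j) * u (suc j) + lowC M j * S (lowτ M j) k) ≈ f j + S g j
    -- Both neighbours of j = 0 fold onto j = 1. Hence `κ̃ 0` is 1 + 1 although `κ 0` is 1.
    regroup zero = (trans (*-congˡ (+-congˡ (*-congʳ (^-congʳ p (≡.cong suc (≡.sym (ℕₚ.+-identityʳ M)))))))
      (solve 2 (λ P u → con 1 :* (P :* u :+ P :* u) := (con 1 :+ con 1) :* P :* u :+ con 0) refl (p ^ suc (M ℕ.+ 0)) (u 1)))
    regroup (suc j) = solve 5 (λ κ P u Q v → κ :* (P :* u :+ Q :* v) := κ :* P :* u :+ κ :* Q :* v) refl _ _ _ _ _
    merge : ∀ j → S f j + g j ≈ (t₁ M + t₅ M) * (κ j * u j)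
    merge zero = solve 3 (λ P r u → con 0 :+ ((con 1 :* (con 1 :* (r :* r :* r :* r :* r)) :+ con 1 :* (con 1 :* r)) :* P) :* u
        := (P :* r :+ P :* (r :* r :* r :* r :* r)) :* (con 1 :* u)) refl (p ^ M) r (u 0)
    merge (suc j) with ℕₚ.<-≤-connex M (suc j)
    ... | Sum.inj₁ M<j = trans (+-cong (*-zeroʳ (u-zero (suc j) M<j)) (*-zeroʳ (u-zero (suc j) M<j)))
        (trans (+-identityˡ _) (sym (*-zeroʳ (*-zeroʳ (u-zero (suc j) M<j)))))
    ... | Sum.inj₂ j<M = begin
        (κ̃ j * p ^ suc (M ℕ.+ j)) * v + (κ̃ (suc (suc j)) * p ^ (M ∸ suc j)) * v
          ≈⟨ +-cong (*-congʳ (*-congˡ (*-congˡ (^-+ p M j)))) refl ⟩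
        (κ̃ j * (p * (p ^ M * p ^ j))) * v + (κ̃ (suc (suc j)) * D) * v
          ≈⟨ solve 8 (λ a b r P Q v Q' D →
               ((a :+ b) :* ((r :* (r :* r)) :* (r :* (r :* r)) :* (P :* Q))) :* v
               :+ ((a :* (Q :* (r :* r :* r :* r :* r)) :* (Q' :* (r :* r :* r :* r :* r)) :+ b :* (Q :* r) :* (Q' :* r)) :* D) :* v
               := ((a :+ b) :* ((r :* (r :* r)) :* (r :* (r :* r)) :* (P :* Q))) :* v
               :+ (a :* (Q :* (r :* r :* r :* r :* r)) :* (r :* r :* r :* r :* r) :+ b :* (Q :* r) :* r) :* (Q' :* D) :* v)
               refl (w⁺ j) (w⁻ j) r (p ^ M) (p ^ j) v (p ^ suc j) D ⟩
        (κ̃ j * (p * (p ^ M * p ^ j))) * v + (w⁺ (suc j) * (r * r * r * r * r) + w⁻ (suc j) * r) * (p ^ suc j * D) * v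
          ≈⟨ +-congˡ (*-congʳ (*-congˡ (trans (sym (^-+ p (suc j) (M ∸ suc j))) (^-congʳ p (ℕₚ.m+[n∸m]≡n j<M))))) ⟩
        (κ̃ j * (p * (p ^ M * p ^ j))) * v + (w⁺ (suc j) * (r * r * r * r * r) + w⁻ (suc j) * r) * p ^ M * v
          ≈⟨ solve 6 (λ a b r P Q v →
               ((a :+ b) :* ((r :* (r :* r)) :* (r :* (r :* r)) :* (P :* Q))) :* v
               :+ (a :* (Q :* (r :* r :* r :* r :* r)) :* (r :* r :* r :* r :* r) :+ b :* (Q :* r) :* r) :* P :* v
               := (P :* r :+ P :* (r :* r :* r :* r :* r)) :* ((a :* (Q :* (r :* r :* r :* r :* r)) :+ b :* (Q :* r)) :* v))
               refl (w⁺ j) (w⁻ j) r (p ^ M) (p ^ j) v ⟩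
        (t₁ M + t₅ M) * (κ (suc j) * v) ∎
      where
      v = u (suc j)
      D = p ^ (M ∸ suc j)

  ΣΦ-rel : ∀ {B} M k → M ℕ.< B →
    ΣΦ B M k + x₁ M * x₂ M * S (S (S (S (ΣΦ B M)))) k
    ≈ (x₁ M + x₂ M) * S (S (ΣΦ B M)) k + (Στ B M k + x₁ M * S (S (Στ B M)) k + (t₁ M + t₅ M) * S (Στ B M) k)
  ΣΦ-rel {B} M k M<B = begin
    ΣΦ B M k + xy * S (S (S (S (ΣΦ B M)))) k
      ≈⟨ +-congˡ (*-congˡ (trans (S-cong (S-cong (S²-sum B κ (Φ̂ M))) k) (S²-sum B κ (λ j → S (S (Φ̂ M j))) k))) ⟩
    ΣΦ B M k + xy * sumTo B (λ j → κ j * S (S (S (S (Φ̂ M j)))) k)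
      ≈⟨ sum-lin B xy (λ j → solve 4 (λ κ f x g → κ :* (f :+ x :* g) := κ :* f :+ x :* (κ :* g)) refl (κ j) (Φ̂ M j k) xy _) ⟨
    sumTo B (λ j → κ j * (Φ̂ M j k + xy * S (S (S (S (Φ̂ M j)))) k))
      ≈⟨ sum-cong B (λ j → trans (*-congˡ (Φ̂-rel M j k))
           (solve 8 (λ κ y a b x d e f → κ :* (y :* a :+ b :+ x :* d :+ e :+ f)
               := (y :* (κ :* a) :+ (κ :* b :+ x :* (κ :* d))) :+ κ :* (e :+ f)) refl
             (κ j) (x₁ M + x₂ M) (S (S (Φ̂ M j)) k) (τ M j k) (x₁ M) (S (S (τ M j)) k) _ _)) ⟩
    sumTo B (λ j → ((x₁ M + x₂ M) * (κ j * S (S (Φ̂ M j)) k) + (κ j * τ M j k + x₁ M * (κ j * S (S (τ M j)) k)))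
        + κ j * (p ^ suc (M ℕ.+ j) * S (τ M (suc j)) k + lowC M j * S (lowτ M j) k))
      ≈⟨ trans (sum-+ B) (+-cong (trans (sum-+ B) (+-cong (sum-*ˡ B _) (sum-lin B (x₁ M) (λ _ → refl)))) (crossing M k M<B)) ⟩
    ((x₁ M + x₂ M) * sumTo B (λ j → κ j * S (S (Φ̂ M j)) k) + (Στ B M k + x₁ M * sumTo B (λ j → κ j * S (S (τ M j)) k)))
      + (t₁ M + t₅ M) * S (Στ B M) k
      ≈⟨ trans (+-congʳ (+-cong (*-congˡ (sym (S²-sum B κ (Φ̂ M) k))) (+-congˡ (*-congˡ (sym (S²-sum B κ (τ M) k)))))) (+-assoc _ _ _) ⟩
    (x₁ M + x₂ M) * S (S (ΣΦ B M)) k + (Στ B M k + x₁ M * S (S (Στ B M)) k + (t₁ M + t₅ M) * S (Στ B M) k) ∎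
    where xy = x₁ M * x₂ M

  t₃ : ℕ → Carrier
  t₃ M = p ^ M * s

  Y : ℕ → Seq → Seq
  Y M f k = f k + x₁ M * S (S f) k + (t₁ M + t₅ M) * S f k

  Στ-suc : ∀ B M k → Στ B (suc M) k ≈ ΣΦ B M k + t₃ M * S (ΣΦ B M) k
  Στ-suc B M k = trans (sum-cong B (λ j → trans (*-congˡ (step j)) (solve 4 (λ κ f x g → κ :* (f :+ x :* g) := κ :* f :+ x :* (κ :* g)) refl (κ j) _ (t₃ M) _)))
    (trans (sum-+ B) (+-congˡ (trans (sum-*ˡ B _) (*-congˡ (sym (S-sum B κ (Φ̂ M) k))))))
    where
    step : ∀ j → τ (suc M) j k ≈ Φ̂ M j k + t₃ M * S (Φ̂ M j) k
    step j = trans (sh-lin j (t₃ M) (U-cf M (suc (suc M ℕ.+ j)) (suc (suc M) ∸ j) j) k) (+-congˡ (*-congˡ (≡⇒≈ (sh-S j (Φ M j) k))))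

  S-Y : ∀ M f k → S (Y M f) k ≈ S f k + x₁ M * S (S (S f)) k + (t₁ M + t₅ M) * S (S f) k
  S-Y M f zero    = solve 2 (λ x t → con 0 := con 0 :+ x :* con 0 :+ t :* con 0) refl (x₁ M) (t₁ M + t₅ M)
  S-Y M f (suc k) = refl

  -- Coefficients of (1 - x₁z²)(1 - x₂z²) Στ (M+1) = (1 + t₁z)(1 + t₃z)(1 + t₅z) Στ M. The factor
  -- with t₃ is the one left out of Φ.
  Στ-rec : ∀ {B} M k → M ℕ.< B →
    Στ B (suc M) k + x₁ M * x₂ M * S (S (S (S (Στ B (suc M))))) k
    ≈ Y M (Στ B M) k + t₃ M * S (Y M (Στ B M)) k + (x₁ M + x₂ M) * S (S (Στ B (suc M))) k
  Στ-rec {B} M k M<B = begin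
    Στ B (suc M) k + z * S (S (S (S (Στ B (suc M))))) k
      ≈⟨ +-cong (Στ-suc B M k) (*-congˡ (sh-lin 4 (t₃ M) (Στ-suc B M) k)) ⟩
    (X k + t₃ M * S X k) + z * (S (S (S (S X))) k + t₃ M * sh 4 (S X) k)
      ≈⟨ solve 6 (λ x t sx z x₄ x₅ → (x :+ t :* sx) :+ z :* (x₄ :+ t :* x₅) := (x :+ z :* x₄) :+ t :* (sx :+ z :* x₅)) refl
           (X k) (t₃ M) (S X k) z _ _ ⟩
    (X k + z * S (S (S (S X))) k) + t₃ M * (S X k + z * S (S (S (S (S X)))) k)
      ≈⟨ +-cong (rel k) (*-congˡ (sh-rel₂₂ 1 z y rel k)) ⟩
    (Y M (Στ B M) k + y * S (S X) k) + t₃ M * (S (Y M (Στ B M)) k + y * S (S (S X)) k)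
      ≈⟨ solve 6 (λ a y x₂ t b x₃ → (a :+ y :* x₂) :+ t :* (b :+ y :* x₃) := a :+ t :* b :+ y :* (x₂ :+ t :* x₃)) refl
           _ y _ (t₃ M) _ _ ⟩
    Y M (Στ B M) k + t₃ M * S (Y M (Στ B M)) k + y * (S (S X) k + t₃ M * sh 2 (S X) k)
      ≈⟨ +-congˡ (*-congˡ (sh-lin 2 (t₃ M) (Στ-suc B M) k)) ⟨
    Y M (Στ B M) k + t₃ M * S (Y M (Στ B M)) k + y * S (S (Στ B (suc M))) k ∎
    where
    z = x₁ M * x₂ M
    y = x₁ M + x₂ M
    X = ΣΦ B M
    rel : ∀ k → X k + z * S (S (S (S X))) k ≈ Y M (Στ B M) k + y * S (S X) k
    rel k = trans (ΣΦ-rel M k M<B) (+-comm _ _)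

  -- The coefficients of (-rz;r²)_(3M) / (z²;p)_(2M+1).
  Θ : ℕ → Seq
  Θ M = conv (Root.cf (M ℕ.+ M ℕ.+ M)) (E (suc (M ℕ.+ M)))

  E-pascal : ∀ d k → E (suc (suc d)) k ≈ E (suc d) k + p ^ suc d * S (S (E (suc (suc d)))) k
  E-pascal d zero          = sym (trans (+-congˡ (zeroʳ _)) (+-identityʳ _))
  E-pascal d (suc zero)    = sym (trans (+-congˡ (zeroʳ _)) (+-identityʳ _))
  E-pascal d (suc (suc k)) = refl

  conv-E : ∀ u d k → conv u (E (suc (suc d))) k ≈ conv u (E (suc d)) k + p ^ suc d * S (S (conv u (E (suc (suc d))))) k
  conv-E u d k = trans (conv-linʳ u {h = S (S (E (suc (suc d))))} (p ^ suc d) (E-pascal d) k) (+-congˡ (*-congˡ (conv-S²ʳ u _ k)))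

  root-power : ∀ M → Root.p ^ (M ℕ.+ M ℕ.+ M) ≈ p ^ M
  root-power zero    = refl
  root-power (suc M) = trans (^-congʳ Root.p size)
    (trans (solve 2 (λ r x → r :* r :* (r :* r :* (r :* r :* x)) := (r :* (r :* r)) :* (r :* (r :* r)) :* x) refl r _) (*-congˡ (root-power M)))
    where
    size : suc M ℕ.+ suc M ℕ.+ suc M ≡ suc (suc (suc (M ℕ.+ M ℕ.+ M)))
    size = ≡.cong suc (≡.trans (ℕₚ.+-suc (M ℕ.+ suc M) M) (≡.cong (λ n → suc (n ℕ.+ M)) (ℕₚ.+-suc M M)))

  conv-root : ∀ N f k → conv (Root.cf (suc N)) f k ≈ conv (Root.cf N) f k + (Root.p ^ N * r) * S (conv (Root.cf N) f) k
  conv-root N f k = trans (conv-linˡ f (Root.p ^ N * r) (λ _ → refl) k) (+-congˡ (*-congˡ (conv-Sˡ (Root.cf N) f k)))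

  Θ-rec : ∀ M k →
    Θ (suc M) k + x₁ M * x₂ M * S (S (S (S (Θ (suc M))))) k
    ≈ Y M (Θ M) k + t₃ M * S (Y M (Θ M)) k + (x₁ M + x₂ M) * S (S (Θ (suc M))) k
  Θ-rec M k = begin
    Θ (suc M) k + x₁ M * x₂ M * S (S (S (S (Θ (suc M))))) k
      ≈⟨ +-cong (same k) (*-congˡ (sh-cong 4 same k)) ⟩
    A₂ k + x₁ M * x₂ M * S (S (S (S A₂))) k
      ≈⟨ +-congʳ (trans (conv-E u (suc (M ℕ.+ M)) k) (+-congʳ (conv-E u (M ℕ.+ M) k))) ⟩
    ((A₀ k + x₁ M * S (S A₁) k) + x₂ M * S (S A₂) k) + x₁ M * x₂ M * S (S (S (S A₂))) k
      ≈⟨ solve 6 (λ a x b y d e → ((a :+ x :* b) :+ y :* d) :+ x :* y :* e := (a :+ x :* (b :+ y :* e)) :+ y :* d) refl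
           (A₀ k) (x₁ M) (S (S A₁) k) (x₂ M) (S (S A₂) k) _ ⟩
    (A₀ k + x₁ M * (S (S A₁) k + x₂ M * S (S (S (S A₂))) k)) + x₂ M * S (S A₂) k
      ≈⟨ +-congʳ (+-congˡ (*-congˡ (sh-lin 2 (x₂ M) (conv-E u (suc (M ℕ.+ M))) k))) ⟨
    (A₀ k + x₁ M * S (S A₂) k) + x₂ M * S (S A₂) k
      ≈⟨ trans (+-assoc _ _ _) (+-congˡ (sym (distribʳ _ _ _))) ⟩
    A₀ k + (x₁ M + x₂ M) * S (S A₂) k
      ≈⟨ +-cong (three k) (*-congˡ (sym (sh-cong 2 same k))) ⟩
    Y M (Θ M) k + t₃ M * S (Y M (Θ M)) k + (x₁ M + x₂ M) * S (S (Θ (suc M))) k ∎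
    where
    N = M ℕ.+ M ℕ.+ M
    u A₀ A₁ A₂ : Seq
    u  = Root.cf (suc (suc (suc N)))
    A₀ = conv u (E (suc (M ℕ.+ M)))
    A₁ = conv u (E (suc (suc (M ℕ.+ M))))
    A₂ = conv u (E (suc (suc (suc (M ℕ.+ M)))))
    size : suc M ℕ.+ suc M ℕ.+ suc M ≡ suc (suc (suc N))
    size = ≡.cong suc (≡.trans (ℕₚ.+-suc (M ℕ.+ suc M) M) (≡.cong (λ n → suc (n ℕ.+ M)) (ℕₚ.+-suc M M)))
    same : ∀ k → Θ (suc M) k ≈ A₂ k
    same k = ≡⇒≈ (≡.cong₂ (λ n d → conv (Root.cf n) (E d) k) size (≡.cong (2 ℕ.+_) (ℕₚ.+-suc M M)))
    f : Seq
    f = E (suc (M ℕ.+ M))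
    a₀ : Seq
    a₀ = conv (Root.cf (suc N)) f
    c₀ c₁ c₂ : Carrier
    c₀ = Root.p ^ N * r
    c₁ = Root.p ^ suc N * r
    c₂ = Root.p ^ suc (suc N) * r
    three : ∀ k → A₀ k ≈ Y M (Θ M) k + t₃ M * S (Y M (Θ M)) k
    three k = begin
      A₀ k
        ≈⟨ trans (conv-root (suc (suc N)) f k) (+-cong (conv-root (suc N) f k) (*-congˡ (S-lin c₁ (conv-root (suc N) f) k))) ⟩
      (a₀ k + c₁ * S a₀ k) + c₂ * (S a₀ k + c₁ * S (S a₀) k)
        ≈⟨ +-cong (+-cong (conv-root N f k) (*-congˡ (S-lin c₀ (conv-root N f) k)))
             (*-congˡ (+-cong (S-lin c₀ (conv-root N f) k) (*-congˡ (sh-lin 2 c₀ (conv-root N f) k)))) ⟩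
      ((Θ M k + c₀ * S (Θ M) k) + c₁ * (S (Θ M) k + c₀ * S (S (Θ M)) k))
        + c₂ * ((S (Θ M) k + c₀ * S (S (Θ M)) k) + c₁ * (S (S (Θ M)) k + c₀ * S (S (S (Θ M))) k))
        ≈⟨ +-cong (+-cong (+-congˡ (*-congʳ e₀)) (*-cong e₁ (+-congˡ (*-congʳ e₀))))
             (*-cong e₂ (+-cong (+-congˡ (*-congʳ e₀)) (*-cong e₁ (+-congˡ (*-congʳ e₀))))) ⟩
      ((Θ M k + t₁ M * S (Θ M) k) + t₃ M * (S (Θ M) k + t₁ M * S (S (Θ M)) k))
        + t₅ M * ((S (Θ M) k + t₁ M * S (S (Θ M)) k) + t₃ M * (S (S (Θ M)) k + t₁ M * S (S (S (Θ M))) k))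
        ≈⟨ solve 6 (λ f₀ f₁ f₂ f₃ P r →
             ((f₀ :+ (P :* r) :* f₁) :+ (P :* (r :* (r :* r))) :* (f₁ :+ (P :* r) :* f₂))
               :+ (P :* (r :* r :* r :* r :* r)) :* ((f₁ :+ (P :* r) :* f₂) :+ (P :* (r :* (r :* r))) :* (f₂ :+ (P :* r) :* f₃))
             := (f₀ :+ ((r :* (r :* r)) :* (r :* (r :* r)) :* (P :* P)) :* f₂ :+ ((P :* r) :+ (P :* (r :* r :* r :* r :* r))) :* f₁)
               :+ (P :* (r :* (r :* r))) :* (f₁ :+ ((r :* (r :* r)) :* (r :* (r :* r)) :* (P :* P)) :* f₃ :+ ((P :* r) :+ (P :* (r :* r :* r :* r :* r))) :* f₂))
             refl (Θ M k) (S (Θ M) k) (S (S (Θ M)) k) (S (S (S (Θ M))) k) (p ^ M) r ⟩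
      (Θ M k + (p * (p ^ M * p ^ M)) * S (S (Θ M)) k + (t₁ M + t₅ M) * S (Θ M) k)
        + t₃ M * (S (Θ M) k + (p * (p ^ M * p ^ M)) * S (S (S (Θ M))) k + (t₁ M + t₅ M) * S (S (Θ M)) k)
        ≈⟨ +-cong (+-congʳ (+-congˡ (*-congʳ eₓ))) (*-congˡ (trans (+-congʳ (+-congˡ (*-congʳ eₓ))) (sym (S-Y M (Θ M) k)))) ⟩
      Y M (Θ M) k + t₃ M * S (Y M (Θ M)) k ∎
      where
      e₀ : c₀ ≈ t₁ M
      e₀ = *-congʳ (root-power M)
      e₁ : c₁ ≈ t₃ M
      e₁ = trans (*-congʳ (*-congˡ (root-power M))) (solve 2 (λ r x → r :* r :* x :* r := x :* (r :* (r :* r))) refl r (p ^ M))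
      e₂ : c₂ ≈ t₅ M
      e₂ = trans (*-congʳ (*-congˡ (*-congˡ (root-power M)))) (solve 2 (λ r x → r :* r :* (r :* r :* x) :* r := x :* (r :* r :* r :* r :* r)) refl r (p ^ M))
      eₓ : p * (p ^ M * p ^ M) ≈ x₁ M
      eₓ = *-congˡ (sym (^-+ p M M))

  Y-cong : ∀ M {f g} → (∀ k → f k ≈ g k) → ∀ k → Y M f k ≈ Y M g k
  Y-cong M eq k = +-cong (+-cong (eq k) (*-congˡ (sh-cong 2 eq k))) (*-congˡ (S-cong eq k))

  seed : ∀ {B} M → M ℕ.< B → ∀ k → Στ B M k ≈ Θ M k
  -- At M = 0 only j = 0 contributes, and the part of 1/((1 - x)(1 - y)) free of w is 1/(1 - z²).
  seed {B} zero M<B k = trans (trans (sum-first B (λ j → *-zeroʳ (τ-zero 0 (suc j) k (s≤s z≤n)))) (*-identityˡ _))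
    (trans (conv-cf₀ _ k) (trans (idem k) (sym (root₀ k))))
    where
    idem : ∀ k → E 1 k * E 1 k ≈ E 1 k
    idem zero = *-identityˡ _
    idem (suc zero) = zeroˡ _
    idem (suc (suc k)) = trans (*-cong (trans (+-identityˡ _) (*-identityˡ _)) (trans (+-identityˡ _) (*-identityˡ _)))
      (trans (idem k) (sym (trans (+-identityˡ _) (*-identityˡ _))))
    root₀ : ∀ k → Θ 0 k ≈ E 1 k
    root₀ zero    = *-identityˡ _
    root₀ (suc k) = trans (+-cong (*-identityˡ _) (trans (conv-homˡ (E 1) 0# (λ n → sym (zeroˡ 0#)) k) (zeroˡ _))) (+-identityʳ _)
  seed {B} (suc M) M<B = go
    where
    ih : ∀ k → Στ B M k ≈ Θ M k
    ih = seed M (ℕₚ.<-trans (ℕₚ.n<1+n M) M<B)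
    z = x₁ M * x₂ M
    go : ∀ k → Στ B (suc M) k ≈ Θ (suc M) k
    go₂ : ∀ k → S (S (Στ B (suc M))) k ≈ S (S (Θ (suc M))) k
    go₄ : ∀ k → S (S (S (S (Στ B (suc M))))) k ≈ S (S (S (S (Θ (suc M))))) k
    go k = +-cancelʳ (z * S (S (S (S (Στ B (suc M))))) k) _ _ (begin
      Στ B (suc M) k + z * S (S (S (S (Στ B (suc M))))) k
        ≈⟨ Στ-rec M k (ℕₚ.<-trans (ℕₚ.n<1+n M) M<B) ⟩
      Y M (Στ B M) k + t₃ M * S (Y M (Στ B M)) k + (x₁ M + x₂ M) * S (S (Στ B (suc M))) k
        ≈⟨ +-cong (+-cong (Y-cong M ih k) (*-congˡ (S-cong (Y-cong M ih) k))) (*-congˡ (go₂ k)) ⟩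
      Y M (Θ M) k + t₃ M * S (Y M (Θ M)) k + (x₁ M + x₂ M) * S (S (Θ (suc M))) k
        ≈⟨ Θ-rec M k ⟨
      Θ (suc M) k + z * S (S (S (S (Θ (suc M))))) k
        ≈⟨ +-congˡ (*-congˡ (go₄ k)) ⟨
      Θ (suc M) k + z * S (S (S (S (Στ B (suc M))))) k ∎)
    go₂ zero          = refl
    go₂ (suc zero)    = refl
    go₂ (suc (suc k)) = go k
    go₄ zero                      = refl
    go₄ (suc zero)                = refl
    go₄ (suc (suc zero))          = refl
    go₄ (suc (suc (suc zero)))    = refl
    go₄ (suc (suc (suc (suc k)))) = go k

  -- Iteration of the transformations.

  sum-exchange : ∀ A B (f : ℕ → ℕ → Carrier) →
    sumTo A (λ i → sumTo B (f i)) ≈ sumTo B (λ j → sumTo A (λ i → f i j))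
  sum-exchange zero    B f = refl
  sum-exchange (suc A) B f = trans (+-congʳ (sum-exchange A B f)) (sym (sum-+ B))

  sh-cong-≤ : ∀ n {f g} k → (∀ j → j ≤ k → f j ≈ g j) → sh n f k ≈ sh n g k
  sh-cong-≤ zero    k       eq = eq k ℕₚ.≤-refl
  sh-cong-≤ (suc n) zero    eq = refl
  sh-cong-≤ (suc n) (suc k) eq = sh-cong-≤ n k (λ j j≤k → eq j (ℕₚ.m≤n⇒m≤1+n j≤k))

  sh-sum : ∀ n B (w : Seq) (f : ℕ → Seq) k → sh n (λ k → sumTo B (λ j → w j * f j k)) k ≈ sumTo B (λ j → w j * sh n (f j) k)
  sh-sum zero    B w f k       = refl
  sh-sum (suc n) B w f zero    = sym (sum-zero B (λ j → zeroʳ _))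
  sh-sum (suc n) B w f (suc k) = sh-sum n B w f k

  -- The chain of transformations peels off N_ν, …, N_1 in turn.
  I : ℕ → ℕ → ℕ → Seq
  I B zero    K   = Θ K
  I B (suc k) K Λ = sumTo B λ N → s ^ (N ℕ.* N) * (sh N (gx (suc Λ)) K * sh N (I B k N) Λ)

  -- Each `T-transform` keeps b = j, adds j to a and contributes s^(j²). Starting from a = b = j
  -- this leads to a = (k+1)j after k applications.
  I-closed : ∀ {B} k K → K ℕ.< B → ∀ Λ →
    I B k K Λ ≈ sumTo B (λ j → (κ j * s ^ (k ℕ.* (j ℕ.* j))) * sh (suc k ℕ.* j) (T K j (suc k ℕ.* j)) Λ)
  I-closed {B} zero K K<B Λ = trans (sym (seed K K<B Λ)) (sum-cong B (λ j →
    *-cong (sym (*-identityʳ _)) (reflexive (≡.cong (λ a → sh a (T K j a) Λ) (≡.sym (ℕₚ.+-identityʳ j))))))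
  I-closed {B} (suc k) K K<B Λ = begin
    sumTo B (λ N → s ^ (N ℕ.* N) * (sh N (gx (suc Λ)) K * sh N (I B k N) Λ))
      ≈⟨ sum-cong B (λ N → inner N (ℕₚ.<-≤-connex K N)) ⟩
    sumTo B (λ N → sumTo B (λ j → w j * f N j))
      ≈⟨ sum-exchange B B (λ N j → w j * f N j) ⟩
    sumTo B (λ j → sumTo B (λ N → w j * f N j))
      ≈⟨ sum-cong B (λ j → trans (sum-*ˡ B (w j)) (trans (*-congˡ (T-transform j (suc k ℕ.* j) Λ (ℕₚ.<⇒≤ K<B)))
           (trans (sym (*-assoc _ _ _)) (*-congʳ (trans (*-assoc _ _ _) (*-congˡ (trans (*-comm _ _) (sym (^-+ s (j ℕ.* j) _))))))))) ⟩
    sumTo B (λ j → (κ j * s ^ (suc k ℕ.* (j ℕ.* j))) * sh (suc (suc k) ℕ.* j) (T K j (suc (suc k) ℕ.* j)) Λ) ∎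
    where
    w : Seq
    w j = κ j * s ^ (k ℕ.* (j ℕ.* j))
    f : ℕ → Seq
    f N j = s ^ (N ℕ.* N) * (sh N (gx (suc Λ)) K * sh (N ℕ.+ suc k ℕ.* j) (T N j (suc k ℕ.* j)) Λ)
    -- For N > K the binomial vanishes, so the induction hypothesis is called only with N ≤ K < B.
    inner : ∀ N → K ℕ.< N Sum.⊎ N ≤ K → s ^ (N ℕ.* N) * (sh N (gx (suc Λ)) K * sh N (I B k N) Λ) ≈ sumTo B (λ j → w j * f N j)
    inner N (Sum.inj₁ K<N) = trans (*-zeroʳ (*-zeroˡ γ≈0))
      (sym (sum-zero B (λ j → *-zeroʳ (*-zeroʳ (*-zeroˡ γ≈0)))))
      where
      γ≈0 : sh N (gx (suc Λ)) K ≈ 0#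
      γ≈0 = ≡⇒≈ (sh-over N (gx (suc Λ)) K K<N)
    inner N (Sum.inj₂ N≤K) = begin
      s ^ (N ℕ.* N) * (sh N (gx (suc Λ)) K * sh N (I B k N) Λ)
        ≈⟨ *-congˡ (*-congˡ (trans (sh-cong N (I-closed k N (ℕₚ.≤-<-trans N≤K K<B)) Λ) (sh-sum N B w (λ j → sh (suc k ℕ.* j) (T N j (suc k ℕ.* j))) Λ))) ⟩
      s ^ (N ℕ.* N) * (sh N (gx (suc Λ)) K * sumTo B (λ j → w j * sh N (sh (suc k ℕ.* j) (T N j (suc k ℕ.* j))) Λ))
        ≈⟨ trans (sym (*-assoc _ _ _)) (sym (sum-*ˡ B _)) ⟩
      sumTo B (λ j → (s ^ (N ℕ.* N) * sh N (gx (suc Λ)) K) * (w j * sh N (sh (suc k ℕ.* j) (T N j (suc k ℕ.* j))) Λ))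
        ≈⟨ sum-cong B (λ j → trans (solve 4 (λ a b w t → (a :* b) :* (w :* t) := w :* (a :* (b :* t))) refl _ _ _ _)
             (*-congˡ (*-congˡ (*-congˡ (≡⇒≈ (sh-sh N (suc k ℕ.* j) _ Λ)))))) ⟩
      sumTo B (λ j → w j * f N j) ∎

  -- The summand with index ±j of the right-hand side, without its κ-weight; k is ν.
  dual : ℕ → ℕ → ℕ → ℕ → ℕ → Carrier
  dual B k L M j = s ^ (a ℕ.* a) * W B (M ∸ j) (j ℕ.+ M) (j ℕ.+ a) M L
    where a = suc k ℕ.* j

  -- `Z` stands for the right-hand terms as `Sref` provides them. Agreement with `dual` is asked
  -- only for j ≤ M, where `M ∸ j` is a true difference.
  chain : ∀ {B} k L M → L ℕ.< B → M ℕ.< B → (Z : Seq) →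
    (∀ j → j ≤ M → Z j ≈ dual B k L M j) → (∀ j → M ℕ.< j → Z j ≈ 0#) →
    sumTo B (λ i → s ^ (i ℕ.* i) * (sh i (gx (suc L)) M * sh i (λ μ → I B k μ i) L))
    ≈ sumTo B (λ j → (κ j * s ^ (k ℕ.* (j ℕ.* j))) * Z j)
  chain {B} k L M L<B M<B Z Z≈ Z≈0 = begin
    sumTo B (λ i → s ^ (i ℕ.* i) * (sh i (gx (suc L)) M * sh i (λ μ → I B k μ i) L))
      ≈⟨ sum-cong B inner ⟩
    sumTo B (λ i → sumTo B (λ j → w j * f i j))
      ≈⟨ sum-exchange B B (λ i j → w j * f i j) ⟩
    sumTo B (λ j → sumTo B (λ i → w j * f i j))
      ≈⟨ sum-cong B (λ j → trans (sum-*ˡ B (w j)) (*-congˡ (eval j (ℕₚ.<-≤-connex M j)))) ⟩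
    sumTo B (λ j → w j * Z j) ∎
    where
    w : Seq
    w j = κ j * s ^ (k ℕ.* (j ℕ.* j))
    f : ℕ → Seq
    f i j = s ^ (i ℕ.* i) * (sh i (gx (suc L)) M * sh i (λ μ → sh (suc k ℕ.* j) (T μ j (suc k ℕ.* j)) i) L)
    inner : ∀ i → s ^ (i ℕ.* i) * (sh i (gx (suc L)) M * sh i (λ μ → I B k μ i) L) ≈ sumTo B (λ j → w j * f i j)
    inner i = begin
      s ^ (i ℕ.* i) * (sh i (gx (suc L)) M * sh i (λ μ → I B k μ i) L)
        ≈⟨ *-congˡ (*-congˡ (trans (sh-cong-≤ i L (λ μ μ≤L → I-closed k μ (ℕₚ.≤-<-trans μ≤L L<B) i))
             (sh-sum i B w (λ j μ → sh (suc k ℕ.* j) (T μ j (suc k ℕ.* j)) i) L))) ⟩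
      s ^ (i ℕ.* i) * (sh i (gx (suc L)) M * sumTo B (λ j → w j * sh i (λ μ → sh (suc k ℕ.* j) (T μ j (suc k ℕ.* j)) i) L))
        ≈⟨ trans (sym (*-assoc _ _ _)) (sym (sum-*ˡ B _)) ⟩
      sumTo B (λ j → (s ^ (i ℕ.* i) * sh i (gx (suc L)) M) * (w j * sh i (λ μ → sh (suc k ℕ.* j) (T μ j (suc k ℕ.* j)) i) L))
        ≈⟨ sum-cong B (λ j → solve 4 (λ a b w t → (a :* b) :* (w :* t) := w :* (a :* (b :* t))) refl _ _ _ _) ⟩
      sumTo B (λ j → w j * f i j) ∎
    eval : ∀ j → M ℕ.< j Sum.⊎ j ≤ M → sumTo B (λ i → f i j) ≈ Z j
    eval j (Sum.inj₁ M<j) = trans (T-to-S-over j (suc k ℕ.* j) L M<B (ℕₚ.<-≤-trans M<j (ℕₚ.m≤m+n j _))) (sym (Z≈0 j M<j))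
    eval j (Sum.inj₂ j≤M) = trans (T-to-S j (suc k ℕ.* j) L M<B (M ∸ j) (ℕₚ.m∸n+n≡m j≤M)) (sym (Z≈ j j≤M))

  -- Right-hand side: exponents and the folding of negative j.

  p-power : ∀ j → p ^ j ≈ r ^ (6 ℕ.* j)
  p-power j = trans (^-congˡ j (solve 1 (λ r → (r :* (r :* r)) :* (r :* (r :* r)) := r :* (r :* (r :* (r :* (r :* (r :* con 1)))))) refl r)) (^-assocʳ r 6 j)

  w⁺-closed : ∀ j → w⁺ j ≈ r ^ (j ℕ.* (3 ℕ.* j ℕ.+ 2))
  w⁺-closed zero    = refl
  w⁺-closed (suc j) = trans (*-cong (w⁺-closed j) (*-congʳ (p-power j)))
    (trans (solve 3 (λ a b r → a :* (b :* (r :* r :* r :* r :* r)) := a :* (b :* (r :* (r :* (r :* (r :* (r :* con 1))))))) refl _ _ r)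
      (trans (*-congˡ (sym (^-+ r (6 ℕ.* j) 5))) (trans (sym (^-+ r (j ℕ.* (3 ℕ.* j ℕ.+ 2)) (6 ℕ.* j ℕ.+ 5))) (^-congʳ r (size j)))))
    where
    size : ∀ j → j ℕ.* (3 ℕ.* j ℕ.+ 2) ℕ.+ (6 ℕ.* j ℕ.+ 5) ≡ suc j ℕ.* (3 ℕ.* suc j ℕ.+ 2)
    size = ℕS.solve 1 (λ j → j ℕS.:* (ℕS.con 3 ℕS.:* j ℕS.:+ ℕS.con 2) ℕS.:+ (ℕS.con 6 ℕS.:* j ℕS.:+ ℕS.con 5)
      ℕS.:= (ℕS.con 1 ℕS.:+ j) ℕS.:* (ℕS.con 3 ℕS.:* (ℕS.con 1 ℕS.:+ j) ℕS.:+ ℕS.con 2)) ≡.refl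

  -- The exponent 3n² - 2n at n = j + 1, factored to avoid subtraction.
  w⁻-closed : ∀ j → w⁻ (suc j) ≈ r ^ (suc j ℕ.* (3 ℕ.* j ℕ.+ 1))
  w⁻-closed zero    = solve 1 (λ r → con 1 :* (con 1 :* r) := r :* con 1) refl r
  w⁻-closed (suc j) = trans (*-cong (w⁻-closed j) (*-congʳ (p-power (suc j))))
    (trans (solve 3 (λ a b r → a :* (b :* r) := a :* (b :* (r :* con 1))) refl _ _ r)
      (trans (*-congˡ (sym (^-+ r (6 ℕ.* suc j) 1))) (trans (sym (^-+ r (suc j ℕ.* (3 ℕ.* j ℕ.+ 1)) (6 ℕ.* suc j ℕ.+ 1))) (^-congʳ r (size j)))))
    where
    size : ∀ j → suc j ℕ.* (3 ℕ.* j ℕ.+ 1) ℕ.+ (6 ℕ.* suc j ℕ.+ 1) ≡ suc (suc j) ℕ.* (3 ℕ.* suc j ℕ.+ 1)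
    size = ℕS.solve 1 (λ j → (ℕS.con 1 ℕS.:+ j) ℕS.:* (ℕS.con 3 ℕS.:* j ℕS.:+ ℕS.con 1) ℕS.:+ (ℕS.con 6 ℕS.:* (ℕS.con 1 ℕS.:+ j) ℕS.:+ ℕS.con 1)
      ℕS.:= (ℕS.con 2 ℕS.:+ j) ℕS.:* (ℕS.con 3 ℕS.:* (ℕS.con 1 ℕS.:+ j) ℕS.:+ ℕS.con 1)) ≡.refl

  q : Carrier
  q = r * r

  q³≈p : q ^ 3 ≈ p
  q³≈p = solve 1 (λ r → (r :* r) :* ((r :* r) :* ((r :* r) :* con 1)) := (r :* (r :* r)) :* (r :* (r :* r))) refl r

  qbinℤ-cong : ∀ {x y} → x ≈ y → ∀ a b → qbinℤ x a b ≈ qbinℤ y a b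
  qbinℤ-cong x≈y (+ a)      (+ b)      = qbin-cong x≈y a b
  qbinℤ-cong x≈y (+ a)      (-[1+ b ]) = refl
  qbinℤ-cong x≈y (-[1+ a ]) b          = refl

  Sref-cong : ∀ B {x y} → x ≈ y → ∀ L M a b → Sref B x L M a b ≈ Sref B y L M a b
  Sref-cong B x≈y L M a b = sum-cong B (λ n → *-cong (*-cong (*-cong (^-congˡ ∣ + n ℤ.* (+ n ℤ.+ a) ∣ x≈y)
    (qbinℤ-cong x≈y (+ (M ℕ.+ L) ℤ.- a ℤ.- + (2 ℕ.* n)) (+ M))) (qbinℤ-cong x≈y (+ M ℤ.- a ℤ.+ b) (+ n)))
    (qbinℤ-cong x≈y (+ M ℤ.+ a ℤ.- b) (+ n ℤ.+ a)))

  s-power : ∀ n → s ^ n ≈ r ^ (3 ℕ.* n)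
  s-power n = trans (^-congˡ n (solve 1 (λ r → r :* (r :* r) := r :* (r :* (r :* con 1))) refl r)) (^-assocʳ r 3 n)

  q-power : ∀ n → q ^ n ≈ r ^ (2 ℕ.* n)
  q-power n = trans (^-congˡ n (solve 1 (λ r → r :* r := r :* (r :* con 1)) refl r)) (^-assocʳ r 2 n)

  twice-C2 : ∀ n → 2 ℕ.* ((n ℕ.+ 2) C 2) ≡ (n ℕ.+ 2) ℕ.* (n ℕ.+ 1)
  twice-C2 zero    = ≡.refl
  twice-C2 (suc n) = ≡.trans (≡.cong (2 ℕ.*_) (≡.trans (≡.sym (nCk+nC[k+1]≡[n+1]C[k+1] (n ℕ.+ 2) 1)) (≡.cong (ℕ._+ (n ℕ.+ 2) C 2) (nC1≡n (n ℕ.+ 2)))))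
    (≡.trans (ℕₚ.*-distribˡ-+ 2 (n ℕ.+ 2) _) (≡.trans (≡.cong (2 ℕ.* (n ℕ.+ 2) ℕ.+_) (twice-C2 n))
      (ℕS.solve 1 (λ n → ℕS.con 2 ℕS.:* (n ℕS.:+ ℕS.con 2) ℕS.:+ (n ℕS.:+ ℕS.con 2) ℕS.:* (n ℕS.:+ ℕS.con 1)
         ℕS.:= (ℕS.con 1 ℕS.:+ n ℕS.:+ ℕS.con 2) ℕS.:* (ℕS.con 1 ℕS.:+ n ℕS.:+ ℕS.con 1)) ≡.refl n)))

  module RightSide (ν B L M : ℕ) (M<B : M ℕ.< B) (2M≤B : M ℕ.+ M ≤ B) where
    c₂ : ℕ
    c₂ = 3 ℕ.* ((ν ℕ.+ 2) C 2)

    f : ℤ → Carrier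
    f j = (q ^ ∣ (+ c₂) ℤ.* j ℤ.* j ℤ.+ j ∣) * Sref B (q ^ 3) L M ((+ (ν ℕ.+ 2)) ℤ.* j) ((+ (ν ℕ.+ 1)) ℤ.* j)

    Sr Z X : Seq
    Sr j = Sref B p L M (+ (j ℕ.+ suc ν ℕ.* j)) (+ (suc ν ℕ.* j))
    Z j = s ^ ((suc ν ℕ.* j) ℕ.* (suc ν ℕ.* j)) * Sr j
    X j = s ^ (ν ℕ.* (j ℕ.* j)) * Z j

    Z≈ : ∀ j → j ≤ M → Z j ≈ dual B ν L M j
    Z≈ j j≤M = *-congˡ (Sref-pos B L M j (suc ν ℕ.* j) j≤M)

    Sr≈0 : ∀ j → M ℕ.< j → Sr j ≈ 0#
    Sr≈0 j M<j = Sref-pos-over B L M j (suc ν ℕ.* j) M<j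

    Z≈0 : ∀ j → M ℕ.< j → Z j ≈ 0#
    Z≈0 j M<j = *-zeroʳ (Sr≈0 j M<j)

    ν+2* : ∀ j → (ν ℕ.+ 2) ℕ.* j ≡ j ℕ.+ suc ν ℕ.* j
    ν+2* j = ≡.cong (ℕ._* j) (ℕₚ.+-comm ν 2)

    ν+1* : ∀ j → (ν ℕ.+ 1) ℕ.* j ≡ suc ν ℕ.* j
    ν+1* j = ≡.cong (ℕ._* j) (ℕₚ.+-comm ν 1)

    collect : ∀ w e j t → w ≈ r ^ e →
              (w * s ^ (ν ℕ.* (j ℕ.* j))) * (s ^ ((suc ν ℕ.* j) ℕ.* (suc ν ℕ.* j)) * t)
              ≈ r ^ (e ℕ.+ 3 ℕ.* (ν ℕ.* (j ℕ.* j)) ℕ.+ 3 ℕ.* ((suc ν ℕ.* j) ℕ.* (suc ν ℕ.* j))) * t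
    collect w e j t w≈ = trans (sym (*-assoc _ _ _)) (*-congʳ (sym (trans (^-+ r (e ℕ.+ 3 ℕ.* (ν ℕ.* (j ℕ.* j))) (3 ℕ.* ((suc ν ℕ.* j) ℕ.* (suc ν ℕ.* j))))
      (*-cong (trans (^-+ r e (3 ℕ.* (ν ℕ.* (j ℕ.* j)))) (*-cong (sym w≈) (sym (s-power (ν ℕ.* (j ℕ.* j)))))) (sym (s-power ((suc ν ℕ.* j) ℕ.* (suc ν ℕ.* j))))))))

    -- From (ν+2)(ν+1) = 1 + ν + (ν+1)². The three terms come from the seed, from ν uses of
    -- `T-transform` and from `T-to-S`.
    size : ∀ j → 2 ℕ.* (c₂ ℕ.* j ℕ.* j) ≡ 3 ℕ.* (j ℕ.* j) ℕ.+ 3 ℕ.* (ν ℕ.* (j ℕ.* j)) ℕ.+ 3 ℕ.* ((suc ν ℕ.* j) ℕ.* (suc ν ℕ.* j))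
    size j = ≡.trans (ℕS.solve 2 (λ C j → ℕS.con 2 ℕS.:* (ℕS.con 3 ℕS.:* C ℕS.:* j ℕS.:* j) ℕS.:= ℕS.con 3 ℕS.:* (ℕS.con 2 ℕS.:* C) ℕS.:* (j ℕS.:* j)) ≡.refl ((ν ℕ.+ 2) C 2) j)
      (≡.trans (≡.cong (λ C → 3 ℕ.* C ℕ.* (j ℕ.* j)) (twice-C2 ν))
        (ℕS.solve 2 (λ ν j → ℕS.con 3 ℕS.:* ((ν ℕS.:+ ℕS.con 2) ℕS.:* (ν ℕS.:+ ℕS.con 1)) ℕS.:* (j ℕS.:* j)
           ℕS.:= ℕS.con 3 ℕS.:* (j ℕS.:* j) ℕS.:+ ℕS.con 3 ℕS.:* (ν ℕS.:* (j ℕS.:* j)) ℕS.:+ ℕS.con 3 ℕS.:* (((ℕS.con 1 ℕS.:+ ν) ℕS.:* j) ℕS.:* ((ℕS.con 1 ℕS.:+ ν) ℕS.:* j))) ≡.refl ν j))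

    f⁺ : ∀ j → f (+ j) ≈ w⁺ j * X j
    f⁺ j = trans (*-cong (trans (q-power ∣ (+ c₂) ℤ.* (+ j) ℤ.* (+ j) ℤ.+ (+ j) ∣) (^-congʳ r expo))
        (trans (Sref-cong B q³≈p L M (+ (ν ℕ.+ 2) ℤ.* + j) (+ (ν ℕ.+ 1) ℤ.* + j)) (reflexive (≡.cong₂ (Sref B p L M)
          (≡.trans (≡.sym (ℤₚ.pos-* (ν ℕ.+ 2) j)) (≡.cong +_ (ν+2* j))) (≡.trans (≡.sym (ℤₚ.pos-* (ν ℕ.+ 1) j)) (≡.cong +_ (ν+1* j)))))))
      (trans (sym (collect (w⁺ j) (j ℕ.* (3 ℕ.* j ℕ.+ 2)) j (Sr j) (w⁺-closed j))) (*-assoc _ _ _))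
      where
      expo : 2 ℕ.* ∣ (+ c₂) ℤ.* (+ j) ℤ.* (+ j) ℤ.+ (+ j) ∣
             ≡ j ℕ.* (3 ℕ.* j ℕ.+ 2) ℕ.+ 3 ℕ.* (ν ℕ.* (j ℕ.* j)) ℕ.+ 3 ℕ.* ((suc ν ℕ.* j) ℕ.* (suc ν ℕ.* j))
      expo = ≡.trans (≡.cong (λ z → 2 ℕ.* ∣ z ℤ.+ + j ∣) (≡.trans (≡.cong (ℤ._* + j) (≡.sym (ℤₚ.pos-* c₂ j))) (≡.sym (ℤₚ.pos-* (c₂ ℕ.* j) j))))
        (≡.trans (ℕₚ.*-distribˡ-+ 2 (c₂ ℕ.* j ℕ.* j) j) (≡.trans (≡.cong (ℕ._+ 2 ℕ.* j) (size j))
          (ℕS.solve 3 (λ j x y → ℕS.con 3 ℕS.:* (j ℕS.:* j) ℕS.:+ x ℕS.:+ y ℕS.:+ ℕS.con 2 ℕS.:* j ℕS.:= j ℕS.:* (ℕS.con 3 ℕS.:* j ℕS.:+ ℕS.con 2) ℕS.:+ x ℕS.:+ y) ≡.refl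
            j (3 ℕ.* (ν ℕ.* (j ℕ.* j))) (3 ℕ.* ((suc ν ℕ.* j) ℕ.* (suc ν ℕ.* j))))))

    f⁻ : ∀ j → f -[1+ j ] ≈ w⁻ (suc j) * X (suc j)
    f⁻ j = trans (*-cong (trans (q-power ∣ (+ c₂) ℤ.* -[1+ j ] ℤ.* -[1+ j ] ℤ.+ -[1+ j ] ∣) (^-congʳ r expo))
        (trans (Sref-cong B q³≈p L M (+ (ν ℕ.+ 2) ℤ.* -[1+ j ]) (+ (ν ℕ.+ 1) ℤ.* -[1+ j ])) (trans (reflexive (≡.cong₂ (Sref B p L M) (neg (ν ℕ.+ 2) (ν+2* j⁺)) (neg (ν ℕ.+ 1) (ν+1* j⁺)))) (even (ℕₚ.<-≤-connex M j⁺)))))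
      (trans (sym (collect (w⁻ j⁺) (j⁺ ℕ.* (3 ℕ.* j ℕ.+ 1)) j⁺ (Sr j⁺) (w⁻-closed j))) (*-assoc _ _ _))
      where
      j⁺ = suc j
      neg : ∀ x {y} → x ℕ.* j⁺ ≡ y → (+ x) ℤ.* -[1+ j ] ≡ ℤ.- (+ y)
      neg x eq = ≡.trans (≡.sym (ℤₚ.neg-distribʳ-* (+ x) (+ j⁺))) (≡.cong ℤ.-_ (≡.trans (≡.sym (ℤₚ.pos-* x j⁺)) (≡.cong +_ eq)))
      even : M ℕ.< j⁺ Sum.⊎ j⁺ ≤ M → Sref B p L M (ℤ.- (+ (j⁺ ℕ.+ suc ν ℕ.* j⁺))) (ℤ.- (+ (suc ν ℕ.* j⁺))) ≈ Sr j⁺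
      even (Sum.inj₁ M<j⁺) = trans (Sref-neg-over B L M j⁺ _ M<j⁺) (sym (Sr≈0 j⁺ M<j⁺))
      even (Sum.inj₂ j⁺≤M) = trans (Sref-neg B L M j⁺ _ j⁺≤M 2M≤B) (sym (Sref-pos B L M j⁺ _ j⁺≤M))
      y = c₂ ℕ.* j⁺ ℕ.* j⁺
      target : ℕ
      target = j⁺ ℕ.* (3 ℕ.* j ℕ.+ 1) ℕ.+ 3 ℕ.* (ν ℕ.* (j⁺ ℕ.* j⁺)) ℕ.+ 3 ℕ.* ((suc ν ℕ.* j⁺) ℕ.* (suc ν ℕ.* j⁺))
      2y : 2 ℕ.* y ≡ target ℕ.+ 2 ℕ.* j⁺
      2y = ≡.trans (size j⁺) (ℕS.solve 3 (λ j x y → ℕS.con 3 ℕS.:* ((ℕS.con 1 ℕS.:+ j) ℕS.:* (ℕS.con 1 ℕS.:+ j)) ℕS.:+ x ℕS.:+ y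
          ℕS.:= (ℕS.con 1 ℕS.:+ j) ℕS.:* (ℕS.con 3 ℕS.:* j ℕS.:+ ℕS.con 1) ℕS.:+ x ℕS.:+ y ℕS.:+ ℕS.con 2 ℕS.:* (ℕS.con 1 ℕS.:+ j)) ≡.refl
            j (3 ℕ.* (ν ℕ.* (j⁺ ℕ.* j⁺))) (3 ℕ.* ((suc ν ℕ.* j⁺) ℕ.* (suc ν ℕ.* j⁺))))
      j⁺≤y : j⁺ ≤ y
      j⁺≤y = ℕₚ.*-cancelˡ-≤ 2 (≡.subst (2 ℕ.* j⁺ ≤_) (≡.sym 2y) (ℕₚ.m≤n+m (2 ℕ.* j⁺) target))
      value : (+ c₂) ℤ.* -[1+ j ] ℤ.* -[1+ j ] ℤ.+ -[1+ j ] ≡ + (y ∸ j⁺)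
      value = ≡.trans (≡.cong (ℤ._+ -[1+ j ]) (≡.trans (sq (+ c₂) (+ j⁺)) (≡.trans (≡.cong (ℤ._* + j⁺) (≡.sym (ℤₚ.pos-* c₂ j⁺))) (≡.sym (ℤₚ.pos-* (c₂ ℕ.* j⁺) j⁺)))))
        (≡.trans (ℤₚ.m-n≡m⊖n y j⁺) (ℤₚ.⊖-≥ j⁺≤y))
        where
        sq : ∀ c j → c ℤ.* (ℤ.- j) ℤ.* (ℤ.- j) ≡ c ℤ.* j ℤ.* j
        sq = ℤS.solve 2 (λ c j → c ℤS.:* (ℤS.:- j) ℤS.:* (ℤS.:- j) ℤS.:= c ℤS.:* j ℤS.:* j) ≡.refl
      expo : 2 ℕ.* ∣ (+ c₂) ℤ.* -[1+ j ] ℤ.* -[1+ j ] ℤ.+ -[1+ j ] ∣ ≡ target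
      expo = ≡.trans (≡.cong (λ z → 2 ℕ.* ∣ z ∣) value) (≡.trans (ℕₚ.*-distribˡ-∸ 2 y j⁺)
        (≡.trans (≡.cong (_∸ 2 ℕ.* j⁺) 2y) (ℕₚ.m+n∸n≡m target (2 ℕ.* j⁺))))

    total : sumℤ B f ≈ sumTo B (λ j → (κ j * s ^ (ν ℕ.* (j ℕ.* j))) * Z j)
    total = begin
      sumTo B (λ j → f (+ j)) + sumTo B (λ j → f -[1+ j ]) + - f -[1+ B ]
        -- The term at -(B+1) vanishes since B + 1 > M. This removes the correction in `sumℤ` and
        -- lets the sum over negative indices be shifted by one.
        ≈⟨ +-cong (+-cong (sum-cong B f⁺) (sum-cong B f⁻)) (trans (-‿cong last≈0) -0#≈0#) ⟩
      sumTo B (λ j → w⁺ j * X j) + sumTo B g + 0#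
        ≈⟨ trans (+-identityʳ _) (+-congˡ (sym (sum-S B g g≈0))) ⟩
      sumTo B (λ j → w⁺ j * X j) + sumTo B (S g)
        ≈⟨ sum-+ B ⟨
      sumTo B (λ j → w⁺ j * X j + S g j)
        ≈⟨ sum-cong B (λ j → trans (fold j) (sym (*-assoc _ _ _))) ⟩
      sumTo B (λ j → (κ j * s ^ (ν ℕ.* (j ℕ.* j))) * Z j) ∎
      where
      open import Algebra.Properties.Ring ring using (-0#≈0#)
      g : Seq
      g j = w⁻ (suc j) * X (suc j)
      g≈0 : g B ≈ 0#
      g≈0 = *-zeroʳ (*-zeroʳ (Z≈0 (suc B) (ℕₚ.m<n⇒m<1+n M<B)))
      last≈0 : f -[1+ B ] ≈ 0#
      last≈0 = trans (f⁻ B) g≈0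
      fold : ∀ j → w⁺ j * X j + S g j ≈ κ j * X j
      fold zero    = +-identityʳ _
      fold (suc j) = sym (distribʳ _ _ _)

  -- Left-hand side: parity, nested sums and reduction to the chain.

  parity : ∀ t → (∃ λ u → t ≡ u ℕ.+ u) Sum.⊎ (∃ λ u → t ≡ suc (u ℕ.+ u))
  parity zero    = Sum.inj₁ (0 , ≡.refl)
  parity (suc t) with parity t
  ... | Sum.inj₁ (u , eq) = Sum.inj₂ (u , ≡.cong suc eq)
  ... | Sum.inj₂ (u , eq) = Sum.inj₁ (suc u , ≡.trans (≡.cong suc eq) (≡.cong suc (≡.sym (ℕₚ.+-suc u u))))

  double : ∀ u → u ℕ.+ u ≡ u ℕ.* 2
  double u = ≡.trans (≡.cong (u ℕ.+_) (≡.sym (ℕₚ.+-identityʳ u))) (ℕₚ.*-comm 2 u)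

  ifEven-even : ∀ {t x} u → t ≡ u ℕ.+ u → ifEven t x ≈ x
  ifEven-even {t} u eq with t ℕ.% 2 ℕ.≟ 0
  ... | yes _ = refl
  ... | no ¬0 = ⊥-elim (¬0 (≡.trans (≡.cong (ℕ._% 2) (≡.trans eq (double u))) (m*n%n≡0 u 2)))

  ifEven-odd : ∀ {t x} u → t ≡ suc (u ℕ.+ u) → ifEven t x ≈ 0#
  ifEven-odd {t} u eq with t ℕ.% 2 ℕ.≟ 0
  ... | no _ = refl
  ... | yes 0≡ with ≡.trans (≡.sym 0≡) (≡.trans (≡.cong (ℕ._% 2) (≡.trans eq (≡.cong suc (double u)))) ([m+kn]%n≡m%n 1 u 2))
  ...   | ()

  half : ∀ u → (u ℕ.+ u) ℕ./ 2 ≡ u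
  half u = ≡.trans (≡.cong (ℕ._/ 2) (double u)) (m*n/n≡m u 2)

  -- Σ (3 N_j² + N_j) is even, so the exponent of q is an integer exactly under the parity condition.
  pronic : ∀ n → ∃ λ h → 3 ℕ.* (n ℕ.* n) ℕ.+ n ≡ h ℕ.+ h
  pronic zero    = 0 , ≡.refl
  pronic (suc n) with pronic n
  ... | h , eq = h ℕ.+ (3 ℕ.* n ℕ.+ 2) , ≡.trans
    (ℕS.solve 1 (λ n → ℕS.con 3 ℕS.:* ((ℕS.con 1 ℕS.:+ n) ℕS.:* (ℕS.con 1 ℕS.:+ n)) ℕS.:+ (ℕS.con 1 ℕS.:+ n)
        ℕS.:= (ℕS.con 3 ℕS.:* (n ℕS.:* n) ℕS.:+ n) ℕS.:+ ((ℕS.con 3 ℕS.:* n ℕS.:+ ℕS.con 2) ℕS.:+ (ℕS.con 3 ℕS.:* n ℕS.:+ ℕS.con 2))) ≡.refl n)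
    (≡.trans (≡.cong (ℕ._+ (3 ℕ.* n ℕ.+ 2 ℕ.+ (3 ℕ.* n ℕ.+ 2))) eq)
      (ℕS.solve 2 (λ h x → (h ℕS.:+ h) ℕS.:+ (x ℕS.:+ x) ℕS.:= (h ℕS.:+ x) ℕS.:+ (h ℕS.:+ x)) ≡.refl h (3 ℕ.* n ℕ.+ 2)))

  pronic-N : ∀ ν n → ∃ λ h → 3 ℕ.* sumN² ν n ℕ.+ sumN ν n ≡ h ℕ.+ h
  pronic-N zero    n = 0 , ≡.refl
  pronic-N (suc ν) n with pronic (Nk (suc ν) n fzero) | pronic-N ν (λ x → n (fsuc x))
  ... | h , eq | h' , eq' = h ℕ.+ h' , ≡.trans
    (ℕS.solve 3 (λ N x y → ℕS.con 3 ℕS.:* (N ℕS.:* N ℕS.:+ x) ℕS.:+ (N ℕS.:+ y) ℕS.:= (ℕS.con 3 ℕS.:* (N ℕS.:* N) ℕS.:+ N) ℕS.:+ (ℕS.con 3 ℕS.:* x ℕS.:+ y)) ≡.refl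
       (Nk (suc ν) n fzero) (sumN² ν (λ x → n (fsuc x))) (sumN ν (λ x → n (fsuc x))))
    (≡.trans (≡.cong₂ ℕ._+_ eq eq') (ℕS.solve 2 (λ h x → (h ℕS.:+ h) ℕS.:+ (x ℕS.:+ x) ℕS.:= (h ℕS.:+ x) ℕS.:+ (h ℕS.:+ x)) ≡.refl h h'))

  q-half : ∀ m i x y u h → i ℕ.+ m ℕ.+ y ≡ u ℕ.+ u → 3 ℕ.* x ℕ.+ y ≡ h ℕ.+ h →
    q ^ ((m ℕ.* m ℕ.+ 3 ℕ.* (i ℕ.* i ℕ.+ x)) ℕ./ 2) ≈ r ^ (m ℕ.* m) * (s ^ (i ℕ.* i) * s ^ x)
  q-half m i x y u h t-even N-even with pronic m | pronic i
  ... | hm , eqm | hi , eqi = trans (q-power ((m ℕ.* m ℕ.+ 3 ℕ.* (i ℕ.* i ℕ.+ x)) ℕ./ 2)) (trans (^-congʳ r (≡.trans (≡.cong (2 ℕ.*_) (≡.trans (≡.cong (ℕ._/ 2) X≡) (half e)))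
         (≡.trans (≡.cong (e ℕ.+_) (ℕₚ.+-identityʳ e)) (≡.sym X≡))))
      (trans (^-+ r (m ℕ.* m) (3 ℕ.* (i ℕ.* i ℕ.+ x))) (*-congˡ (trans (sym (s-power (i ℕ.* i ℕ.+ x))) (^-+ s (i ℕ.* i) x)))))
    where
    X e b : ℕ
    X = m ℕ.* m ℕ.+ 3 ℕ.* (i ℕ.* i ℕ.+ x)
    -- X = (3m² + m) + (3i² + i) + (3x + y) - (i + m + y) - 2m², and the half of every term is
    -- known.
    e = (hm ℕ.+ hi ℕ.+ h) ∸ b
    b = u ℕ.+ m ℕ.* m
    sum≡ : X ℕ.+ (b ℕ.+ b) ≡ (hm ℕ.+ hi ℕ.+ h) ℕ.+ (hm ℕ.+ hi ℕ.+ h)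
    sum≡ = ≡.trans (ℕS.solve 4 (λ m i x u → m ℕS.:* m ℕS.:+ ℕS.con 3 ℕS.:* (i ℕS.:* i ℕS.:+ x) ℕS.:+ ((u ℕS.:+ m ℕS.:* m) ℕS.:+ (u ℕS.:+ m ℕS.:* m))
          ℕS.:= (ℕS.con 3 ℕS.:* (m ℕS.:* m) ℕS.:+ ℕS.con 3 ℕS.:* (i ℕS.:* i) ℕS.:+ ℕS.con 3 ℕS.:* x) ℕS.:+ (u ℕS.:+ u)) ≡.refl m i x u)
      (≡.trans (≡.cong ((3 ℕ.* (m ℕ.* m) ℕ.+ 3 ℕ.* (i ℕ.* i) ℕ.+ 3 ℕ.* x) ℕ.+_) (≡.sym t-even))
        (≡.trans (ℕS.solve 6 (λ a b c i m y → (a ℕS.:+ b ℕS.:+ c) ℕS.:+ (i ℕS.:+ m ℕS.:+ y) ℕS.:= ((a ℕS.:+ m) ℕS.:+ (b ℕS.:+ i)) ℕS.:+ (c ℕS.:+ y)) ≡.refl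
            (3 ℕ.* (m ℕ.* m)) (3 ℕ.* (i ℕ.* i)) (3 ℕ.* x) i m y)
          (≡.trans (≡.cong₂ ℕ._+_ (≡.cong₂ ℕ._+_ eqm eqi) N-even)
            (ℕS.solve 3 (λ a b c → (a ℕS.:+ a ℕS.:+ (b ℕS.:+ b)) ℕS.:+ (c ℕS.:+ c) ℕS.:= (a ℕS.:+ b ℕS.:+ c) ℕS.:+ (a ℕS.:+ b ℕS.:+ c)) ≡.refl hm hi h))))
    b≤ : b ≤ hm ℕ.+ hi ℕ.+ h
    b≤ = ℕₚ.*-cancelˡ-≤ 2 (≡.subst₂ _≤_ (≡.cong (b ℕ.+_) (≡.sym (ℕₚ.+-identityʳ b))) (≡.cong ((hm ℕ.+ hi ℕ.+ h) ℕ.+_) (≡.sym (ℕₚ.+-identityʳ _)))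
      (≡.subst (b ℕ.+ b ≤_) sum≡ (ℕₚ.m≤n+m (b ℕ.+ b) X)))
    X≡ : X ≡ e ℕ.+ e
    X≡ = ℕₚ.+-cancelʳ-≡ (b ℕ.+ b) X (e ℕ.+ e) (≡.trans sum≡ (≡.trans (≡.cong₂ ℕ._+_ (≡.sym (ℕₚ.m∸n+n≡m b≤)) (≡.sym (ℕₚ.m∸n+n≡m b≤)))
      (ℕS.solve 2 (λ e b → (e ℕS.:+ b) ℕS.:+ (e ℕS.:+ b) ℕS.:= (e ℕS.:+ e) ℕS.:+ (b ℕS.:+ b)) ≡.refl e b)))

  -- The dividend is -2(h + 1), so the division is exact. The parity condition excludes odd
  -- dividends.
  /ℕ-neg : ∀ h → -[1+ suc (h ℕ.+ h) ] /ℕ 2 ≡ -[1+ h ]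
  /ℕ-neg h with suc (suc (h ℕ.+ h)) ℕ.% 2 in eq
  ... | zero  = ≡.cong (λ n → ℤ.- (+ n)) (≡.trans (≡.cong (λ n → suc n ℕ./ 2) (≡.sym (ℕₚ.+-suc h h))) (half (suc h)))
  ... | suc _ with ≡.trans (≡.sym eq) (≡.trans (≡.cong (λ n → suc n ℕ.% 2) (≡.sym (ℕₚ.+-suc h h))) (≡.trans (≡.cong (ℕ._% 2) (double (suc h))) (m*n%n≡0 (suc h) 2)))
  ...   | ()

  qbinℤ-drop : ∀ x a d → qbinℤ x (+ a ℤ.+ -[1+ d ]) (+ a) ≈ 0#
  qbinℤ-drop x a d with ℕₚ.<-≤-connex a (suc d)
  ... | Sum.inj₁ a<d = qbinℤ-neg x a (suc d) a a<d
  ... | Sum.inj₂ d<a = trans (qbinℤ-pos x a (suc d) a d<a) (qbin-over x (a ∸ suc d) a (ℕₚ.∸-monoʳ-< (s≤s z≤n) d<a))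

  -- For i < m + y the upper entry falls below 2n, so the binomial is zero like the shifted `E`.
  -- Otherwise the parity condition makes i - m - y even, and `E-even` applies.
  E-factor : ∀ n i m y u → i ℕ.+ m ℕ.+ y ≡ u ℕ.+ u →
    qbinℤ p (+ (2 ℕ.* n) ℤ.+ ((+ i ℤ.- + m ℤ.- + y) /ℕ 2)) (+ (2 ℕ.* n)) ≈ sh m (sh y (E (suc (n ℕ.+ n)))) i
  E-factor n i m y u t-even with ℕₚ.<-≤-connex i (m ℕ.+ y)
  ... | Sum.inj₁ i<m+y with ℕₚ.m≤n⇒∃[o]m+o≡n i<m+y
  ...   | d , eqd = trans (trans (reflexive (≡.cong (λ z → qbinℤ p (+ (2 ℕ.* n) ℤ.+ (z /ℕ 2)) (+ (2 ℕ.* n))) int≡)) (neg d (parity d) ≡.refl))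
          (sym (≡⇒≈ (≡.trans (sh-sh m y _ i) (sh-over (m ℕ.+ y) _ i i<m+y))))
    where
    e : ∀ i m y → i ℤ.- m ℤ.- y ≡ i ℤ.- (m ℤ.+ y)
    e = ℤS.solve 3 (λ i m y → i ℤS.:- m ℤS.:- y ℤS.:= i ℤS.:- (m ℤS.:+ y)) ≡.refl
    int≡ : + i ℤ.- + m ℤ.- + y ≡ -[1+ d ]
    int≡ = ≡.trans (e (+ i) (+ m) (+ y)) (≡.trans (≡.cong (λ z → + i ℤ.- + z) (≡.trans (≡.sym eqd) (≡.sym (ℕₚ.+-suc i d))))
      (≡.trans (ℤₚ.m-n≡m⊖n i (i ℕ.+ suc d)) (≡.trans (ℤₚ.⊖-< (ℕₚ.m<m+n i (s≤s z≤n))) (≡.cong (λ n → ℤ.- (+ n)) (ℕₚ.m+n∸m≡n i (suc d))))))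
    neg : ∀ d' → (∃ λ h → d' ≡ h ℕ.+ h) Sum.⊎ (∃ λ h → d' ≡ suc (h ℕ.+ h)) → d' ≡ d →
          qbinℤ p (+ (2 ℕ.* n) ℤ.+ (-[1+ d' ] /ℕ 2)) (+ (2 ℕ.* n)) ≈ 0#
    neg d' (Sum.inj₂ (h , ≡.refl)) _ = trans (reflexive (≡.cong (λ z → qbinℤ p (+ (2 ℕ.* n) ℤ.+ z) (+ (2 ℕ.* n))) (/ℕ-neg h))) (qbinℤ-drop p (2 ℕ.* n) h)
    neg d' (Sum.inj₁ (h , ≡.refl)) ≡.refl = ⊥-elim (ℕₚ.even≢odd u (i ℕ.+ h) (≡.trans (≡.cong (u ℕ.+_) (ℕₚ.+-identityʳ u)) (≡.trans (≡.sym t-even)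
      (≡.trans (≡.trans (ℕₚ.+-assoc i m y) (≡.cong (i ℕ.+_) (≡.sym eqd)))
        (ℕS.solve 2 (λ i h → i ℕS.:+ (ℕS.con 1 ℕS.:+ i ℕS.:+ (h ℕS.:+ h)) ℕS.:= ℕS.con 1 ℕS.:+ (ℕS.con 2 ℕS.:* (i ℕS.:+ h))) ≡.refl i h)))))
  E-factor n i m y u t-even | Sum.inj₂ m+y≤i with ℕₚ.m≤n⇒∃[o]m+o≡n m+y≤i
  ... | d , ≡.refl with parity d
  ...   | Sum.inj₂ (h , ≡.refl) = ⊥-elim (ℕₚ.even≢odd u (m ℕ.+ y ℕ.+ h) (≡.trans (≡.cong (u ℕ.+_) (ℕₚ.+-identityʳ u)) (≡.trans (≡.sym t-even)
      (ℕS.solve 3 (λ m y h → m ℕS.:+ y ℕS.:+ (ℕS.con 1 ℕS.:+ (h ℕS.:+ h)) ℕS.:+ m ℕS.:+ y ℕS.:= ℕS.con 1 ℕS.:+ (ℕS.con 2 ℕS.:* (m ℕS.:+ y ℕS.:+ h))) ≡.refl m y h))))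
  ...   | Sum.inj₁ (h , ≡.refl) = begin
    qbinℤ p (+ (2 ℕ.* n) ℤ.+ ((+ (m ℕ.+ y ℕ.+ (h ℕ.+ h)) ℤ.- + m ℤ.- + y) /ℕ 2)) (+ (2 ℕ.* n))
      ≈⟨ reflexive (≡.cong (λ z → qbinℤ p (+ (2 ℕ.* n) ℤ.+ (z /ℕ 2)) (+ (2 ℕ.* n))) (e (+ m) (+ y) (+ (h ℕ.+ h)))) ⟩
    qbin p (2 ℕ.* n ℕ.+ (h ℕ.+ h) ℕ./ 2) (2 ℕ.* n)
      ≈⟨ reflexive (≡.cong₂ (λ a b → qbin p (a ℕ.+ b) a) (≡.cong (n ℕ.+_) (ℕₚ.+-identityʳ n)) (half h)) ⟩
    qbin p (n ℕ.+ n ℕ.+ h) (n ℕ.+ n)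
      ≈⟨ trans (E-even (n ℕ.+ n) h) (gx-qbin (n ℕ.+ n) h) ⟨
    E (suc (n ℕ.+ n)) (h ℕ.+ h)
      ≈⟨ ≡⇒≈ (≡.trans (sh-sh m y _ (m ℕ.+ y ℕ.+ (h ℕ.+ h))) (sh-at (m ℕ.+ y) _ (h ℕ.+ h))) ⟨
    sh m (sh y (E (suc (n ℕ.+ n)))) (m ℕ.+ y ℕ.+ (h ℕ.+ h)) ∎
    where
    e : ∀ m y d → m ℤ.+ y ℤ.+ d ℤ.- m ℤ.- y ≡ d
    e = ℤS.solve 3 (λ m y d → m ℤS.:+ y ℤS.:+ d ℤS.:- m ℤS.:- y ℤS.:= d) ≡.refl

  -- `E` vanishes at odd indices, which makes the parity condition automatic on the side of the
  -- series.
  E-factor-odd : ∀ d i m y u → i ℕ.+ m ℕ.+ y ≡ suc (u ℕ.+ u) → sh m (sh y (E d)) i ≈ 0#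
  E-factor-odd d i m y u t-odd with ℕₚ.<-≤-connex i (m ℕ.+ y)
  ... | Sum.inj₁ i<m+y = ≡⇒≈ (≡.trans (sh-sh m y _ i) (sh-over (m ℕ.+ y) _ i i<m+y))
  ... | Sum.inj₂ m+y≤i with ℕₚ.m≤n⇒∃[o]m+o≡n m+y≤i
  ...   | e , ≡.refl with parity e
  ...     | Sum.inj₂ (h , ≡.refl) = trans (≡⇒≈ (≡.trans (sh-sh m y _ (m ℕ.+ y ℕ.+ suc (h ℕ.+ h))) (sh-at (m ℕ.+ y) _ (suc (h ℕ.+ h))))) (E-odd d h)
  ...     | Sum.inj₁ (h , ≡.refl) = ⊥-elim (ℕₚ.even≢odd (m ℕ.+ y ℕ.+ h) u (≡.trans
      (ℕS.solve 3 (λ m y h → ℕS.con 2 ℕS.:* (m ℕS.:+ y ℕS.:+ h) ℕS.:= m ℕS.:+ y ℕS.:+ (h ℕS.:+ h) ℕS.:+ m ℕS.:+ y) ≡.refl m y h)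
      (≡.trans t-odd (≡.cong (λ n → suc (u ℕ.+ n)) (≡.sym (ℕₚ.+-identityʳ u))))))

  sum-cong-≤ : ∀ B {f g : Seq} → (∀ i → i ≤ B → f i ≈ g i) → sumTo B f ≈ sumTo B g
  sum-cong-≤ zero    eq = eq 0 z≤n
  sum-cong-≤ (suc B) eq = +-cong (sum-cong-≤ B (λ i i≤B → eq i (ℕₚ.m≤n⇒m≤1+n i≤B))) (eq (suc B) ℕₚ.≤-refl)

  sumBox-cong : ∀ k B {f g : (Fin k → ℕ) → Carrier} → (∀ v → f v ≈ g v) → sumBox k B f ≈ sumBox k B g
  sumBox-cong zero    B eq = eq []
  sumBox-cong (suc k) B eq = sum-cong B (λ x → sumBox-cong k B (λ v → eq (x ∷ v)))

  sumBox-*ˡ : ∀ k B x {f : (Fin k → ℕ) → Carrier} → sumBox k B (λ v → x * f v) ≈ x * sumBox k B f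
  sumBox-*ˡ zero    B x = refl
  sumBox-*ˡ (suc k) B x = trans (sum-cong B (λ y → sumBox-*ˡ k B x)) (sum-*ˡ B x)

  sumBox-exchange : ∀ k A B (f : ℕ → (Fin k → ℕ) → Carrier) →
    sumTo A (λ x → sumBox k B (f x)) ≈ sumBox k B (λ v → sumTo A (λ x → f x v))
  sumBox-exchange zero    A B f = refl
  sumBox-exchange (suc k) A B f = trans (sum-exchange A B (λ x y → sumBox k B (λ v → f x (y ∷ v))))
    (sum-cong B (λ y → sumBox-exchange k A B (λ x v → f x (y ∷ v))))

  sh-sumBox : ∀ n k B (f : (Fin k → ℕ) → Seq) L → sh n (λ L → sumBox k B (λ v → f v L)) L ≈ sumBox k B (λ v → sh n (f v) L)
  sh-sumBox zero    k B f L       = refl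
  sh-sumBox (suc n) k B f zero    = sym (zeros k B)
    where
    zeros : ∀ k B → sumBox k B (λ _ → 0#) ≈ 0#
    zeros zero    B = refl
    zeros (suc k) B = sum-zero B (λ _ → zeros k B)
  sh-sumBox (suc n) k B f (suc L) = sh-sumBox n k B f L

  prodFin-cong : ∀ k {f g : Fin k → Carrier} → (∀ j → f j ≈ g j) → prodFin k f ≈ prodFin k g
  prodFin-cong zero    eq = refl
  prodFin-cong (suc k) eq = *-cong (eq fzero) (prodFin-cong k (λ j → eq (fsuc j)))

  chainProd : (k : ℕ) → (Fin (suc k) → ℕ) → ℤ → Carrier
  chainProd k v ι = prodFin k (λ j → qbinℤ p (ι ℤ.- (+ prefN (suc k) v (inject₁ j)) ℤ.+ (+ v (inject₁ j))) (+ v (inject₁ j)))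

  -- What the sum over m leaves for fixed n_1, ..., n_ν. The variable i is generalized to Λ, because
  -- splitting off N_1 replaces it by i - N_1.
  inner : (k : ℕ) → (Fin (suc k) → ℕ) → Seq
  inner k v Λ = s ^ sumN² (suc k) v * (chainProd k v (+ Λ) * sh (sumN (suc k) v) (Θ (v (fromℕ k))) Λ)

  -- Splits off N_1, whose range replaces that of n_1.
  inner-step : ∀ k x v Λ → let N₂ = sumFin (suc k) v; N₁ = x ℕ.+ N₂ in
    inner (suc k) (x ∷ v) Λ ≈ s ^ (N₁ ℕ.* N₁) * sh N₁ (λ Λ → sh N₂ (gx (suc Λ)) N₁ * inner k v Λ) Λ
  inner-step k x v Λ with ℕₚ.<-≤-connex Λ (x ℕ.+ sumFin (suc k) v)
  ... | Sum.inj₁ Λ<N₁ = trans (*-congˡ (*-zeroʳ (≡⇒≈ (sh-over (N₁ ℕ.+ sumN (suc k) v) _ Λ (ℕₚ.<-≤-trans Λ<N₁ (ℕₚ.m≤m+n N₁ _))))))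
      (trans (zeroʳ _) (sym (*-zeroʳ (≡⇒≈ (sh-over N₁ _ Λ Λ<N₁)))))
    where
    N₁ = x ℕ.+ sumFin (suc k) v
  ... | Sum.inj₂ N₁≤Λ with ℕₚ.m≤n⇒∃[o]m+o≡n N₁≤Λ
  ...   | Λ' , ≡.refl = begin
    s ^ (N₁ ℕ.* N₁ ℕ.+ sumN² (suc k) v) * ((first * rest) * sh (N₁ ℕ.+ sumN (suc k) v) θ (N₁ ℕ.+ Λ'))
      ≈⟨ *-cong (^-+ s (N₁ ℕ.* N₁) (sumN² (suc k) v)) (*-cong (*-cong first≈ rest≈) (≡⇒≈ (≡.trans (≡.sym (sh-sh N₁ (sumN (suc k) v) θ (N₁ ℕ.+ Λ'))) (sh-at N₁ _ Λ')))) ⟩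
    (s ^ (N₁ ℕ.* N₁) * s ^ sumN² (suc k) v) * ((sh N₂ (gx (suc Λ')) N₁ * chainProd k v (+ Λ')) * sh (sumN (suc k) v) θ Λ')
      ≈⟨ solve 5 (λ a b c d e → (a :* b) :* ((c :* d) :* e) := a :* (c :* (b :* (d :* e)))) refl (s ^ (N₁ ℕ.* N₁)) (s ^ sumN² (suc k) v) _ _ _ ⟩
    s ^ (N₁ ℕ.* N₁) * (sh N₂ (gx (suc Λ')) N₁ * inner k v Λ')
      ≈⟨ *-congˡ (≡⇒≈ (sh-at N₁ (λ Λ → sh N₂ (gx (suc Λ)) N₁ * inner k v Λ) Λ')) ⟨
    s ^ (N₁ ℕ.* N₁) * sh N₁ (λ Λ → sh N₂ (gx (suc Λ)) N₁ * inner k v Λ) (N₁ ℕ.+ Λ') ∎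
    where
    N₂ = sumFin (suc k) v
    N₁ = x ℕ.+ N₂
    θ = Θ (v (fromℕ k))
    first = qbinℤ p (+ (N₁ ℕ.+ Λ') ℤ.- (+ N₁) ℤ.+ (+ x)) (+ x)
    rest = prodFin k (λ j → qbinℤ p (+ (N₁ ℕ.+ Λ') ℤ.- (+ (N₁ ℕ.+ prefN (suc k) v (inject₁ j))) ℤ.+ (+ v (inject₁ j))) (+ v (inject₁ j)))
    e₁ : ∀ N Λ x → N ℤ.+ Λ ℤ.- N ℤ.+ x ≡ Λ ℤ.+ x
    e₁ = ℤS.solve 3 (λ N Λ x → N ℤS.:+ Λ ℤS.:- N ℤS.:+ x ℤS.:= Λ ℤS.:+ x) ≡.refl
    e₂ : ∀ N Λ P x → N ℤ.+ Λ ℤ.- (N ℤ.+ P) ℤ.+ x ≡ Λ ℤ.- P ℤ.+ x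
    e₂ = ℤS.solve 4 (λ N Λ P x → N ℤS.:+ Λ ℤS.:- (N ℤS.:+ P) ℤS.:+ x ℤS.:= Λ ℤS.:- P ℤS.:+ x) ≡.refl
    first≈ : first ≈ sh N₂ (gx (suc Λ')) N₁
    first≈ = trans (reflexive (≡.cong (λ z → qbinℤ p z (+ x)) (e₁ (+ N₁) (+ Λ') (+ x)))) (trans (sym (gx-qbin′ Λ' x))
      (≡⇒≈ (≡.trans (≡.sym (sh-at N₂ (gx (suc Λ')) x)) (≡.cong (sh N₂ (gx (suc Λ'))) (ℕₚ.+-comm N₂ x)))))
    rest≈ : rest ≈ chainProd k v (+ Λ')
    rest≈ = prodFin-cong k (λ j → reflexive (≡.cong (λ z → qbinℤ p z (+ v (inject₁ j))) (e₂ (+ N₁) (+ Λ') (+ prefN (suc k) v (inject₁ j)) (+ v (inject₁ j)))))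

  -- A sum over n_1 becomes one over N_1 only if the shifted range can be cut back to B, hence the
  -- vanishing of `h` beyond B. In the recursion `h` is the binomial that `inner-step` produces.
  box : ∀ k B Λ (h : Seq) → (∀ N → B ℕ.< N → h N ≈ 0#) →
    sumBox (suc k) B (λ v → h (sumFin (suc k) v) * inner k v Λ) ≈ sumTo B (λ N → h N * (s ^ (N ℕ.* N) * sh N (I B k N) Λ))
  box zero B Λ h h≈0 = sum-cong B (λ x → trans (*-cong (reflexive (≡.cong h (ℕₚ.+-identityʳ x)))
      (*-cong (^-congʳ s (≡.trans (ℕₚ.+-identityʳ _) (≡.cong (λ n → n ℕ.* n) (ℕₚ.+-identityʳ x))))
        (trans (*-identityˡ _) (reflexive (≡.cong (λ n → sh n (Θ x) Λ) (≡.trans (ℕₚ.+-identityʳ _) (ℕₚ.+-identityʳ x))))))) refl)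
  box (suc k) B Λ h h≈0 = begin
    sumTo B (λ x → sumBox (suc k) B (λ v → h (x ℕ.+ sumFin (suc k) v) * inner (suc k) (x ∷ v) Λ))
      ≈⟨ sum-cong B (λ x → sumBox-cong (suc k) B (λ v → *-congˡ {h (x ℕ.+ sumFin (suc k) v)} (inner-step k x v Λ))) ⟩
    sumTo B (λ x → sumBox (suc k) B (λ v → φ v (x ℕ.+ sumFin (suc k) v)))
      ≈⟨ sumBox-exchange (suc k) B B (λ x v → φ v (x ℕ.+ sumFin (suc k) v)) ⟩
    sumBox (suc k) B (λ v → sumTo B (λ x → φ v (x ℕ.+ sumFin (suc k) v)))
      ≈⟨ sumBox-cong (suc k) B reindex ⟩
    sumBox (suc k) B (λ v → sumTo B (φ v))
      ≈⟨ sumBox-exchange (suc k) B B (λ N v → φ v N) ⟨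
    sumTo B (λ N → sumBox (suc k) B (λ v → φ v N))
      ≈⟨ sum-cong-≤ B (λ N N≤B → trans (sumBox-*ˡ (suc k) B (h N) {f = λ v → s ^ (N ℕ.* N) * ψ v N}) (*-congˡ (trans (sumBox-*ˡ (suc k) B (s ^ (N ℕ.* N)) {f = λ v → ψ v N}) (*-congˡ
           (trans (sym (sh-sumBox N (suc k) B (λ v Λ → sh (sumFin (suc k) v) (gx (suc Λ)) N * inner k v Λ) Λ))
             (sh-cong N (λ Λ → trans (box k B Λ (λ N₂ → sh N₂ (gx (suc Λ)) N) (λ N₂ B<N₂ → ≡⇒≈ (sh-over N₂ (gx (suc Λ)) N (ℕₚ.≤-<-trans N≤B B<N₂))))
                (sum-cong B (λ N₂ → solve 3 (λ a b c → a :* (b :* c) := b :* (a :* c)) refl _ _ _))) Λ)))))) ⟩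
    sumTo B (λ N → h N * (s ^ (N ℕ.* N) * sh N (I B (suc k) N) Λ)) ∎
    where
    ψ φ : (Fin (suc k) → ℕ) → Seq
    ψ v N = sh N (λ Λ → sh (sumFin (suc k) v) (gx (suc Λ)) N * inner k v Λ) Λ
    φ v N = h N * (s ^ (N ℕ.* N) * ψ v N)
    reindex : ∀ v → sumTo B (λ x → φ v (x ℕ.+ sumFin (suc k) v)) ≈ sumTo B (φ v)
    reindex v = trans (sym (sum-sh B N₂ (λ x → φ v (x ℕ.+ N₂)) (λ x B< → *-zeroˡ (h≈0 _ (≡.subst (B ℕ.<_) (ℕₚ.+-comm N₂ x) B<)))))
      (sum-cong B (λ N → shifted N (ℕₚ.<-≤-connex N N₂)))
      where
      N₂ = sumFin (suc k) v
      shifted : ∀ N → N ℕ.< N₂ Sum.⊎ N₂ ≤ N → sh N₂ (λ x → φ v (x ℕ.+ N₂)) N ≈ φ v N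
      shifted N (Sum.inj₁ N<N₂) = trans (≡⇒≈ (sh-over N₂ _ N N<N₂)) (sym (*-zeroʳ (trans (*-congˡ
        (sh-zero N (λ Λ → *-zeroˡ (≡⇒≈ (sh-over N₂ (gx (suc Λ)) N N<N₂))) Λ)) (zeroʳ _))))
      shifted N (Sum.inj₂ N₂≤N) with ℕₚ.m≤n⇒∃[o]m+o≡n N₂≤N
      ... | x , ≡.refl = ≡⇒≈ (≡.trans (sh-at N₂ _ x) (≡.cong (φ v) (ℕₚ.+-comm x N₂)))

  conv-sum : ∀ B Λ u f → Λ ≤ B → sumTo B (λ m → u m * sh m f Λ) ≈ conv u f Λ
  conv-sum B       zero    u f _         = sum-first B (λ m → zeroʳ _)
  conv-sum (suc B) (suc Λ) u f (s≤s Λ≤B) = trans (sum-head B (λ m → u m * sh m f (suc Λ))) (+-congˡ (conv-sum B Λ (λ m → u (suc m)) f Λ≤B))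

  conv-sh : ∀ n u f k → conv u (sh n f) k ≈ sh n (conv u f) k
  conv-sh zero    u f k = refl
  conv-sh (suc n) u f k = trans (conv-Sʳ u (sh n f) k) (S-cong (conv-sh n u f) k)

  -- Valid for either parity: if the condition fails, `ifEven` makes the left zero and
  -- `E-factor-odd` the right. The sum over m is thereby unrestricted and becomes a convolution.
  lhsTerm-value : ∀ k L M i m n → lhsTerm q k L M i m n
    ≈ (qbinℤ p (+ (L ℕ.+ M) ℤ.- + i) (+ L) * s ^ (i ℕ.* i))
      * ((qbinℤ p (+ L ℤ.- + sumFin (suc k) n) (+ i) * (s ^ sumN² (suc k) n * chainProd k n (+ i)))
         * (Root.cf (n (fromℕ k) ℕ.+ n (fromℕ k) ℕ.+ n (fromℕ k)) m * sh m (sh (sumN (suc k) n) (E (suc (n (fromℕ k) ℕ.+ n (fromℕ k))))) i))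
  lhsTerm-value k L M i m n with parity (i ℕ.+ m ℕ.+ sumN (suc k) n)
  ... | Sum.inj₂ (u , eq) = trans (ifEven-odd u eq)
      (sym (*-zeroʳ (*-zeroʳ (*-zeroʳ (E-factor-odd (suc (nν ℕ.+ nν)) i m (sumN (suc k) n) u eq)))))
    where nν = n (fromℕ k)
  ... | Sum.inj₁ (u , eq) with pronic-N (suc k) n
  ...   | h , N-even = trans (ifEven-even u eq) (trans
      (*-cong (*-cong (*-cong (*-cong (*-cong (q-half m i (sumN² (suc k) n) (sumN (suc k) n) u h eq N-even)
          (qbinℤ-cong q³≈p (+ (L ℕ.+ M) ℤ.- + i) (+ L)))
          (qbinℤ-cong q³≈p (+ L ℤ.- + sumFin (suc k) n) (+ i)))
          (reflexive (≡.cong (λ a → qbin q a m) (≡.trans (≡.cong (λ a → nν ℕ.+ (nν ℕ.+ a)) (ℕₚ.+-identityʳ nν)) (≡.sym (ℕₚ.+-assoc nν nν nν))))))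
          (trans (qbinℤ-cong q³≈p (+ (2 ℕ.* nν) ℤ.+ ((+ i ℤ.- + m ℤ.- + sumN (suc k) n) /ℕ 2)) (+ (2 ℕ.* nν))) (E-factor nν i m (sumN (suc k) n) u eq)))
          (prodFin-cong k (λ j → qbinℤ-cong q³≈p (+ i ℤ.- + prefN (suc k) n (inject₁ j) ℤ.+ + n (inject₁ j)) (+ n (inject₁ j)))))
      (trans (solve 8 (λ rm si sN A H b e P → (rm :* (si :* sN)) :* A :* H :* b :* e :* P
          := (A :* si) :* ((H :* (sN :* P)) :* ((rm :* b) :* e))) refl
          (r ^ (m ℕ.* m)) (s ^ (i ℕ.* i)) (s ^ sumN² (suc k) n) _ _ _ _ _)
        (*-congˡ (*-congˡ (*-congʳ (sym (Root.cf-qbin (nν ℕ.+ nν ℕ.+ nν) m)))))))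
    where nν = n (fromℕ k)

  lhs-chain : ∀ k B L M → L ℕ.< B →
    Q.LHS R q k B L M ≈ sumTo B (λ i → s ^ (i ℕ.* i) * (sh i (gx (suc L)) M * sh i (λ μ → I B (suc k) μ i) L))
  lhs-chain k B L M L<B = sum-cong-≤ B (λ i i≤B → begin
    sumTo B (λ m → sumBox (suc k) B (λ n → lhsTerm q k L M i m n))
      ≈⟨ sum-cong B (λ m → trans (sumBox-cong (suc k) B (lhsTerm-value k L M i m)) (sumBox-*ˡ (suc k) B (c₀ i) {f = λ n → outer i n * tail i m n})) ⟩
    sumTo B (λ m → c₀ i * sumBox (suc k) B (λ n → outer i n * tail i m n))
      ≈⟨ trans (sum-*ˡ B (c₀ i)) (*-congˡ (sumBox-exchange (suc k) B B (λ m n → outer i n * tail i m n))) ⟩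
    c₀ i * sumBox (suc k) B (λ n → sumTo B (λ m → outer i n * tail i m n))
      ≈⟨ *-congˡ (sumBox-cong (suc k) B (λ n → trans (sum-*ˡ B (outer i n)) (trans
           (*-congˡ (trans (conv-sum B i (u n) (sh (sumN (suc k) n) (e n)) i≤B) (conv-sh (sumN (suc k) n) (u n) (e n) i)))
           (trans (*-assoc (hh i (sumFin (suc k) n)) _ _) (*-congˡ (*-assoc (s ^ sumN² (suc k) n) (chainProd k n (+ i)) _)))))) ⟩
    c₀ i * sumBox (suc k) B (λ n → hh i (sumFin (suc k) n) * inner k n i)
      ≈⟨ *-congˡ (box k B i (hh i) (λ N B<N → qbinℤ-neg p L N i (ℕₚ.<-trans L<B B<N))) ⟩
    c₀ i * sumTo B (λ N → hh i N * (s ^ (N ℕ.* N) * sh N (I B k N) i))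
      ≈⟨ *-cong (trans (*-comm _ _) (*-congˡ (qbinℤ-sh L M i))) (last i (ℕₚ.<-≤-connex L i)) ⟩
    (s ^ (i ℕ.* i) * sh i (gx (suc L)) M) * sh i (λ μ → I B (suc k) μ i) L
      ≈⟨ *-assoc _ _ _ ⟩
    s ^ (i ℕ.* i) * (sh i (gx (suc L)) M * sh i (λ μ → I B (suc k) μ i) L) ∎)
    where
    c₀ : Seq
    c₀ i = qbinℤ p (+ (L ℕ.+ M) ℤ.- + i) (+ L) * s ^ (i ℕ.* i)
    hh : ℕ → Seq
    hh i N = qbinℤ p (+ L ℤ.- + N) (+ i)
    u e : (Fin (suc k) → ℕ) → Seq
    u n = Root.cf (n (fromℕ k) ℕ.+ n (fromℕ k) ℕ.+ n (fromℕ k))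
    e n = E (suc (n (fromℕ k) ℕ.+ n (fromℕ k)))
    tail : ℕ → ℕ → (Fin (suc k) → ℕ) → Carrier
    tail i m n = u n m * sh m (sh (sumN (suc k) n) (e n)) i
    outer : ℕ → (Fin (suc k) → ℕ) → Carrier
    outer i n = hh i (sumFin (suc k) n) * (s ^ sumN² (suc k) n * chainProd k n (+ i))
    -- With L = i + μ the binomial of L - N over i is the one in `I B (suc k) μ i`, so this factor
    -- supplies the last of the ν transformations T → T.
    last : ∀ i → L ℕ.< i Sum.⊎ i ≤ L → sumTo B (λ N → hh i N * (s ^ (N ℕ.* N) * sh N (I B k N) i)) ≈ sh i (λ μ → I B (suc k) μ i) L
    last i (Sum.inj₁ L<i) = trans (sum-zero B (λ N → *-zeroˡ (none N (ℕₚ.<-≤-connex L N)))) (sym (≡⇒≈ (sh-over i _ L L<i)))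
      where
      none : ∀ N → L ℕ.< N Sum.⊎ N ≤ L → hh i N ≈ 0#
      none N (Sum.inj₁ L<N) = qbinℤ-neg p L N i L<N
      none N (Sum.inj₂ N≤L) = trans (qbinℤ-pos p L N i N≤L) (qbin-over p (L ∸ N) i (ℕₚ.≤-<-trans (ℕₚ.m∸n≤m L N) L<i))
    last i (Sum.inj₂ i≤L) with ℕₚ.m≤n⇒∃[o]m+o≡n i≤L
    ... | μ , ≡.refl = trans (sum-cong B (λ N → trans (*-congʳ (qbinℤ-sh i μ N)) (solve 3 (λ a b c → a :* (b :* c) := b :* (a :* c)) refl _ _ _)))
      (≡⇒≈ (≡.sym (sh-at i (λ μ → I B (suc k) μ i) μ)))

  theorem-with-root : ∀ k B L M → L ℕ.< B → M ℕ.< B → M ℕ.+ M ≤ B → Q.LHS R q k B L M ≈ Q.RHS R q k B L M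
  theorem-with-root k B L M L<B M<B 2M≤B = trans (lhs-chain k B L M L<B)
    (trans (chain (suc k) L M L<B M<B Z Z≈ Z≈0) (sym total))
    where open RightSide (suc k) B L M M<B 2M≤B

-- Compatibility of both sides with ring homomorphisms.

module Transfer {c ℓ c′ ℓ′ : Level} (R : CommutativeRing c ℓ) (R′ : CommutativeRing c′ ℓ′) where
  private
    module A = CommutativeRing R
    module B = CommutativeRing R′
    module QA = Q R
    module QB = Q R′
  open B using (_≈_; _+_; _*_; refl; sym; trans; +-cong; *-cong)

  -- `Q` at two rings yields two copies of each function on natural numbers. They are identified by
  -- recursion before the terms can be compared.
  sumFin-≡ : ∀ k {f g} → (∀ j → f j ≡ g j) → QA.sumFin k f ≡ QB.sumFin k g
  sumFin-≡ zero    eq = ≡.refl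
  sumFin-≡ (suc k) eq = ≡.cong₂ ℕ._+_ (eq fzero) (sumFin-≡ k (λ j → eq (fsuc j)))

  Nk-≡ : ∀ k n l → QA.Nk k n l ≡ QB.Nk k n l
  Nk-≡ (suc k) n fzero    = sumFin-≡ (suc k) {n} {n} (λ _ → ≡.refl)
  Nk-≡ (suc k) n (fsuc l) = Nk-≡ k (λ x → n (fsuc x)) l

  sumN-≡ : ∀ k n → QA.sumN k n ≡ QB.sumN k n
  sumN-≡ k n = sumFin-≡ k (Nk-≡ k n)

  sumN²-≡ : ∀ k n → QA.sumN² k n ≡ QB.sumN² k n
  sumN²-≡ k n = sumFin-≡ k (λ l → ≡.cong₂ ℕ._*_ (Nk-≡ k n l) (Nk-≡ k n l))

  pre-≡ : ∀ k {f g} → (∀ j → f j ≡ g j) → ∀ l → QA.pre k f l ≡ QB.pre k g l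
  pre-≡ (suc k) eq fzero    = eq fzero
  pre-≡ (suc k) eq (fsuc l) = ≡.cong₂ ℕ._+_ (eq fzero) (pre-≡ k (λ j → eq (fsuc j)) l)

  module Along (φ : A.Carrier → B.Carrier)
               (φ-0 : φ A.0# ≈ B.0#) (φ-1 : φ A.1# ≈ B.1#)
               (φ-+ : ∀ x y → φ (x A.+ y) ≈ φ x + φ y) (φ-* : ∀ x y → φ (x A.* y) ≈ φ x * φ y)
               (φ-neg : ∀ x → φ (A.- x) ≈ B.- φ x) where
    private
      open module PA = Algebra.Properties.Semiring.Exp A.semiring using () renaming (_^_ to _^ᴬ_)
      open module PB = Algebra.Properties.Semiring.Exp B.semiring using () renaming (_^_ to _^ᴮ_)

    Maps : A.Carrier → B.Carrier → Set ℓ′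
    Maps x y = φ x ≈ y

    map-+ : ∀ {x x′ y y′} → Maps x y → Maps x′ y′ → Maps (x A.+ x′) (y + y′)
    map-+ e e′ = trans (φ-+ _ _) (+-cong e e′)

    map-* : ∀ {x x′ y y′} → Maps x y → Maps x′ y′ → Maps (x A.* x′) (y * y′)
    map-* e e′ = trans (φ-* _ _) (*-cong e e′)

    map-^ : ∀ {x y} n → Maps x y → Maps (x ^ᴬ n) (y ^ᴮ n)
    map-^ zero    e = φ-1
    map-^ (suc n) e = map-* e (map-^ n e)

    map-qbin : ∀ {x y} → Maps x y → ∀ n k → Maps (QA.qbin x n k) (QB.qbin y n k)
    map-qbin e zero    zero    = φ-1
    map-qbin e zero    (suc k) = φ-0
    map-qbin e (suc n) zero    = φ-1
    map-qbin e (suc n) (suc k) = map-+ (map-qbin e n k) (map-* (map-^ (suc k) e) (map-qbin e n (suc k)))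

    map-qbinℤ : ∀ {x y} → Maps x y → ∀ {a a′ b b′} → a ≡ a′ → b ≡ b′ → Maps (QA.qbinℤ x a b) (QB.qbinℤ y a′ b′)
    map-qbinℤ e {+ a}      {b = + b}      ≡.refl ≡.refl = map-qbin e a b
    map-qbinℤ e {+ a}      {b = -[1+ b ]} ≡.refl ≡.refl = φ-0
    map-qbinℤ e { -[1+ a ]} {b = b}        ≡.refl ≡.refl = φ-0

    map-qbinℤ′ : ∀ {x y} → Maps x y → ∀ a b → Maps (QA.qbinℤ x a b) (QB.qbinℤ y a b)
    map-qbinℤ′ e a b = map-qbinℤ e {a} {b = b} ≡.refl ≡.refl

    map-sumTo : ∀ B {f g} → (∀ i → Maps (f i) (g i)) → Maps (QA.sumTo B f) (QB.sumTo B g)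
    map-sumTo zero    e = e 0
    map-sumTo (suc B) e = map-+ (map-sumTo B e) (e (suc B))

    map-sumℤ : ∀ B {f g} → (∀ i → Maps (f i) (g i)) → Maps (QA.sumℤ B f) (QB.sumℤ B g)
    map-sumℤ B e = map-+ (map-+ (map-sumTo B (λ j → e (+ j))) (map-sumTo B (λ j → e -[1+ j ])))
                         (trans (φ-neg _) (B.-‿cong (e -[1+ B ])))

    map-sumBox : ∀ k B {f g} → (∀ v → Maps (f v) (g v)) → Maps (QA.sumBox k B f) (QB.sumBox k B g)
    map-sumBox zero    B e = e []
    map-sumBox (suc k) B e = map-sumTo B (λ x → map-sumBox k B (λ v → e (x ∷ v)))

    map-prodFin : ∀ k {f g} → (∀ j → Maps (f j) (g j)) → Maps (QA.prodFin k f) (QB.prodFin k g)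
    map-prodFin zero    e = φ-1
    map-prodFin (suc k) e = map-* (e fzero) (map-prodFin k (λ j → e (fsuc j)))

    map-ifEven : ∀ {t t′ x y} → t ≡ t′ → Maps x y → Maps (QA.ifEven t x) (QB.ifEven t′ y)
    map-ifEven {t} ≡.refl e with t ℕ.% 2 ℕ.≟ 0
    ... | yes _ = e
    ... | no  _ = φ-0

    map-Sref : ∀ {x y} → Maps x y → ∀ B L M a b → Maps (QA.Sref B x L M a b) (QB.Sref B y L M a b)
    map-Sref e B L M a b = map-sumTo B (λ n → map-* (map-* (map-* (map-^ ∣ + n ℤ.* (+ n ℤ.+ a) ∣ e)
      (map-qbinℤ′ e (+ (M ℕ.+ L) ℤ.- a ℤ.- + (2 ℕ.* n)) (+ M))) (map-qbinℤ′ e (+ M ℤ.- a ℤ.+ b) (+ n)))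
      (map-qbinℤ′ e (+ M ℤ.+ a ℤ.- b) (+ n ℤ.+ a)))

    map-RHS : ∀ {x y} → Maps x y → ∀ k B L M → Maps (QA.RHS x k B L M) (QB.RHS y k B L M)
    map-RHS e k B L M = map-sumℤ B (λ j → map-*
      (map-^ ∣ + (3 ℕ.* ((suc k ℕ.+ 2) C 2)) ℤ.* j ℤ.* j ℤ.+ j ∣ e)
      (map-Sref (map-^ 3 e) B L M (+ (suc k ℕ.+ 2) ℤ.* j) (+ (suc k ℕ.+ 1) ℤ.* j)))

    map-lhsTerm : ∀ {x y} → Maps x y → ∀ k L M i m n → Maps (QA.lhsTerm x k L M i m n) (QB.lhsTerm y k L M i m n)
    map-lhsTerm {x} {y} e k L M i m n = map-ifEven (≡.cong (i ℕ.+ m ℕ.+_) (sumN-≡ (suc k) n))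
      (map-* (map-* (map-* (map-* (map-*
        (power (≡.cong (λ z → (m ℕ.* m ℕ.+ 3 ℕ.* (i ℕ.* i ℕ.+ z)) ℕ./ 2) (sumN²-≡ (suc k) n)))
        (map-qbinℤ′ e³ (+ (L ℕ.+ M) ℤ.- + i) (+ L)))
        (map-qbinℤ e³ (≡.cong (λ z → + L ℤ.- + z) (Nk-≡ (suc k) n fzero)) ≡.refl))
        (map-qbinℤ′ e (+ (3 ℕ.* n (fromℕ k))) (+ m)))
        (map-qbinℤ e³ (≡.cong (λ z → + (2 ℕ.* n (fromℕ k)) ℤ.+ ((+ i ℤ.- + m ℤ.- + z) /ℕ 2)) (sumN-≡ (suc k) n)) ≡.refl))
        (map-prodFin k (λ j → map-qbinℤ e³ (≡.cong (λ z → + i ℤ.- + z ℤ.+ + n (inject₁ j)) (pre-≡ (suc k) (Nk-≡ (suc k) n) (inject₁ j))) ≡.refl)))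
      where
      e³ = map-^ 3 e
      power : ∀ {a b} → a ≡ b → Maps (x ^ᴬ a) (y ^ᴮ b)
      power {a} ≡.refl = map-^ a e

    map-LHS : ∀ {x y} → Maps x y → ∀ k B L M → Maps (QA.LHS x k B L M) (QB.LHS y k B L M)
    map-LHS e k B L M = map-sumTo B (λ i → map-sumTo B (λ m → map-sumBox (suc k) B (map-lhsTerm e k L M i m)))

-- R embeds in R[√q], where the half-integral powers of q used by the proof exist.
module SquareRoot {c ℓ : Level} (R : CommutativeRing c ℓ) (q : CommutativeRing.Carrier R) where
  open CommutativeRing R
  open import Algebra.Solver.Ring.NaturalCoefficients.Default commutativeSemiring
    using (solve; _:=_; _:+_; _:*_; con)
  import Algebra.Construct.DirectProduct as Product

  -- The pair (a , b) stands for a + b√q.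
  _⊠_ : Carrier × Carrier → Carrier × Carrier → Carrier × Carrier
  (a , b) ⊠ (x , y) = a * x + q * (b * y) , a * y + b * x

  extension : CommutativeRing c ℓ
  extension = record
    { Carrier = Carrier × Carrier
    ; _≈_ = AbelianGroup._≈_ add
    ; _+_ = AbelianGroup._∙_ add
    ; _*_ = _⊠_
    ; -_  = AbelianGroup._⁻¹ add
    ; 0#  = 0# , 0#
    ; 1#  = 1# , 0#
    ; isCommutativeRing = record
      { isRing = record
        { +-isAbelianGroup = AbelianGroup.isAbelianGroup add
        ; *-cong = λ (a , b) (x , y) →
            +-cong (*-cong a x) (*-congˡ (*-cong b y)) , +-cong (*-cong a y) (*-cong b x)
        ; *-assoc = λ (a , b) (x , y) (u , v) →
            solve 7 (λ q a b x y u v → (a :* x :+ q :* (b :* y)) :* u :+ q :* ((a :* y :+ b :* x) :* v)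
              := a :* (x :* u :+ q :* (y :* v)) :+ q :* (b :* (x :* v :+ y :* u))) refl q a b x y u v ,
            solve 7 (λ q a b x y u v → (a :* x :+ q :* (b :* y)) :* v :+ (a :* y :+ b :* x) :* u
              := a :* (x :* v :+ y :* u) :+ b :* (x :* u :+ q :* (y :* v))) refl q a b x y u v
        ; *-identity =
            (λ (a , b) → solve 3 (λ q a b → con 1 :* a :+ q :* (con 0 :* b) := a) refl q a b ,
                         solve 2 (λ a b → con 1 :* b :+ con 0 :* a := b) refl a b) ,
            (λ (a , b) → solve 3 (λ q a b → a :* con 1 :+ q :* (b :* con 0) := a) refl q a b ,
                         solve 2 (λ a b → a :* con 0 :+ b :* con 1 := b) refl a b)
        ; distrib =
            (λ (a , b) (x , y) (u , v) →
              solve 7 (λ q a b x y u v → a :* (x :+ u) :+ q :* (b :* (y :+ v))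
                := (a :* x :+ q :* (b :* y)) :+ (a :* u :+ q :* (b :* v))) refl q a b x y u v ,
              solve 6 (λ a b x y u v → a :* (y :+ v) :+ b :* (x :+ u)
                := (a :* y :+ b :* x) :+ (a :* v :+ b :* u)) refl a b x y u v) ,
            (λ (a , b) (x , y) (u , v) →
              solve 7 (λ q a b x y u v → (x :+ u) :* a :+ q :* ((y :+ v) :* b)
                := (x :* a :+ q :* (y :* b)) :+ (u :* a :+ q :* (v :* b))) refl q a b x y u v ,
              solve 6 (λ a b x y u v → (x :+ u) :* b :+ (y :+ v) :* a
                := (x :* b :+ y :* a) :+ (u :* b :+ v :* a)) refl a b x y u v)
        }
      ; *-comm = λ (a , b) (x , y) →
          solve 5 (λ q a b x y → a :* x :+ q :* (b :* y) := x :* a :+ q :* (y :* b)) refl q a b x y ,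
          solve 4 (λ a b x y → a :* y :+ b :* x := x :* b :+ y :* a) refl a b x y
      }
    }
    where
    open import Algebra.Bundles using (AbelianGroup)
    add = Product.abelianGroup +-abelianGroup +-abelianGroup

  open import Algebra.Properties.Ring ring using (-0#≈0#)
  private module X = CommutativeRing extension

  ι : Carrier → X.Carrier
  ι x = x , 0#

  root : X.Carrier
  root = 0# , 1#

  ι-q : ι q X.≈ root X.* root
  ι-q = solve 1 (λ q → q := con 0 :* con 0 :+ q :* (con 1 :* con 1)) refl q ,
        solve 0 (con 0 := con 0 :* con 1 :+ con 1 :* con 0) refl

  ι-+ : ∀ x y → ι (x + y) X.≈ ι x X.+ ι y
  ι-+ x y = refl , sym (+-identityʳ _)

  ι-* : ∀ x y → ι (x * y) X.≈ ι x X.* ι y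
  ι-* x y = solve 3 (λ q x y → x :* y := x :* y :+ q :* (con 0 :* con 0)) refl q x y ,
            solve 2 (λ x y → con 0 := x :* con 0 :+ con 0 :* y) refl x y

  open Transfer.Along R extension ι (refl , refl) (refl , refl) ι-+ ι-* (λ x → refl , sym -0#≈0#)
    public using (map-LHS; map-RHS)

theorem6p2 : {c ℓ : Level} (R : CommutativeRing c ℓ) (q : CommutativeRing.Carrier R)
    (k L M : ℕ) → ∃[ B₀ ] ((B : ℕ) → B₀ ≤ B →
    CommutativeRing._≈_ R (Q.LHS R q k B L M) (Q.RHS R q k B L M))
theorem6p2 R q k L M = suc (L ℕ.+ (M ℕ.+ M)) , λ B B₀≤B → proj₁ (begin
  -- Equality in the extension is componentwise, so the first component of an equality between
  -- values of `ι` is an equality in R.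
  ι (Q.LHS R q k B L M)
    ≈⟨ map-LHS ι-q k B L M ⟩
  Q.LHS extension (root * root) k B L M
    -- The bound `suc (L + (M + M))` puts B above L, above M and at least at M + M. The last of
    -- these keeps the reflected sums for negative j complete.
    ≈⟨ Hierarchy.theorem-with-root extension root k B L M
         (ℕₚ.≤-trans (s≤s (ℕₚ.m≤m+n L (M ℕ.+ M))) B₀≤B)
         (ℕₚ.≤-trans (s≤s (ℕₚ.≤-trans (ℕₚ.m≤m+n M M) (ℕₚ.m≤n+m (M ℕ.+ M) L))) B₀≤B)
         (ℕₚ.≤-trans (ℕₚ.≤-trans (ℕₚ.m≤n+m (M ℕ.+ M) L) (ℕₚ.n≤1+n _)) B₀≤B) ⟩
  Q.RHS extension (root * root) k B L M
    ≈⟨ map-RHS ι-q k B L M ⟨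
  ι (Q.RHS R q k B L M) ∎)
  where
  open SquareRoot R q
  open CommutativeRing extension using (_*_; setoid)
  open import Relation.Binary.Reasoning.Setoid setoid
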